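{- Let $q$ be a prime power, let $H=\mathrm{PG}(2,q)$ be embedded as a plane in $\mathrm{PG}(3,q)$, and let $\mathcal{K}$ be a $q$-arc in $H$. Define the incidence structure $(\mathcal{P},\mathcal{L},\mathcal{I})$, with incidence given by containment, as follows. The points $\mathcal{P}$ are the lines of $\mathrm{PG}(3,q)$ not contained in $H$ that pass through a point of $\mathcal{K}$. The lines $\mathcal{L}$ are (1) the affine points of $\mathrm{PG}(3,q)$, i.e. the points not in $H$, and (2) the planes of $\mathrm{PG}(3,q)$, different from $H$, that contain a tangent line to $\mathcal{K}$. Then $(\mathcal{P},\mathcal{L},\mathcal{I})$ is a generalised quadrangle of order $(q-1,q+1)$. Moreover, if $q$ is odd, it is isomorphic to the Ahrens–Szekeres generalised quadrangle $\mathrm{AS}(q)$.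
   Context: A $k$-arc in a projective plane is a set of $k$ points no three of which are collinear. A tangent line to an arc is a line meeting it in exactly one point. A generalised quadrangle (GQ) of order $(s,t)$ is a point-line incidence structure with the following properties: every line has $s+1$ points; every point is on $t+1$ lines; two points are on at most one common line; and for every point $P$ and line $L$ with $P$ not on $L$ there is a unique point on $L$ collinear with $P$. $\mathrm{AS}(q)$, for $q$ odd, denotes the generalised quadrangle of order $(q-1,q+1)$ constructed by Ahrens and Szekeres. -}

module Defs where

open import Data.Nat using (ℕ; zero; suc)
open import Data.Fin using (Fin; zero; suc)
open import Data.Product using (Σ; ∃; ∃-syntax; _×_; _,_)
open import Data.Sum using (_⊎_; inj₁; inj₂)
open import Data.Empty using (⊥)
open import Relation.Nullary using (¬_)
open import Relation.Binary.PropositionalEquality using (_≡_; _≢_)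
open import Algebra.Structures using (IsCommutativeRing)

record Field : Set₁ where
  infixl 6 _+_
  infixl 7 _*_
  field
    Carrier : Set
    _+_ _*_ : Carrier → Carrier → Carrier
    -_ : Carrier → Carrier
    0# 1# : Carrier
    isCommutativeRing : IsCommutativeRing _≡_ _+_ _*_ -_ 0# 1#
    0≢1 : 0# ≢ 1#
    inverse : ∀ x → x ≢ 0# → ∃[ y ] (x * y ≡ 1#)

-- Abstract point–line incidence structures, with equality of points and
-- of lines given by (equivalence) relations, so that geometric objects
-- can be represented by coordinates up to the appropriate equivalence.

record IncStr : Set₁ where
  field
    Pt Ln : Set
    _≈P_ : Pt → Pt → Set
    _≈L_ : Ln → Ln → Set
    _I_ : Pt → Ln → Set

module _ (S : IncStr) where
  open IncStr S

  Collinear : Pt → Pt → Set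
  Collinear P Q = ∃[ M ] (P I M × Q I M)

  record IsGQ (s t : ℕ) : Set where
    field
      linePoints : ∀ L → Σ (Fin (suc s) → Pt) λ f →
        (∀ i → f i I L) × (∀ i j → f i ≈P f j → i ≡ j) ×
        (∀ P → P I L → ∃[ i ] (P ≈P f i))
      pointLines : ∀ P → Σ (Fin (suc t) → Ln) λ g →
        (∀ i → P I g i) × (∀ i j → g i ≈L g j → i ≡ j) ×
        (∀ L → P I L → ∃[ i ] (L ≈L g i))
      atMostOneLine : ∀ P Q L M → ¬ (P ≈P Q) →
        P I L → Q I L → P I M → Q I M → L ≈L M
      uniqueProjection : ∀ P L → ¬ (P I L) →
        Σ Pt λ Q → Q I L × Collinear P Q ×
          (∀ R → R I L → Collinear P R → R ≈P Q)

record Isomorphism (A B : IncStr) : Set where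
  module A = IncStr A
  module B = IncStr B
  field
    fP : A.Pt → B.Pt
    fL : A.Ln → B.Ln
    fP-resp : ∀ P Q → A._≈P_ P Q → B._≈P_ (fP P) (fP Q)
    fP-inj  : ∀ P Q → B._≈P_ (fP P) (fP Q) → A._≈P_ P Q
    fP-surj : ∀ P' → ∃[ P ] B._≈P_ (fP P) P'
    fL-resp : ∀ L M → A._≈L_ L M → B._≈L_ (fL L) (fL M)
    fL-inj  : ∀ L M → B._≈L_ (fL L) (fL M) → A._≈L_ L M
    fL-surj : ∀ L' → ∃[ L ] B._≈L_ (fL L) L'
    inc-pres : ∀ P L → A._I_ P L → B._I_ (fP P) (fL L)
    inc-refl : ∀ P L → B._I_ (fP P) (fL L) → A._I_ P L

Isomorphic : IncStr → IncStr → Set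
Isomorphic A B = Isomorphism A B

module Proj (𝔽 : Field) where
  open Field 𝔽

  Vec : ℕ → Set
  Vec n = Fin n → Carrier

  dot : ∀ {n} → Vec n → Vec n → Carrier
  dot {zero}  a b = 0#
  dot {suc n} a b = a zero * b zero + dot (λ i → a (suc i)) (λ i → b (suc i))

  NonZero : ∀ {n} → Vec n → Set
  NonZero v = ¬ (∀ i → v i ≡ 0#)

  -- u and v represent the same projective point (hyperplane)
  Prop : ∀ {n} → Vec n → Vec n → Set
  Prop u v = ∃[ c ] (c ≢ 0# × (∀ i → u i ≡ c * v i))

  InSpan : ∀ {n} → Vec n → Vec n → Vec n → Set
  InSpan p u w = ∃[ λ₁ ] ∃[ μ ] (∀ i → p i ≡ λ₁ * u i + μ * w i)

  Independent : ∀ {n} → Vec n → Vec n → Set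
  Independent u w = ∀ λ₁ μ → (∀ i → λ₁ * u i + μ * w i ≡ 0#) → (λ₁ ≡ 0#) × (μ ≡ 0#)

  -- three points of PG(2,q) are collinear: some line of PG(2,q)
  -- (a nonzero covector a, the line being {x | a·x = 0}) contains them
  Collinear3 : Vec 3 → Vec 3 → Vec 3 → Set
  Collinear3 x y z = ∃[ a ] (NonZero a × dot a x ≡ 0# × dot a y ≡ 0# × dot a z ≡ 0#)

  record IsArc {k : ℕ} (K : Fin k → Vec 3) : Set where
    field
      nonzero   : ∀ i → NonZero (K i)
      distinct  : ∀ i j → i ≢ j → ¬ Prop (K i) (K j)
      noThree   : ∀ i j l → i ≢ j → j ≢ l → i ≢ l → ¬ Collinear3 (K i) (K j) (K l)

  Tangent : ∀ {k} → (Fin k → Vec 3) → Vec 3 → Set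
  Tangent K a = NonZero a × ∃[ i ] (dot a (K i) ≡ 0# × (∀ j → dot a (K j) ≡ 0# → j ≡ i))

  -- PG(3,q) has coordinates x0,x1,x2,x3; H is the plane x3 = 0, and
  -- PG(2,q) is identified with H via  (x0,x1,x2) ↦ (x0,x1,x2,0).
  embed : Vec 3 → Vec 4
  embed x zero = x zero
  embed x (suc zero) = x (suc zero)
  embed x (suc (suc zero)) = x (suc (suc zero))
  embed x (suc (suc (suc zero))) = 0#

  x₃ : Vec 4 → Carrier
  x₃ v = v (suc (suc (suc zero)))

  hH : Vec 4
  hH (suc (suc (suc zero))) = 1#
  hH _ = 0#

  record PLine : Set where
    constructor pline
    field
      u w : Vec 4
      indep : Independent u w

  OnLine : Vec 4 → PLine → Set
  OnLine p (pline u w _) = NonZero p × InSpan p u w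

  SameLine : PLine → PLine → Set
  SameLine ℓ m = ∀ p → (OnLine p ℓ → OnLine p m) × (OnLine p m → OnLine p ℓ)

  LineInH : PLine → Set
  LineInH ℓ = ∀ p → OnLine p ℓ → x₃ p ≡ 0#

  PlaneContains : Vec 4 → PLine → Set
  PlaneContains b ℓ = ∀ p → OnLine p ℓ → dot b p ≡ 0#

  PlaneContainsHLine : Vec 4 → Vec 3 → Set
  PlaneContainsHLine b a = ∀ x → NonZero x → dot a x ≡ 0# → dot b (embed x) ≡ 0#

  module Construction {k : ℕ} (K : Fin k → Vec 3) where

    Point : Set
    Point = Σ PLine λ ℓ → ¬ LineInH ℓ × ∃[ i ] OnLine (embed (K i)) ℓ

    AffinePoint : Set
    AffinePoint = Σ (Vec 4) λ x → x₃ x ≢ 0#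

    TangentPlane : Set
    TangentPlane = Σ (Vec 4) λ b → NonZero b × ¬ Prop b hH ×
                     ∃[ a ] (Tangent K a × PlaneContainsHLine b a)

    Line : Set
    Line = AffinePoint ⊎ TangentPlane

    _≈P_ : Point → Point → Set
    (ℓ , _) ≈P (m , _) = SameLine ℓ m

    _≈L_ : Line → Line → Set
    inj₁ (x , _) ≈L inj₁ (y , _) = Prop x y
    inj₂ (b , _) ≈L inj₂ (c , _) = Prop b c
    _ ≈L _ = ⊥

    _I_ : Point → Line → Set
    (ℓ , _) I inj₁ (x , _) = OnLine x ℓ
    (ℓ , _) I inj₂ (b , _) = PlaneContains b ℓ

    structure : IncStr
    structure = record { Pt = Point ; Ln = Line ; _≈P_ = _≈P_ ; _≈L_ = _≈L_ ; _I_ = _I_ }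

-- The Ahrens–Szekeres quadrangle AS(q) (Payne–Thas, FGQ 3.2.6):
-- points: points (x,y,z) of AG(3,q); lines: the curves
--  (i)   x = σ, y = a, z = b
--  (ii)  x = a, y = σ, z = b
--  (iii) x = cσ² − bσ + a, y = −2cσ + b, z = σ      (σ ∈ GF(q)).

module ASq (𝔽 : Field) where
  open Field 𝔽

  Point : Set
  Point = Carrier × Carrier × Carrier

  Line : Set
  Line = (Carrier × Carrier) ⊎ (Carrier × Carrier) ⊎ (Carrier × Carrier × Carrier)

  two : Carrier
  two = 1# + 1#

  _I_ : Point → Line → Set
  (x , y , z) I inj₁ (a , b) = y ≡ a × z ≡ b
  (x , y , z) I inj₂ (inj₁ (a , b)) = x ≡ a × z ≡ b
  (x , y , z) I inj₂ (inj₂ (a , b , c)) =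
    x ≡ c * (z * z) + - (b * z) + a × y ≡ - (two * c * z) + b

  structure : IncStr
  structure = record { Pt = Point ; Ln = Line ; _≈P_ = _≡_ ; _≈L_ = _≡_ ; _I_ = _I_ }

{-# OPTIONS --safe #-}
-- Each point of a q-arc lies on two tangents, and the functionals T_i, U_i of the two tangents at the i-th
-- point turn the lines not in H through that point into pairs (T_i X , U_i X), X affine.  The quadrangle
-- axioms then reduce to the fact that the other lines of the pencil are exactly the q − 1 secants, i.e. that
-- the ratios T_i/U_i at the other points of the arc exhaust the nonzero field elements.
--
-- For q odd, Segre's lemma of tangents (a product over the field) shows that the 2q tangents belong to an
-- envelope of class 4 which, restricted to the pencil of a point of the arc, is (T_i U_i)² up to a constant.
-- Hence a point off the arc lying on five tangents is joined to every point of the arc by a tangent, and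
-- completes the arc to an oval.  Such a point exists for q ≥ 5: the number τ of tangents through a vector
-- off the arc is odd, while the first two moments of τ contradict (τ − 1)(τ − 3) ≤ 0.
-- In affine coordinates with the new point at infinity the oval is a graph; the lemma of tangents says that
-- the slope of a chord is the mean of the slopes at its ends, so the graph is a parabola.  Parametrising the
-- arc as (σ², 2σ, 1), the functionals of the tangents are precisely the equations of the curves (iii) of AS(q).
module Submission where

-- The envelope is never written down as a polynomial. For six points of the arc and a point `P`,
-- the restricted quartics are interpolated instead: a quartic form on six nodes has vanishing
-- divided difference, which gives a 6 by 6 matrix with zero row sums. The lemma of tangents makes
-- this matrix antisymmetric off the diagonal, so the diagonal sums to zero too, and its entries are
-- nonzero multiples of `(T_i U_i)²` at `P`. The square is forced: the product of the
-- `det (K i) (K j) (K c)` over `c` is symmetric in `i` and `j` only up to sign. Two tangents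
-- squared give degree 4, hence six nodes.
--
-- Completing the arc matters because it leaves a single tangent at each old point; the lemma of
-- tangents at the new point is then a linear relation between slopes, which can be summed around a
-- triangle.
--
-- Tangents are counted through vectors, not projective points, so the zero vector needs a
-- correction. The resulting inequality `q(q - 2)(q - 4) ≤ 3` is contradictory from `q = 5` on but
-- true for `q = 3`, where the arc is extended by hand.

open import Defs
open import Algebra.Bundles using (CommutativeMonoid; CommutativeRing)
import Algebra.Properties.CommutativeMonoid.Sum as MonoidSum
import Algebra.Properties.Ring as RingProperties
import Algebra.Properties.Semiring.Mult.TCOptimised as Mult
import Algebra.Properties.Semiring.Sum as SemiringSum
import Algebra.Solver.Ring
import Algebra.Solver.Ring.AlmostCommutativeRing as ACR
open import Data.Bool.Base using (Bool; true; false)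
open import Data.Empty using (⊥-elim)
open import Data.Fin using (Fin; zero; suc; join; punchIn; punchOut; splitAt; _↑ˡ_; _↑ʳ_)
open import Data.Fin.Permutation using (permutation)
open import Data.Fin.Properties using (¬Fin0; ¬∀⟶∃¬; all?; any?; injective⇒≤; join-splitAt; punchIn-injective;
  punchIn-punchOut; punchInᵢ≢i; punchOut-injective; splitAt-↑ʳ; splitAt-↑ˡ; suc-injective)
  renaming (_≟_ to _≟F_)
open import Data.Integer.Base as ℤ using (ℤ)
import Data.Integer.Properties as ℤₚ
open import Data.Maybe.Base using (Maybe; just; nothing)
open import Data.Nat as ℕ using (ℕ; _∸_; zero; suc; s≤s; z≤n)
open import Data.Nat.Divisibility using (_∣_; divides)
import Data.Nat.Properties as ℕₚ
import Data.Nat.Solver as ℕSolver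
open import Data.Product using (Σ; ∃-syntax; _×_; _,_; proj₁; proj₂)
open import Data.Sum using (_⊎_; inj₁; inj₂; [_,_]′)
open import Data.Sum.Properties using (inj₁-injective)
open import Data.Vec.Base using ([]; _∷_) renaming (Vec to Tuple)
open import Data.Vec.Functional using (removeAt)
open import Function.Base using (_∘_)
open import Function.Bundles using (_↔_; Inverse)
open import Function.Definitions using (Injective)
open import Level using (0ℓ)
open import Relation.Binary.PropositionalEquality
open import Relation.Nullary using (¬_; Dec; yes; no; ¬?)
open import Relation.Nullary.Decidable using (_×-dec_; decidable-stable; map′)

-- Ring solver with integer coefficients over an arbitrary field

module FieldSolver (𝔽 : Field) where
  open import Data.Integer.Base using (+_; -[1+_]; _⊖_)
  open Field 𝔽 using (Carrier; isCommutativeRing)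

  commutativeRing : CommutativeRing _ _
  commutativeRing = record { isCommutativeRing = isCommutativeRing }

  private
    open CommutativeRing commutativeRing hiding (Carrier; isCommutativeRing; sym; trans; refl; reflexive)
    open RingProperties ring using (-‿distribˡ-*; -‿distribʳ-*; -‿involutive; -‿+-comm; -0#≈0#)
    open Mult semiring using (1+×; ×-homo-+; ×1-homo-*) renaming (_×_ to _×ⁿ_)

    -- The optimised multiple reduces `1 ×ⁿ 1#` to `1#`, so `:1` denotes `1#` definitionally and
    -- `1-homo` is `refl`.
    ⟦_⟧ℤ : ℤ → Carrier
    ⟦ + n ⟧ℤ = n ×ⁿ 1#
    ⟦ -[1+ n ] ⟧ℤ = - (suc n ×ⁿ 1#)

    open ≡-Reasoning

    ⊖-homo : ∀ m n → ⟦ m ⊖ n ⟧ℤ ≡ m ×ⁿ 1# + - (n ×ⁿ 1#)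
    ⊖-homo zero zero = sym (-‿inverseʳ 0#)
    ⊖-homo zero (suc n) = sym (+-identityˡ _)
    ⊖-homo (suc m) zero = sym (trans (cong (λ z → suc m ×ⁿ 1# + z) -0#≈0#) (+-identityʳ _))
    ⊖-homo (suc m) (suc n) = begin
      ⟦ suc m ⊖ suc n ⟧ℤ ≡⟨ cong ⟦_⟧ℤ (ℤₚ.[1+m]⊖[1+n]≡m⊖n m n) ⟩
      ⟦ m ⊖ n ⟧ℤ ≡⟨ ⊖-homo m n ⟩
      M + - N ≡⟨ cong (_+ - N) (sym (+-identityˡ M)) ⟩
      (0# + M) + - N ≡⟨ cong (λ z → (z + M) + - N) (sym (-‿inverseʳ 1#)) ⟩
      ((1# + - 1#) + M) + - N ≡⟨ cong (_+ - N) (+-assoc _ _ _) ⟩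
      (1# + (- 1# + M)) + - N ≡⟨ cong (λ z → (1# + z) + - N) (+-comm _ _) ⟩
      (1# + (M + - 1#)) + - N ≡⟨ cong (_+ - N) (sym (+-assoc _ _ _)) ⟩
      ((1# + M) + - 1#) + - N ≡⟨ +-assoc _ _ _ ⟩
      (1# + M) + (- 1# + - N) ≡⟨ cong (λ z → (1# + M) + z) (-‿+-comm 1# N) ⟩
      (1# + M) + - (1# + N) ≡⟨ sym (cong₂ (λ a b → a + - b) (1+× m 1#) (1+× n 1#)) ⟩
      suc m ×ⁿ 1# + - (suc n ×ⁿ 1#) ∎
      where
      M = m ×ⁿ 1#
      N = n ×ⁿ 1#

    +-homo : ∀ i j → ⟦ i ℤ.+ j ⟧ℤ ≡ ⟦ i ⟧ℤ + ⟦ j ⟧ℤ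
    +-homo (+ m) (+ n) = ×-homo-+ 1# m n
    +-homo (+ m) -[1+ n ] = ⊖-homo m (suc n)
    +-homo -[1+ m ] (+ n) = trans (⊖-homo n (suc m)) (+-comm _ _)
    +-homo -[1+ m ] -[1+ n ] = begin
      - (suc (suc (m ℕ.+ n)) ×ⁿ 1#) ≡⟨ cong (λ k → - (k ×ⁿ 1#)) (cong suc (sym (ℕₚ.+-suc m n))) ⟩
      - ((suc m ℕ.+ suc n) ×ⁿ 1#) ≡⟨ cong -_ (×-homo-+ 1# (suc m) (suc n)) ⟩
      - (suc m ×ⁿ 1# + suc n ×ⁿ 1#) ≡⟨ sym (-‿+-comm _ _) ⟩
      - (suc m ×ⁿ 1#) + - (suc n ×ⁿ 1#) ∎

    neg-homo : ∀ i → ⟦ ℤ.- i ⟧ℤ ≡ - ⟦ i ⟧ℤ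
    neg-homo (+ zero) = sym -0#≈0#
    neg-homo (+ suc n) = refl
    neg-homo -[1+ n ] = sym (-‿involutive _)

    pos-homo : ∀ m n → ⟦ + m ℤ.* + n ⟧ℤ ≡ ⟦ + m ⟧ℤ * ⟦ + n ⟧ℤ
    pos-homo m n = trans (cong ⟦_⟧ℤ (sym (ℤₚ.pos-* m n))) (×1-homo-* m n)

    *-homo : ∀ i j → ⟦ i ℤ.* j ⟧ℤ ≡ ⟦ i ⟧ℤ * ⟦ j ⟧ℤ
    *-homo (+ m) (+ n) = pos-homo m n
    *-homo (+ m) -[1+ n ] = begin
      ⟦ + m ℤ.* ℤ.- (+ suc n) ⟧ℤ ≡⟨ cong ⟦_⟧ℤ (sym (ℤₚ.neg-distribʳ-* (+ m) (+ suc n))) ⟩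
      ⟦ ℤ.- (+ m ℤ.* + suc n) ⟧ℤ ≡⟨ neg-homo (+ m ℤ.* + suc n) ⟩
      - ⟦ + m ℤ.* + suc n ⟧ℤ ≡⟨ cong -_ (pos-homo m (suc n)) ⟩
      - (⟦ + m ⟧ℤ * ⟦ + suc n ⟧ℤ) ≡⟨ -‿distribʳ-* _ _ ⟩
      ⟦ + m ⟧ℤ * - ⟦ + suc n ⟧ℤ ∎
    *-homo -[1+ m ] (+ n) = begin
      ⟦ ℤ.- (+ suc m) ℤ.* + n ⟧ℤ ≡⟨ cong ⟦_⟧ℤ (sym (ℤₚ.neg-distribˡ-* (+ suc m) (+ n))) ⟩
      ⟦ ℤ.- (+ suc m ℤ.* + n) ⟧ℤ ≡⟨ neg-homo (+ suc m ℤ.* + n) ⟩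
      - ⟦ + suc m ℤ.* + n ⟧ℤ ≡⟨ cong -_ (pos-homo (suc m) n) ⟩
      - (⟦ + suc m ⟧ℤ * ⟦ + n ⟧ℤ) ≡⟨ -‿distribˡ-* _ _ ⟩
      - ⟦ + suc m ⟧ℤ * ⟦ + n ⟧ℤ ∎
    *-homo -[1+ m ] -[1+ n ] = begin
      ⟦ + suc m ℤ.* + suc n ⟧ℤ ≡⟨ pos-homo (suc m) (suc n) ⟩
      M * N ≡⟨ sym (-‿involutive _) ⟩
      - (- (M * N)) ≡⟨ cong -_ (-‿distribˡ-* _ _) ⟩
      - ((- M) * N) ≡⟨ -‿distribʳ-* _ _ ⟩
      (- M) * (- N) ∎
      where
      M = suc m ×ⁿ 1#
      N = suc n ×ⁿ 1#

    ACRing = ACR.fromCommutativeRing commutativeRing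

    morphism : ℤ.+-*-rawRing ACR.-Raw-AlmostCommutative⟶ ACRing
    morphism = record
      { ⟦_⟧ = ⟦_⟧ℤ ; +-homo = +-homo ; *-homo = *-homo ; -‿homo = neg-homo
      ; 0-homo = refl ; 1-homo = refl }

    dec : ∀ i j → Maybe (⟦ i ⟧ℤ ≡ ⟦ j ⟧ℤ)
    dec i j with i ℤₚ.≟ j
    ... | yes p = just (cong ⟦_⟧ℤ p)
    -- Different integers may coincide in the field; the solver then only loses strength.
    ... | no _ = nothing

  open Algebra.Solver.Ring ℤ.+-*-rawRing ACRing morphism dec public
    using (solve; _:=_; _:+_; _:*_; :-_; _:-_; con)

  pattern :0 = con (+ 0)
  pattern :1 = con (+ 1)

-- Finite fields

-- Pigeonhole: a surjection would have an injective section from `Fin n` to `Fin m`. This is the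
-- source of tangents, as lines of a pencil left over by the arc.
missing : ∀ {m n} (f : Fin m → Fin n) → m ℕ.< n → ∃[ y ] (∀ x → f x ≢ y)
missing {m} {n} f m<n with ¬∀⟶∃¬ n (λ y → ∃[ x ] f x ≡ y) (λ y → any? (λ x → f x ≟F y)) notOnto
  where
  notOnto : ¬ (∀ y → ∃[ x ] f x ≡ y)
  notOnto onto = ℕₚ.<⇒≱ m<n (injective⇒≤ {f = λ y → proj₁ (onto y)} λ {y} {z} eq →
    trans (sym (proj₂ (onto y))) (trans (cong f eq) (proj₂ (onto z))))
... | y , ∄x = y , λ x eq → ∄x (x , eq)

-- A missed value could be punched out of the codomain, leaving an injection into a smaller set.
injective⇒surjective : ∀ {n} (f : Fin n → Fin n) → Injective _≡_ _≡_ f → ∀ y → ∃[ x ] f x ≡ y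
injective⇒surjective {suc n} f inj y = decidable-stable (any? (λ x → f x ≟F y)) λ ∄x →
  ℕₚ.1+n≰n (injective⇒≤ {f = λ x → punchOut (λ eq → ∄x (x , sym eq))}
    λ {a} {b} eq → inj (punchOut-injective (λ e → ∄x (a , sym e)) (λ e → ∄x (b , sym e)) eq))

splitAt-injective : ∀ m {n} {a b : Fin (m ℕ.+ n)} → splitAt m a ≡ splitAt m b → a ≡ b
splitAt-injective m {n} {a} {b} eq =
  trans (sym (join-splitAt m n a)) (trans (cong (join m n) eq) (join-splitAt m n b))

-- Sums and products of families that agree off one or two indices

module _ (M : CommutativeMonoid 0ℓ 0ℓ) where
  open CommutativeMonoid M renaming (refl to ≈-refl; trans to ≈-trans; sym to ≈-sym)
  open MonoidSum M

  -- The common remainder is returned as an element, so two products over a full index set can be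
  -- compared at the exceptional index alone.
  agree-off-one : ∀ {n} (f g : Fin n → Carrier) i → (∀ c → c ≢ i → f c ≈ g c) →
    ∃[ r ] (sum f ≈ f i ∙ r × sum g ≈ g i ∙ r)
  agree-off-one {suc n} f g i same = sum (removeAt f i) , sum-remove f ,
    ≈-trans (sum-remove g)
      (∙-congˡ (≈-sym (sum-cong-≋ λ c → same (punchIn i c) (punchInᵢ≢i i c))))

  agree-off-two : ∀ {n} (f g : Fin n → Carrier) {i j} → i ≢ j →
    (∀ c → c ≢ i → c ≢ j → f c ≈ g c) →
    ∃[ r ] (sum f ≈ (f i ∙ f j) ∙ r × sum g ≈ (g i ∙ g j) ∙ r)
  agree-off-two {suc n} f g {i} {j} i≢j same = r , split f (proj₁ (proj₂ rest)) , split g (proj₂ (proj₂ rest))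
    where
    rest = agree-off-one (removeAt f i) (removeAt g i) (punchOut i≢j)
      λ c c≢ → same (punchIn i c) (punchInᵢ≢i i c)
        λ eq → c≢ (punchIn-injective i _ _ (trans eq (sym (punchIn-punchOut i≢j))))
    r = proj₁ rest
    split : ∀ h → sum (removeAt h i) ≈ h (punchIn i (punchOut i≢j)) ∙ r → sum h ≈ (h i ∙ h j) ∙ r
    split h eq = ≈-trans (sum-remove {i = i} h) (≈-trans (∙-congˡ
      (≈-trans eq (reflexive (cong (λ k → h k ∙ r) (punchIn-punchOut i≢j))))) (≈-sym (assoc _ _ _)))

module FiniteField (𝔽 : Field) (q : ℕ) (enum : Field.Carrier 𝔽 ↔ Fin q) where
  open Field 𝔽 public hiding (isCommutativeRing)
  open FieldSolver 𝔽 public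
  open CommutativeRing commutativeRing public
    using (+-comm; +-assoc; *-comm; *-assoc; +-identityˡ; +-identityʳ; *-identityˡ; *-identityʳ;
           zeroˡ; zeroʳ; -‿inverseʳ; distribˡ; *-commutativeMonoid; +-commutativeMonoid; semiring)
  open MonoidSum *-commutativeMonoid public
    using () renaming (sum to Π; sum-cong-≗ to Π-cong; ∑-distrib-+ to Π-distrib-*; sum-permute to Π-permute)
  open SemiringSum semiring public
    using () renaming (sum to ∑; sum-cong-≗ to ∑-cong; ∑-distrib-+ to ∑-distrib-+; ∑-comm to ∑-comm; sum-remove to ∑-remove;
                       *-distribˡ-sum to *-distribˡ-∑)

  el : Fin q → Carrier
  el = Inverse.from enum

  ix : Carrier → Fin q
  ix = Inverse.to enum

  el-ix : ∀ x → el (ix x) ≡ x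
  el-ix = Inverse.strictlyInverseʳ enum

  ix-el : ∀ i → ix (el i) ≡ i
  ix-el = Inverse.strictlyInverseˡ enum

  ix-injective : ∀ {x y} → ix x ≡ ix y → x ≡ y
  ix-injective {x} {y} eq = trans (sym (el-ix x)) (trans (cong el eq) (el-ix y))

  el-injective : ∀ {i j} → el i ≡ el j → i ≡ j
  el-injective {i} {j} eq = trans (sym (ix-el i)) (trans (cong ix eq) (ix-el j))

  infix 4 _≟_
  _≟_ : (x y : Carrier) → Dec (x ≡ y)
  x ≟ y = map′ ix-injective (cong ix) (ix x ≟F ix y)

  1≢0 : 1# ≢ 0#
  1≢0 eq = 0≢1 (sym eq)

  opaque
    recip : Carrier → Carrier
    recip x with x ≟ 0#
    ... | yes _ = 0#
    ... | no x≢0 = proj₁ (inverse x x≢0)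

    recipʳ : ∀ {x} → x ≢ 0# → x * recip x ≡ 1#
    recipʳ {x} x≢0 with x ≟ 0#
    ... | yes eq = ⊥-elim (x≢0 eq)
    ... | no ne = proj₂ (inverse x ne)

  recipˡ : ∀ {x} → x ≢ 0# → recip x * x ≡ 1#
  recipˡ x≢0 = trans (*-comm _ _) (recipʳ x≢0)

  *-cancelˡ : ∀ {a x y} → a ≢ 0# → a * x ≡ a * y → x ≡ y
  *-cancelˡ {a} {x} {y} a≢0 eq = trans (shrink x) (trans (cong (recip a *_) eq) (sym (shrink y)))
    where
    shrink : ∀ z → z ≡ recip a * (a * z)
    shrink z = trans (sym (*-identityˡ z)) (trans (cong (_* z) (sym (recipˡ a≢0))) (*-assoc _ _ _))

  *-≡0 : ∀ {x y} → x ≢ 0# → x * y ≡ 0# → y ≡ 0#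
  *-≡0 x≢0 eq = *-cancelˡ x≢0 (trans eq (sym (zeroʳ _)))

  *-≢0 : ∀ {x y} → x ≢ 0# → y ≢ 0# → x * y ≢ 0#
  *-≢0 x≢0 y≢0 eq = y≢0 (*-≡0 x≢0 eq)

  *-≢0ʳ : ∀ {x y} → x * y ≢ 0# → y ≢ 0#
  *-≢0ʳ ne eq = ne (trans (cong (_ *_) eq) (zeroʳ _))

  *-zero-cases : ∀ {x y} → x * y ≡ 0# → x ≡ 0# ⊎ y ≡ 0#
  *-zero-cases {x} eq with x ≟ 0#
  ... | yes x≡0 = inj₁ x≡0
  ... | no x≢0 = inj₂ (*-≡0 x≢0 eq)

  recip-≢0 : ∀ {x} → x ≢ 0# → recip x ≢ 0#
  recip-≢0 x≢0 = *-≢0ʳ {_} (λ eq → 1≢0 (trans (sym (recipʳ x≢0)) eq))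

  -‿≢0 : ∀ {x} → x ≢ 0# → - x ≢ 0#
  -‿≢0 {x} x≢0 eq = x≢0 (trans (solve 1 (λ x → x := :- (:- x)) refl x)
    (trans (cong -_ eq) (solve 0 (:- :0 := :0) refl)))

  x-y≡0⇒x≡y : ∀ {x y} → x + - y ≡ 0# → x ≡ y
  x-y≡0⇒x≡y {x} {y} eq = trans (solve 2 (λ x y → x := (x :- y) :+ y) refl x y)
    (trans (cong (_+ y) eq) (+-identityˡ y))

  x≡y⇒x-y≡0 : ∀ {x y} → x ≡ y → x + - y ≡ 0#
  x≡y⇒x-y≡0 {x} refl = -‿inverseʳ x

  *-recip-cancel : ∀ {a b c} → b ≢ 0# → a ≡ c * b → a * recip b ≡ c
  *-recip-cancel {a} {b} {c} b≢0 refl =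
    trans (*-assoc c b _) (trans (cong (c *_) (recipʳ b≢0)) (*-identityʳ c))

  recip-unmul : ∀ {a b} → b ≢ 0# → (a * recip b) * b ≡ a
  recip-unmul {a} b≢0 = trans (*-assoc a _ _) (trans (cong (a *_) (recipˡ b≢0)) (*-identityʳ a))

  Π-≢0 : ∀ {n} (f : Fin n → Carrier) → (∀ i → f i ≢ 0#) → Π f ≢ 0#
  Π-≢0 {zero} f ne = 1≢0
  Π-≢0 {suc n} f ne = *-≢0 (ne zero) (Π-≢0 (f ∘ suc) (ne ∘ suc))

  Π-agree₂ : ∀ {n} (f g : Fin n → Carrier) {i j} → i ≢ j →
    (∀ c → c ≢ i → c ≢ j → f c ≡ g c) →
    ∃[ r ] (Π f ≡ (f i * f j) * r × Π g ≡ (g i * g j) * r)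
  Π-agree₂ = agree-off-two *-commutativeMonoid

  Π-agree₁ : ∀ {n} (f g : Fin n → Carrier) i →
    (∀ c → c ≢ i → f c ≡ g c) → ∃[ r ] (Π f ≡ f i * r × Π g ≡ g i * r)
  Π-agree₁ = agree-off-one *-commutativeMonoid

  module _ (u : Fin q → Carrier) (u-inj : ∀ {i j} → u i ≡ u j → i ≡ j) where
    injective⇒onto : ∀ x → ∃[ i ] u i ≡ x
    injective⇒onto x with injective⇒surjective (ix ∘ u) (λ eq → u-inj (ix-injective eq)) (ix x)
    ... | i , eq = i , ix-injective eq

    -- An injective enumeration of the field by `Fin q` differs from `el` by a permutation.
    Π-reindex : (g : Carrier → Carrier) → Π (g ∘ u) ≡ Π (g ∘ el)
    Π-reindex g = sym (trans (Π-permute (g ∘ el) (permutation (ix ∘ u) (proj₁ ∘ onto) (proj₂ ∘ onto)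
      (λ i → u-inj (ix-injective (proj₂ (onto (ix (u i)))))))) (Π-cong λ i → cong g (el-ix (u i))))
      where onto = injective⇒surjective (ix ∘ u) (λ eq → u-inj (ix-injective eq))

  -- Replacing a zero factor by 1 lets products run over all of Fin q although some factors vanish.
  opaque
    nz : Carrier → Carrier
    nz x with x ≟ 0#
    ... | yes _ = 1#
    ... | no _ = x

    nz-≢0 : ∀ x → nz x ≢ 0#
    nz-≢0 x with x ≟ 0#
    ... | yes _ = 1≢0
    ... | no ne = ne

    nz-0 : ∀ {x} → x ≡ 0# → nz x ≡ 1#
    nz-0 {x} eq with x ≟ 0#
    ... | yes _ = refl
    ... | no ne = ⊥-elim (ne eq)

    nz-id : ∀ {x} → x ≢ 0# → nz x ≡ x
    nz-id {x} ne with x ≟ 0#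
    ... | yes eq = ⊥-elim (ne eq)
    ... | no _ = refl

  nz-* : ∀ {a w} → a ≢ 0# → w ≢ 0# → nz (a * w) ≡ a * nz w
  nz-* a≢0 w≢0 = trans (nz-id (*-≢0 a≢0 w≢0)) (cong (_ *_) (sym (nz-id w≢0)))

  -- The scalars come out of `nz` except at the zero `j` of `w`, where `nz` is `1#` with or without
  -- scaling. The factor `a j` on the left makes up for this.
  Π-nz-scale : ∀ {n} (a w : Fin n → Carrier) (j : Fin n) → (∀ c → a c ≢ 0#) → w j ≡ 0# →
    (∀ c → c ≢ j → w c ≢ 0#) → a j * Π (λ c → nz (a c * w c)) ≡ Π a * Π (nz ∘ w)
  Π-nz-scale a w j a≢0 wj≡0 w≢0 with Π-agree₁ (λ c → nz (a c * w c)) (λ c → a c * nz (w c)) j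
      (λ c c≢j → nz-* (a≢0 c) (w≢0 c c≢j))
  ... | r , eq₁ , eq₂ = begin
    a j * Π (λ c → nz (a c * w c)) ≡⟨ cong (a j *_) eq₁ ⟩
    a j * (nz (a j * w j) * r) ≡⟨ cong (λ z → a j * (z * r)) (nz-0 (trans (cong (a j *_) wj≡0) (zeroʳ _))) ⟩
    a j * (1# * r) ≡⟨ solve 2 (λ a r → a :* (:1 :* r) := (a :* :1) :* r) refl (a j) r ⟩
    (a j * 1#) * r ≡⟨ cong (λ z → (a j * z) * r) (sym (nz-0 wj≡0)) ⟩
    (a j * nz (w j)) * r ≡⟨ sym eq₂ ⟩
    Π (λ c → a c * nz (w c)) ≡⟨ Π-distrib-* a (nz ∘ w) ⟩
    Π a * Π (nz ∘ w) ∎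
    where open ≡-Reasoning

  W : Carrier
  W = Π (nz ∘ el)

  Π-nz-translate : ∀ (u : Fin q → Carrier) → (∀ {i j} → u i ≡ u j → i ≡ j) → ∀ x →
    Π (λ c → nz (x + - u c)) ≡ W
  Π-nz-translate u u-inj x = Π-reindex (λ c → x + - u c)
    (λ {i} {j} eq → u-inj (trans (lem (u i)) (trans (cong (λ z → x + - z) eq) (sym (lem (u j)))))) nz
    where
    lem : ∀ y → y ≡ x + - (x + - y)
    lem y = solve 2 (λ x y → y := x :- (x :- y)) refl x y

  -- Multiplication by `z` permutes the field. The product of the nonzero elements is scaled by only
  -- `q - 1` factors; the extra factor `z` accounts for the index of `0#`.
  fermat : ∀ {z} → z ≢ 0# → Π {q} (λ _ → z) ≡ z
  fermat {z} z≢0 = *-cancelˡ (Π-≢0 (nz ∘ el) (nz-≢0 ∘ el)) (begin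
    W * Π {q} (λ _ → z) ≡⟨ *-comm _ _ ⟩
    Π {q} (λ _ → z) * W ≡⟨ sym (Π-nz-scale (λ _ → z) el (ix 0#) (λ _ → z≢0) (el-ix 0#)
                             (λ c c≢ eq → c≢ (trans (sym (ix-el c)) (cong ix eq)))) ⟩
    z * Π (λ c → nz (z * el c)) ≡⟨ cong (z *_) (Π-reindex (λ c → z * el c) (λ eq → el-injective (*-cancelˡ z≢0 eq)) nz) ⟩
    z * W ≡⟨ *-comm _ _ ⟩
    W * z ∎)
    where open ≡-Reasoning

-- Vectors in dimension three

module Geometry (𝔽 : Field) (q : ℕ) (enum : Field.Carrier 𝔽 ↔ Fin q) where
  open FiniteField 𝔽 q enum

  record V : Set where
    constructor vec
    field v₀ v₁ v₂ : Carrier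
  open V public

  infixl 7 _∙_ _⨯_
  infixr 8 _·_
  infixl 6 _⊕_
  infix 4 _≟V_

  0V : V
  0V = vec 0# 0# 0#

  vec-cong : ∀ {a b c x y z} → a ≡ x → b ≡ y → c ≡ z → vec a b c ≡ vec x y z
  vec-cong refl refl refl = refl

  _≟V_ : (X Y : V) → Dec (X ≡ Y)
  vec a b c ≟V vec x y z with a ≟ x | b ≟ y | c ≟ z
  ... | yes refl | yes refl | yes refl = yes refl
  ... | no ne | _ | _ = no λ { refl → ne refl }
  ... | _ | no ne | _ = no λ { refl → ne refl }
  ... | _ | _ | no ne = no λ { refl → ne refl }

  opaque
    _∙_ : V → V → Carrier
    vec a b c ∙ vec x y z = a * x + b * y + c * z

    _⨯_ : V → V → V
    vec a b c ⨯ vec x y z = vec (b * z + - (c * y)) (c * x + - (a * z)) (a * y + - (b * x))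

    _·_ : Carrier → V → V
    s · vec x y z = vec (s * x) (s * y) (s * z)

    _⊕_ : V → V → V
    vec a b c ⊕ vec x y z = vec (a + x) (b + y) (c + z)

  det : V → V → V → Carrier
  det X Y Z = X ∙ (Y ⨯ Z)

  opaque
    unfolding _∙_ _⨯_ _·_ _⊕_

    ∙-⊕ʳ : ∀ T X Y → T ∙ (X ⊕ Y) ≡ T ∙ X + T ∙ Y
    ∙-⊕ʳ (vec a b c) (vec x y z) (vec u v w) = solve 9 (λ a b c x y z u v w →
      a :* (x :+ u) :+ b :* (y :+ v) :+ c :* (z :+ w) :=
      (a :* x :+ b :* y :+ c :* z) :+ (a :* u :+ b :* v :+ c :* w)) refl a b c x y z u v w

    ∙-·ʳ : ∀ T s X → T ∙ (s · X) ≡ s * (T ∙ X)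
    ∙-·ʳ (vec a b c) s (vec x y z) = solve 7 (λ a b c s x y z →
      a :* (s :* x) :+ b :* (s :* y) :+ c :* (s :* z) := s :* (a :* x :+ b :* y :+ c :* z)) refl a b c s x y z

    ∙-comm : ∀ X Y → X ∙ Y ≡ Y ∙ X
    ∙-comm (vec a b c) (vec x y z) = solve 6 (λ a b c x y z →
      a :* x :+ b :* y :+ c :* z := x :* a :+ y :* b :+ z :* c) refl a b c x y z

    ∙-·ˡ : ∀ s T X → (s · T) ∙ X ≡ s * (T ∙ X)
    ∙-·ˡ s T X = trans (∙-comm (s · T) X) (trans (∙-·ʳ X s T) (cong (s *_) (∙-comm X T)))

    ∙-⊕ˡ : ∀ S T X → (S ⊕ T) ∙ X ≡ S ∙ X + T ∙ X
    ∙-⊕ˡ S T X = trans (∙-comm (S ⊕ T) X) (trans (∙-⊕ʳ X S T) (cong₂ _+_ (∙-comm X S) (∙-comm X T)))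

    0V-∙ : ∀ X → 0V ∙ X ≡ 0#
    0V-∙ (vec x y z) = solve 3 (λ x y z → :0 :* x :+ :0 :* y :+ :0 :* z := :0) refl x y z

    ∙-0V : ∀ X → X ∙ 0V ≡ 0#
    ∙-0V X = trans (∙-comm X 0V) (0V-∙ X)

    ∙-≢0⇒≢0V : ∀ {T X} → T ∙ X ≢ 0# → T ≢ 0V
    ∙-≢0⇒≢0V {X = X} ne refl = ne (0V-∙ X)

    ·-≡0V : ∀ {s X} → s ≢ 0# → s · X ≡ 0V → X ≡ 0V
    ·-≡0V s≢0 eq = vec-cong (*-≡0 s≢0 (cong v₀ eq)) (*-≡0 s≢0 (cong v₁ eq)) (*-≡0 s≢0 (cong v₂ eq))

    ·-· : ∀ a b X → a · (b · X) ≡ (a * b) · X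
    ·-· a b X = vec-cong (sym (*-assoc _ _ _)) (sym (*-assoc _ _ _)) (sym (*-assoc _ _ _))

    1· : ∀ X → 1# · X ≡ X
    1· X = vec-cong (*-identityˡ _) (*-identityˡ _) (*-identityˡ _)

    binet : ∀ T U X Y → (T ⨯ U) ∙ (X ⨯ Y) ≡ (T ∙ X) * (U ∙ Y) + - ((U ∙ X) * (T ∙ Y))
    binet (vec a b c) (vec d e f) (vec x y z) (vec u v w) = solve 12 (λ a b c d e f x y z u v w →
      (b :* f :+ :- (c :* e)) :* (y :* w :+ :- (z :* v)) :+ (c :* d :+ :- (a :* f)) :* (z :* u :+ :- (x :* w))
        :+ (a :* e :+ :- (b :* d)) :* (x :* v :+ :- (y :* u)) :=
      (a :* x :+ b :* y :+ c :* z) :* (d :* u :+ e :* v :+ f :* w)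
        :+ :- ((d :* x :+ e :* y :+ f :* z) :* (a :* u :+ b :* v :+ c :* w))) refl a b c d e f x y z u v w

    det-cyclic : ∀ X Y Z → det X Y Z ≡ det Y Z X
    det-cyclic (vec a b c) (vec d e f) (vec x y z) = solve 9 (λ a b c d e f x y z →
      a :* (e :* z :+ :- (f :* y)) :+ b :* (f :* x :+ :- (d :* z)) :+ c :* (d :* y :+ :- (e :* x)) :=
      d :* (y :* c :+ :- (z :* b)) :+ e :* (z :* a :+ :- (x :* c)) :+ f :* (x :* b :+ :- (y :* a)))
      refl a b c d e f x y z

    ⨯-anti : ∀ X Y → X ⨯ Y ≡ (- 1#) · (Y ⨯ X)
    ⨯-anti (vec a b c) (vec x y z) = vec-cong (s b z c y) (s c x a z) (s a y b x)
      where
      s : ∀ p q r t → p * q + - (r * t) ≡ - 1# * (t * r + - (q * p))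
      s = solve 4 (λ p q r t → p :* q :+ :- (r :* t) := (:- :1) :* (t :* r :+ :- (q :* p))) refl

    -1* : ∀ x → - 1# * x ≡ - x
    -1* = solve 1 (λ x → (:- :1) :* x := :- x) refl

    det-swap₂₃ : ∀ X Y Z → det X Y Z ≡ - det X Z Y
    det-swap₂₃ X Y Z = trans (cong (X ∙_) (⨯-anti Y Z)) (trans (∙-·ʳ X (- 1#) (Z ⨯ Y)) (-1* _))

    det-swap₁₂ : ∀ X Y Z → det X Y Z ≡ - det Y X Z
    det-swap₁₂ X Y Z = trans (det-cyclic X Y Z) (det-swap₂₃ Y Z X)

    ⨯-self : ∀ X → X ⨯ X ≡ 0V
    ⨯-self (vec a b c) = vec-cong (s b c) (s c a) (s a b)
      where
      s : ∀ x y → x * y + - (y * x) ≡ 0#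
      s = solve 2 (λ x y → x :* y :+ :- (y :* x) := :0) refl

    det-XYY : ∀ X Y → det X Y Y ≡ 0#
    det-XYY X Y = trans (cong (X ∙_) (⨯-self Y)) (∙-0V X)

    det-XYX : ∀ X Y → det X Y X ≡ 0#
    det-XYX X Y = trans (sym (det-cyclic X X Y)) (trans (det-cyclic X X Y) (trans (det-cyclic X Y X) (det-XYY Y X)))

    det-XXY : ∀ X Y → det X X Y ≡ 0#
    det-XXY X Y = trans (det-cyclic X X Y) (det-XYX X Y)

    lagrange : ∀ X L M → X ⨯ (L ⨯ M) ≡ (X ∙ M) · L ⊕ (- (X ∙ L)) · M
    lagrange (vec a b c) (vec d e f) (vec x y z) = vec-cong
      (solve 9 (λ a b c d e f x y z →
        b :* (d :* y :+ :- (e :* x)) :+ :- (c :* (f :* x :+ :- (d :* z))) :=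
        (a :* x :+ b :* y :+ c :* z) :* d :+ (:- (a :* d :+ b :* e :+ c :* f)) :* x) refl a b c d e f x y z)
      (solve 9 (λ a b c d e f x y z →
        c :* (e :* z :+ :- (f :* y)) :+ :- (a :* (d :* y :+ :- (e :* x))) :=
        (a :* x :+ b :* y :+ c :* z) :* e :+ (:- (a :* d :+ b :* e :+ c :* f)) :* y) refl a b c d e f x y z)
      (solve 9 (λ a b c d e f x y z →
        a :* (f :* x :+ :- (d :* z)) :+ :- (b :* (e :* z :+ :- (f :* y))) :=
        (a :* x :+ b :* y :+ c :* z) :* f :+ (:- (a :* d :+ b :* e :+ c :* f)) :* z) refl a b c d e f x y z)

    ⨯-·ʳ : ∀ X s Y → X ⨯ (s · Y) ≡ s · (X ⨯ Y)
    ⨯-·ʳ (vec a b c) s (vec x y z) = vec-cong (t b z c y) (t c x a z) (t a y b x)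
      where
      t : ∀ p q r u → p * (s * q) + - (r * (s * u)) ≡ s * (p * q + - (r * u))
      t = λ p q r u → solve 5 (λ s p q r u → p :* (s :* q) :+ :- (r :* (s :* u)) := s :* (p :* q :+ :- (r :* u))) refl s p q r u

    M⨯[L⊕tM] : ∀ t L M → M ⨯ (L ⊕ t · M) ≡ (- 1#) · (L ⨯ M)
    M⨯[L⊕tM] t (vec a b c) (vec x y z) = vec-cong (s b c y z) (s c a z x) (s a b x y)
      where
      s : ∀ a b x y → x * (b + t * y) + - (y * (a + t * x)) ≡ - 1# * (a * y + - (b * x))
      s = solve 5 (λ t a b x y → x :* (b :+ t :* y) :+ :- (y :* (a :+ t :* x)) :=
        (:- :1) :* (a :* y :+ :- (b :* x))) refl t

    [L⊕tM]⨯M : ∀ t L M → (L ⊕ t · M) ⨯ M ≡ 1# · (L ⨯ M)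
    [L⊕tM]⨯M t (vec a b c) (vec x y z) = vec-cong (s b c y z) (s c a z x) (s a b x y)
      where
      s : ∀ a b x y → (a + t * x) * y + - ((b + t * y) * x) ≡ 1# * (a * y + - (b * x))
      s = solve 5 (λ t a b x y → (a :+ t :* x) :* y :+ :- ((b :+ t :* y) :* x) :=
        :1 :* (a :* y :+ :- (b :* x))) refl t

    [L-sM]⨯[L-tM] : ∀ s t L M → (L ⊕ (- s) · M) ⨯ (L ⊕ (- t) · M) ≡ (s + - t) · (L ⨯ M)
    [L-sM]⨯[L-tM] s t (vec a b c) (vec x y z) = vec-cong (e b c y z) (e c a z x) (e a b x y)
      where
      e : ∀ a b x y → (a + (- s) * x) * (b + (- t) * y) + - ((b + (- s) * y) * (a + (- t) * x))
        ≡ (s + - t) * (a * y + - (b * x))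
      e = solve 6 (λ s t a b x y →
        (a :+ (:- s) :* x) :* (b :+ (:- t) :* y) :+ :- ((b :+ (:- s) :* y) :* (a :+ (:- t) :* x)) :=
        (s :+ :- t) :* (a :* y :+ :- (b :* x))) refl s t

    0·⊕-0· : ∀ X Y → 0# · X ⊕ (- 0#) · Y ≡ 0V
    0·⊕-0· (vec a b c) (vec x y z) = vec-cong (s a x) (s b y) (s c z)
      where
      s : ∀ x y → 0# * x + - 0# * y ≡ 0#
      s = solve 2 (λ x y → :0 :* x :+ (:- :0) :* y := :0) refl

    0-shift : ∀ X Y → X ⊕ 0# · Y ≡ X
    0-shift (vec a b c) (vec x y z) = vec-cong (s a x) (s b y) (s c z)
      where
      s : ∀ x y → x + 0# * y ≡ x
      s = solve 2 (λ x y → x :+ :0 :* y := x) refl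

    shift-injective : ∀ {s t X Y} → Y ≢ 0V → X ⊕ s · Y ≡ X ⊕ t · Y → s ≡ t
    shift-injective {s} {t} {vec a b c} {vec x y z} Y≢0 eq with s ≟ t
    ... | yes s≡t = s≡t
    ... | no s≢t = ⊥-elim (Y≢0 (vec-cong (e a x (cong v₀ eq)) (e b y (cong v₁ eq)) (e c z (cong v₂ eq))))
      where
      e : ∀ a x → a + s * x ≡ a + t * x → x ≡ 0#
      e a x eq = *-≡0 (λ st → s≢t (x-y≡0⇒x≡y st))
        (trans (solve 4 (λ s t a x → (s :+ :- t) :* x := (a :+ s :* x) :+ :- (a :+ t :* x)) refl s t a x) (x≡y⇒x-y≡0 eq))

    0· : ∀ X → 0# · X ≡ 0V
    0· (vec x y z) = vec-cong (zeroˡ x) (zeroˡ y) (zeroˡ z)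

    ·-0V : ∀ s → s · 0V ≡ 0V
    ·-0V s = vec-cong (zeroʳ s) (zeroʳ s) (zeroʳ s)

    0V-⨯ : ∀ X → 0V ⨯ X ≡ 0V
    0V-⨯ (vec x y z) = vec-cong (s z y) (s x z) (s y x)
      where
      s : ∀ x y → 0# * x + - (0# * y) ≡ 0#
      s = solve 2 (λ x y → :0 :* x :+ :- (:0 :* y) := :0) refl

    ⊕-comm : ∀ X Y → X ⊕ Y ≡ Y ⊕ X
    ⊕-comm X Y = vec-cong (+-comm _ _) (+-comm _ _) (+-comm _ _)

    ·-affine : ∀ {s x X a Y} → s * x ≡ 1# → s · (x · X ⊕ a · Y) ≡ X ⊕ (s * a) · Y
    ·-affine {s} {x} {X} {a} {Y} sx≡1 = vec-cong (e (v₀ X) (v₀ Y)) (e (v₁ X) (v₁ Y)) (e (v₂ X) (v₂ Y))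
      where
      e : ∀ u w → s * (x * u + a * w) ≡ u + (s * a) * w
      e u w = trans (solve 5 (λ s x a u w → s :* (x :* u :+ a :* w) := (s :* x) :* u :+ (s :* a) :* w) refl s x a u w)
        (cong (_+ (s * a) * w) (trans (cong (_* u) sx≡1) (*-identityˡ u)))

    ·-⊕· : ∀ s X t Y → s · (X ⊕ t · Y) ≡ s · X ⊕ (s * t) · Y
    ·-⊕· s X t Y = vec-cong (e (v₀ X) (v₀ Y)) (e (v₁ X) (v₁ Y)) (e (v₂ X) (v₂ Y))
      where
      e : ∀ u w → s * (u + t * w) ≡ s * u + (s * t) * w
      e = solve 4 (λ s t u w → s :* (u :+ t :* w) := s :* u :+ (s :* t) :* w) refl s t

    ·-⊕·-⊕ : ∀ s X t a Y → s · (X ⊕ t · Y) ⊕ a · Y ≡ s · X ⊕ (s * t + a) · Y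
    ·-⊕·-⊕ s X t a Y = vec-cong (e (v₀ X) (v₀ Y)) (e (v₁ X) (v₁ Y)) (e (v₂ X) (v₂ Y))
      where
      e : ∀ u w → s * (u + t * w) + a * w ≡ s * u + (s * t + a) * w
      e = solve 5 (λ s t a u w → s :* (u :+ t :* w) :+ a :* w := s :* u :+ (s :* t :+ a) :* w) refl s t a

    drop-0· : ∀ X Y → 0# · X ⊕ Y ≡ Y
    drop-0· X Y = vec-cong (e (v₀ X) (v₀ Y)) (e (v₁ X) (v₁ Y)) (e (v₂ X) (v₂ Y))
      where
      e : ∀ u w → 0# * u + w ≡ w
      e = solve 2 (λ u w → :0 :* u :+ w := w) refl

    parallel⇒⨯≡0 : ∀ {s X Y} → X ≡ s · Y → X ⨯ Y ≡ 0V
    parallel⇒⨯≡0 {s} {Y = vec x y z} refl = vec-cong (e y z) (e z x) (e x y)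
      where
      e : ∀ u w → (s * u) * w + - ((s * w) * u) ≡ 0#
      e = solve 3 (λ s u w → (s :* u) :* w :+ :- ((s :* w) :* u) := :0) refl s

    ∙-ext : ∀ {X Y} → (∀ Z → X ∙ Z ≡ Y ∙ Z) → X ≡ Y
    ∙-ext {vec a b c} {vec x y z} e = vec-cong
      (trans (e₀ a b c) (trans (e (vec 1# 0# 0#)) (sym (e₀ x y z))))
      (trans (e₁ a b c) (trans (e (vec 0# 1# 0#)) (sym (e₁ x y z))))
      (trans (e₂ a b c) (trans (e (vec 0# 0# 1#)) (sym (e₂ x y z))))
      where
      e₀ : ∀ a b c → a ≡ a * 1# + b * 0# + c * 0#
      e₀ = solve 3 (λ a b c → a := a :* :1 :+ b :* :0 :+ c :* :0) refl
      e₁ : ∀ a b c → b ≡ a * 0# + b * 1# + c * 0#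
      e₁ = solve 3 (λ a b c → b := a :* :0 :+ b :* :1 :+ c :* :0) refl
      e₂ : ∀ a b c → c ≡ a * 0# + b * 0# + c * 1#
      e₂ = solve 3 (λ a b c → c := a :* :0 :+ b :* :0 :+ c :* :1) refl

    ∙-lift : ∀ A y z X Y → A ∙ (y · X ⊕ z · Y) ≡ (A ∙ (1# · X ⊕ 0# · Y)) * y + (A ∙ (0# · X ⊕ 1# · Y)) * z
    ∙-lift A y z X Y = trans (split y z) (sym (trans (cong₂ (λ a b → a * y + b * z) (split 1# 0#) (split 0# 1#))
      (solve 4 (λ y z p r → (:1 :* p :+ :0 :* r) :* y :+ (:0 :* p :+ :1 :* r) :* z := y :* p :+ z :* r)
        refl y z (A ∙ X) (A ∙ Y))))
      where
      split : ∀ y z → A ∙ (y · X ⊕ z · Y) ≡ y * (A ∙ X) + z * (A ∙ Y)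
      split y z = trans (∙-⊕ʳ A _ _) (cong₂ _+_ (∙-·ʳ A y X) (∙-·ʳ A z Y))

    nonzero-coordinate : ∀ {X} → X ≢ 0V → ∃[ e ] (e ∙ X ≡ 1#)
    nonzero-coordinate {vec x y z} X≢0 with x ≟ 0# | y ≟ 0# | z ≟ 0#
    ... | no x≢0 | _ | _ = vec (recip x) 0# 0# , trans
      (solve 4 (λ r x y z → r :* x :+ :0 :* y :+ :0 :* z := r :* x) refl (recip x) x y z) (recipˡ x≢0)
    ... | yes _ | no y≢0 | _ = vec 0# (recip y) 0# , trans
      (solve 4 (λ r x y z → :0 :* x :+ r :* y :+ :0 :* z := r :* y) refl (recip y) x y z) (recipˡ y≢0)
    ... | yes _ | yes _ | no z≢0 = vec 0# 0# (recip z) , trans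
      (solve 4 (λ r x y z → :0 :* x :+ :0 :* y :+ r :* z := r :* z) refl (recip z) x y z) (recipˡ z≢0)
    ... | yes refl | yes refl | yes refl = ⊥-elim (X≢0 refl)

    -- `L` and `M` span the covectors vanishing at `X`. The nonzero pivot coordinate becomes `ρ`,
    -- which keeps the witnesses free of division.
    perp-basis : ∀ {X} → X ≢ 0V → ∃[ L ] ∃[ M ] ∃[ ρ ] (ρ ≢ 0# × L ⨯ M ≡ ρ · X)
    perp-basis {vec x y z} X≢0 with x ≟ 0# | y ≟ 0# | z ≟ 0#
    ... | no x≢0 | _ | _ = vec y (- x) 0# , vec z 0# (- x) , x , x≢0 , vec-cong
      (solve 1 (λ x → (:- x) :* (:- x) :+ :- (:0 :* :0) := x :* x) refl x)
      (solve 3 (λ x y z → :0 :* z :+ :- (y :* (:- x)) := x :* y) refl x y z)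
      (solve 3 (λ x y z → y :* :0 :+ :- ((:- x) :* z) := x :* z) refl x y z)
    ... | yes _ | no y≢0 | _ = vec y (- x) 0# , vec 0# z (- y) , y , y≢0 , vec-cong
      (solve 3 (λ x y z → (:- x) :* (:- y) :+ :- (:0 :* z) := y :* x) refl x y z)
      (solve 3 (λ x y z → :0 :* :0 :+ :- (y :* (:- y)) := y :* y) refl x y z)
      (solve 3 (λ x y z → y :* z :+ :- ((:- x) :* :0) := y :* z) refl x y z)
    ... | yes _ | yes _ | no z≢0 = vec z 0# (- x) , vec 0# z (- y) , z , z≢0 , vec-cong
      (solve 3 (λ x y z → :0 :* (:- y) :+ :- ((:- x) :* z) := z :* x) refl x y z)
      (solve 3 (λ x y z → (:- x) :* :0 :+ :- (z :* (:- y)) := z :* y) refl x y z)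
      (solve 3 (λ x y z → z :* z :+ :- (:0 :* :0) := z :* z) refl x y z)
    ... | yes refl | yes refl | yes refl = ⊥-elim (X≢0 refl)

    -- Cramer's rule: up to the determinant, `U ⨯ e`, `e ⨯ T`, `T ⨯ U` is the basis dual to `T`,
    -- `U`, `e`.
    frame : ∀ T U e D → (e ∙ (T ⨯ U)) · D ≡ (T ∙ D) · (U ⨯ e) ⊕ (U ∙ D) · (e ⨯ T) ⊕ (e ∙ D) · (T ⨯ U)
    frame (vec a b c) (vec d e f) (vec x y z) (vec u v w) = vec-cong
      (solve 12 (λ a b c d e f x y z u v w →
        (x :* (b :* f :+ :- (c :* e)) :+ y :* (c :* d :+ :- (a :* f)) :+ z :* (a :* e :+ :- (b :* d))) :* u :=
        (a :* u :+ b :* v :+ c :* w) :* (e :* z :+ :- (f :* y)) :+ (d :* u :+ e :* v :+ f :* w) :* (y :* c :+ :- (z :* b))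
        :+ (x :* u :+ y :* v :+ z :* w) :* (b :* f :+ :- (c :* e))) refl a b c d e f x y z u v w)
      (solve 12 (λ a b c d e f x y z u v w →
        (x :* (b :* f :+ :- (c :* e)) :+ y :* (c :* d :+ :- (a :* f)) :+ z :* (a :* e :+ :- (b :* d))) :* v :=
        (a :* u :+ b :* v :+ c :* w) :* (f :* x :+ :- (d :* z)) :+ (d :* u :+ e :* v :+ f :* w) :* (z :* a :+ :- (x :* c))
        :+ (x :* u :+ y :* v :+ z :* w) :* (c :* d :+ :- (a :* f))) refl a b c d e f x y z u v w)
      (solve 12 (λ a b c d e f x y z u v w →
        (x :* (b :* f :+ :- (c :* e)) :+ y :* (c :* d :+ :- (a :* f)) :+ z :* (a :* e :+ :- (b :* d))) :* w :=
        (a :* u :+ b :* v :+ c :* w) :* (d :* y :+ :- (e :* x)) :+ (d :* u :+ e :* v :+ f :* w) :* (x :* b :+ :- (y :* a))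
        :+ (x :* u :+ y :* v :+ z :* w) :* (a :* e :+ :- (b :* d))) refl a b c d e f x y z u v w)

    -- With `e ∙ Y ≡ 1#`, the Lagrange expansion of `e ⨯ (X ⨯ Y)` solves for `X`.
    ⨯≡0⇒parallel : ∀ {X Y} → Y ≢ 0V → X ⨯ Y ≡ 0V → ∃[ s ] (X ≡ s · Y)
    ⨯≡0⇒parallel {X} {Y} Y≢0 eq with nonzero-coordinate Y≢0
    ... | e , e∙Y≡1 = e ∙ X , vec-cong (lem (cong v₀ eq′)) (lem (cong v₁ eq′)) (lem (cong v₂ eq′))
      where
      eq′ : 0V ≡ (e ∙ Y) · X ⊕ (- (e ∙ X)) · Y
      eq′ = trans (sym (trans (cong (e ⨯_) eq) (⨯0 e))) (lagrange e X Y)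
        where
        ⨯0 : ∀ X → X ⨯ 0V ≡ 0V
        ⨯0 (vec a b c) = vec-cong (s b c) (s c a) (s a b)
          where
          s : ∀ x y → x * 0# + - (y * 0#) ≡ 0#
          s = solve 2 (λ x y → x :* :0 :+ :- (y :* :0) := :0) refl
      lem : ∀ {x y} → 0# ≡ (e ∙ Y) * x + - (e ∙ X) * y → x ≡ (e ∙ X) * y
      lem {x} {y} eq₀ rewrite e∙Y≡1 = x-y≡0⇒x≡y (trans
        (solve 3 (λ x s y → x :+ :- (s :* y) := :1 :* x :+ (:- s) :* y) refl x (e ∙ X) y) (sym eq₀))

    0·-⊕ : ∀ X Y Z → 0# · X ⊕ 0# · Y ⊕ Z ≡ Z
    0·-⊕ (vec a b c) (vec d e f) (vec x y z) = vec-cong (s a d x) (s b e y) (s c f z)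
      where
      s : ∀ x y z → 0# * x + 0# * y + z ≡ z
      s = solve 3 (λ x y z → :0 :* x :+ :0 :* y :+ z := z) refl

    move-right : ∀ {X Y Z} → X ⊕ (- 1#) · Y ≡ Z → X ≡ Y ⊕ Z
    move-right {X} {Y} refl = vec-cong (s (v₀ X) (v₀ Y)) (s (v₁ X) (v₁ Y)) (s (v₂ X) (v₂ Y))
      where
      s : ∀ x y → x ≡ y + (x + - 1# * y)
      s = solve 2 (λ x y → x := y :+ (x :+ (:- :1) :* y)) refl

  -- Coordinates in the pencil of lines through a point

  module Pencil {T U κ : V} {ρ : Carrier} (ρ≢0 : ρ ≢ 0#) (T⨯U≡ρκ : T ⨯ U ≡ ρ · κ) (κ≢0 : κ ≢ 0V) where

    -- `T` and `U` are coordinates on the quotient by `κ`; by Binet-Cauchy the area form of that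
    -- quotient is the determinant with `κ`, up to `ρ`.
    bracket : ∀ X Y → (T ∙ X) * (U ∙ Y) + - ((U ∙ X) * (T ∙ Y)) ≡ ρ * det κ X Y
    bracket X Y = trans (sym (binet T U X Y)) (trans (cong (_∙ (X ⨯ Y)) T⨯U≡ρκ) (∙-·ˡ ρ κ (X ⨯ Y)))

    private
      ρκ≢0 : ρ · κ ≢ 0V
      ρκ≢0 eq = κ≢0 (·-≡0V ρ≢0 eq)

      e : V
      e = proj₁ (nonzero-coordinate ρκ≢0)

      e∙w≡1 : e ∙ (T ⨯ U) ≡ 1#
      e∙w≡1 = trans (cong (e ∙_) T⨯U≡ρκ) (proj₂ (nonzero-coordinate ρκ≢0))

      det₁ : det T U e ≡ 1#
      det₁ = trans (det-cyclic T U e) (trans (det-cyclic U e T) e∙w≡1)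

      det₂ : det U e T ≡ 1#
      det₂ = trans (det-cyclic U e T) e∙w≡1

    T∙κ≡0 : T ∙ κ ≡ 0#
    T∙κ≡0 = *-≡0 ρ≢0 (trans (sym (∙-·ʳ T ρ κ)) (trans (cong (T ∙_) (sym T⨯U≡ρκ)) (det-XXY T U)))

    U∙κ≡0 : U ∙ κ ≡ 0#
    U∙κ≡0 = *-≡0 ρ≢0 (trans (sym (∙-·ʳ U ρ κ)) (trans (cong (U ∙_) (sym T⨯U≡ρκ)) (det-XYX U T)))

    kernel : ∀ {D} → T ∙ D ≡ 0# → U ∙ D ≡ 0# → ∃[ s ] (D ≡ s · κ)
    kernel {D} TD UD = (e ∙ D) * ρ , (begin
      D ≡⟨ sym (1· D) ⟩
      1# · D ≡⟨ cong (_· D) (sym e∙w≡1) ⟩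
      (e ∙ (T ⨯ U)) · D ≡⟨ frame T U e D ⟩
      (T ∙ D) · (U ⨯ e) ⊕ (U ∙ D) · (e ⨯ T) ⊕ (e ∙ D) · (T ⨯ U)
        ≡⟨ cong₂ (λ a b → a · (U ⨯ e) ⊕ b · (e ⨯ T) ⊕ (e ∙ D) · (T ⨯ U)) TD UD ⟩
      0# · (U ⨯ e) ⊕ 0# · (e ⨯ T) ⊕ (e ∙ D) · (T ⨯ U) ≡⟨ 0·-⊕ _ _ _ ⟩
      (e ∙ D) · (T ⨯ U) ≡⟨ cong ((e ∙ D) ·_) T⨯U≡ρκ ⟩
      (e ∙ D) · ρ · κ ≡⟨ ·-· _ _ _ ⟩
      ((e ∙ D) * ρ) · κ ∎)
      where open ≡-Reasoning

    -- A section of `X ↦ (T ∙ X , U ∙ X)`, built from the vectors dual to `T` and `U` once `e` with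
    -- `e ∙ (T ⨯ U) ≡ 1#` completes the basis.
    lift : Carrier → Carrier → V
    lift y z = y · (U ⨯ e) ⊕ z · (e ⨯ T)

    lift-linear : ∀ A y z → A ∙ lift y z ≡ (A ∙ lift 1# 0#) * y + (A ∙ lift 0# 1#) * z
    lift-linear A y z = ∙-lift A y z _ _

    T≢0V : T ≢ 0V
    T≢0V eq = 1≢0 (trans (sym det₁) (trans (cong (_∙ (U ⨯ e)) eq) (0V-∙ _)))

    U≢0V : U ≢ 0V
    U≢0V eq = 1≢0 (trans (sym det₂) (trans (cong (_∙ (e ⨯ T)) eq) (0V-∙ _)))

    T∙lift : ∀ y z → T ∙ lift y z ≡ y
    T∙lift y z = begin
      T ∙ lift y z ≡⟨ ∙-⊕ʳ T _ _ ⟩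
      T ∙ (y · (U ⨯ e)) + T ∙ (z · (e ⨯ T)) ≡⟨ cong₂ _+_ (∙-·ʳ T y _) (∙-·ʳ T z _) ⟩
      y * det T U e + z * det T e T ≡⟨ cong₂ (λ a b → y * a + z * b) det₁ (det-XYX T e) ⟩
      y * 1# + z * 0# ≡⟨ solve 2 (λ y z → y :* :1 :+ z :* :0 := y) refl y z ⟩
      y ∎
      where open ≡-Reasoning

    U∙lift : ∀ y z → U ∙ lift y z ≡ z
    U∙lift y z = begin
      U ∙ lift y z ≡⟨ ∙-⊕ʳ U _ _ ⟩
      U ∙ (y · (U ⨯ e)) + U ∙ (z · (e ⨯ T)) ≡⟨ cong₂ _+_ (∙-·ʳ U y _) (∙-·ʳ U z _) ⟩
      y * det U U e + z * det U e T ≡⟨ cong₂ (λ a b → y * a + z * b) (det-XXY U e) det₂ ⟩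
      y * 0# + z * 1# ≡⟨ solve 2 (λ y z → y :* :0 :+ z :* :1 := z) refl y z ⟩
      z ∎
      where open ≡-Reasoning

    ∙-unique : ∀ {X Y} → T ∙ X ≡ T ∙ Y → U ∙ X ≡ U ∙ Y → ∃[ s ] (X ≡ Y ⊕ s · κ)
    ∙-unique {X} {Y} TX UX with kernel {X ⊕ (- 1#) · Y} (diff T TX) (diff U UX)
      where
      diff : ∀ T → T ∙ X ≡ T ∙ Y → T ∙ (X ⊕ (- 1#) · Y) ≡ 0#
      diff T eq = trans (∙-⊕ʳ T X _) (trans (cong₂ _+_ eq (∙-·ʳ T (- 1#) Y))
        (solve 1 (λ y → y :+ (:- :1) :* y := :0) refl (T ∙ Y)))
    ... | s , eq = s , move-right eq

-- Arcs and their tangents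

predecessor : ∀ {q} → Fin q → ∃[ n ] (q ≡ suc n)
predecessor {suc n} _ = n , refl

all-but : ∀ {q n} → q ≡ suc n → (i : Fin q) → Σ (Fin n → Fin q) λ f → ∀ {j} → j ≢ i → ∃[ x ] (f x ≡ j)
all-but refl i = punchIn i , λ j≢i → punchOut (j≢i ∘ sym) , punchIn-punchOut (j≢i ∘ sym)

module Arcs (𝔽 : Field) (q : ℕ) (enum : Field.Carrier 𝔽 ↔ Fin q) where
  open FiniteField 𝔽 q enum
  open Geometry 𝔽 q enum

  module PencilLines {κ L M : V} {ρ : Carrier} (ρ≢0 : ρ ≢ 0#) (L⨯M : L ⨯ M ≡ ρ · κ) where
    -- All members of the pencil at `κ`, the index `zero` being the parameter at infinity.
    line : Fin (suc q) → V
    line zero = M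
    line (suc s) = L ⊕ (- el s) · M

    opaque
      -- The index of the member through `X`. It identifies a line only when `X` is not a multiple
      -- of `κ`; at `κ` itself it is `zero`.
      slope : V → Fin (suc q)
      slope X with M ∙ X ≟ 0#
      ... | yes _ = zero
      ... | no _ = suc (ix ((L ∙ X) * recip (M ∙ X)))

      slope-unique : ∀ p {X} → (L ∙ X ≡ 0# → M ∙ X ≢ 0#) → line p ∙ X ≡ 0# → slope X ≡ p
      slope-unique zero {X} _ eq with M ∙ X ≟ 0#
      ... | yes _ = refl
      ... | no ne = ⊥-elim (ne eq)
      slope-unique (suc s) {X} ne eq = go
        where
        LX : L ∙ X ≡ el s * (M ∙ X)
        LX = x-y≡0⇒x≡y (trans (trans (solve 3 (λ l s m → l :+ :- (s :* m) := l :+ (:- s) :* m) refl (L ∙ X) (el s) (M ∙ X))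
          (sym (trans (∙-⊕ˡ L _ X) (cong (L ∙ X +_) (∙-·ˡ _ M X))))) eq)
        go : slope X ≡ suc s
        go with M ∙ X ≟ 0#
        ... | yes MX = ⊥-elim (ne (trans LX (trans (cong (el s *_) MX) (zeroʳ _))) MX)
        ... | no MX = cong suc (trans (cong ix (*-recip-cancel MX LX)) (ix-el s))

    line⨯line : ∀ {p p′} → p ≢ p′ → ∃[ c ] (c ≢ 0# × line p ⨯ line p′ ≡ c · (L ⨯ M))
    line⨯line {zero} {zero} ne = ⊥-elim (ne refl)
    line⨯line {zero} {suc s} _ = - 1# , -‿≢0 1≢0 , M⨯[L⊕tM] (- el s) L M
    line⨯line {suc s} {zero} _ = 1# , 1≢0 , [L⊕tM]⨯M (- el s) L M
    line⨯line {suc s} {suc s′} ne = el s + - el s′ ,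
      (λ eq → ne (cong suc (el-injective (x-y≡0⇒x≡y eq)))) , [L-sM]⨯[L-tM] (el s) (el s′) L M

    off-both : ∀ {X} → X ⨯ κ ≢ 0V → L ∙ X ≡ 0# → M ∙ X ≢ 0#
    off-both {X} ne LX MX = ne (·-≡0V ρ≢0 (begin
      ρ · (X ⨯ κ) ≡⟨ sym (⨯-·ʳ X ρ κ) ⟩
      X ⨯ (ρ · κ) ≡⟨ cong (X ⨯_) (sym L⨯M) ⟩
      X ⨯ (L ⨯ M) ≡⟨ lagrange X L M ⟩
      (X ∙ M) · L ⊕ (- (X ∙ L)) · M
        ≡⟨ cong₂ (λ a b → a · L ⊕ (- b) · M) (trans (∙-comm _ _) MX) (trans (∙-comm _ _) LX) ⟩
      0# · L ⊕ (- 0#) · M ≡⟨ 0·⊕-0· L M ⟩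
      0V ∎))
      where open ≡-Reasoning

    missed⇒off : ∀ {p X} → X ⨯ κ ≢ 0V → slope X ≢ p → line p ∙ X ≢ 0#
    missed⇒off {p} ne missed eq = missed (slope-unique p (off-both ne) eq)

  record Arc : Set where
    field
      K : Fin q → V
      K≢0 : ∀ i → K i ≢ 0V
      indep₂ : ∀ {i j} → i ≢ j → K i ⨯ K j ≢ 0V
      indep₃ : ∀ {i j l} → i ≢ j → j ≢ l → i ≢ l → det (K i) (K j) (K l) ≢ 0#

  -- The equation for `T ⨯ U` says at once that the two lines are distinct and that they meet at
  -- `K i`. The factor `ρ` stays free because the tangents of the conic are later dictated by the
  -- equations of AS(q), without normalisation.
  record TangentPair (A : Arc) (i : Fin q) : Set where
    open Arc A
    field
      T U : V
      ρ : Carrier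
      ρ≢0 : ρ ≢ 0#
      T⨯U≡ρK : T ⨯ U ≡ ρ · K i
      T-tangent : ∀ {j} → j ≢ i → T ∙ K j ≢ 0#
      U-tangent : ∀ {j} → j ≢ i → U ∙ K j ≢ 0#

    open Pencil ρ≢0 T⨯U≡ρK (K≢0 i) public

    side : Fin 2 → V
    side zero = T
    side (suc zero) = U

    side-tangent : ∀ k {j} → j ≢ i → side k ∙ K j ≢ 0#
    side-tangent zero = T-tangent
    side-tangent (suc zero) = U-tangent

    side∙K≡0 : ∀ k → side k ∙ K i ≡ 0#
    side∙K≡0 zero = T∙κ≡0
    side∙K≡0 (suc zero) = U∙κ≡0

    side≢0V : ∀ k → side k ≢ 0V
    side≢0V zero = T≢0V
    side≢0V (suc zero) = U≢0V

    -- The parameter, in the pencil at `K i`, of the line to `K c`. The centre receives `0#`, the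
    -- parameter of the tangent `T`, which no other point attains; thus `q` indices face `q` field
    -- elements.
    ratio : Fin q → Carrier
    ratio c = (T ∙ K c) * recip (U ∙ K c)

    ratio-centre : ratio i ≡ 0#
    ratio-centre = trans (cong (_* recip (U ∙ K i)) T∙κ≡0) (zeroˡ _)

    ratio-*U : ∀ {c} → c ≢ i → ratio c * (U ∙ K c) ≡ T ∙ K c
    ratio-*U c≢i = recip-unmul (U-tangent c≢i)

    ratio-≢0 : ∀ {c} → c ≢ i → ratio c ≢ 0#
    ratio-≢0 c≢i = *-≢0 (T-tangent c≢i) (recip-≢0 (U-tangent c≢i))

    -- By `bracket`, equal ratios at two other points would make them collinear with `K i`.
    ratio-injective : ∀ {c d} → ratio c ≡ ratio d → c ≡ d
    ratio-injective {c} {d} eq with c ≟F d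
    ... | yes c≡d = c≡d
    ... | no c≢d with c ≟F i | d ≟F i
    ...   | yes refl | yes refl = refl
    ...   | yes refl | no d≢i = ⊥-elim (ratio-≢0 d≢i (trans (sym eq) ratio-centre))
    ...   | no c≢i | yes refl = ⊥-elim (ratio-≢0 c≢i (trans eq ratio-centre))
    ...   | no c≢i | no d≢i = ⊥-elim (*-≢0 ρ≢0 (indep₃ (c≢i ∘ sym) c≢d (d≢i ∘ sym)) (begin
      ρ * det (K i) (K c) (K d) ≡⟨ sym (bracket (K c) (K d)) ⟩
      (T ∙ K c) * (U ∙ K d) + - ((U ∙ K c) * (T ∙ K d))
        ≡⟨ cong₂ (λ a b → a * (U ∙ K d) + - ((U ∙ K c) * b)) (sym (ratio-*U c≢i)) (sym (ratio-*U d≢i)) ⟩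
      (ratio c * (U ∙ K c)) * (U ∙ K d) + - ((U ∙ K c) * (ratio d * (U ∙ K d)))
        ≡⟨ cong (λ r → (r * (U ∙ K c)) * (U ∙ K d) + - ((U ∙ K c) * (ratio d * (U ∙ K d)))) eq ⟩
      (ratio d * (U ∙ K c)) * (U ∙ K d) + - ((U ∙ K c) * (ratio d * (U ∙ K d)))
        ≡⟨ solve 3 (λ r x y → (r :* x) :* y :+ :- (x :* (r :* y)) := :0) refl (ratio d) (U ∙ K c) (U ∙ K d) ⟩
      0# ∎))
      where open ≡-Reasoning

    -- A line of the pencil that is not one of the two tangents is a secant: the ratios exhaust the field.
    secant : ∀ {t u} → t ≢ 0# → u ≢ 0# → ∃[ j ] (j ≢ i × t ≡ ratio j * u)
    secant {t} {u} t≢0 u≢0 with injective⇒onto ratio ratio-injective (t * recip u)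
    ... | j , eq = j , (λ { refl → *-≢0 t≢0 (recip-≢0 u≢0) (trans (sym eq) ratio-centre) }) ,
      trans (sym (recip-unmul u≢0)) (cong (_* u) (sym eq))

  module TangentExistence (A : Arc) where
    open Arc A

    module _ {n : ℕ} (q≡ : q ≡ suc n) {i : Fin q} {L M : V} {ρ : Carrier} (ρ≢0 : ρ ≢ 0#) (L⨯M : L ⨯ M ≡ ρ · K i) where
      open PencilLines ρ≢0 L⨯M

      private
        others : Fin n → Fin q
        others = proj₁ (all-but q≡ i)

        secants : Fin n → Fin (suc q)
        secants x = slope (K (others x))

        -- Only `n = q - 1` of the `q + 1` lines meet the arc again. Adjoining the first missed line
        -- to the list forces the second one to be different.
        p₀ : ∃[ p ] (∀ x → secants x ≢ p)
        p₀ = missing secants (ℕ.s≤s (ℕₚ.≤-trans (ℕₚ.n≤1+n n) (ℕₚ.≤-reflexive (sym q≡))))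

        secants⁺ : Fin (suc n) → Fin (suc q)
        secants⁺ zero = proj₁ p₀
        secants⁺ (suc x) = secants x

        p₁ : ∃[ p ] (∀ x → secants⁺ x ≢ p)
        p₁ = missing secants⁺ (ℕ.s≤s (ℕₚ.≤-reflexive (sym q≡)))

      missed⇒tangent : ∀ {p} → (∀ x → secants x ≢ p) → ∀ {j} → j ≢ i → line p ∙ K j ≢ 0#
      missed⇒tangent missed {j} j≢i eq with proj₂ (all-but q≡ i) j≢i
      ... | x , refl = missed⇒off (indep₂ j≢i) (missed x) eq

      tangentPair′ : Σ (TangentPair A i) λ t → TangentPair.ρ t ≡ 1#
      tangentPair′ = record
        -- Rescaling `U` makes `T ⨯ U` equal to `K i`, so in the lemma of tangents the brackets of
        -- pencil coordinates are determinants on the nose.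
        { T = T ; U = recip s · U ; ρ = 1# ; ρ≢0 = 1≢0
        ; T⨯U≡ρK = begin
            T ⨯ (recip s · U) ≡⟨ ⨯-·ʳ T (recip s) U ⟩
            recip s · (T ⨯ U) ≡⟨ cong (recip s ·_) (trans T⨯U (trans (cong (c ·_) L⨯M) (·-· c ρ (K i)))) ⟩
            recip s · (s · K i) ≡⟨ ·-· _ _ _ ⟩
            (recip s * s) · K i ≡⟨ cong (_· K i) (recipˡ s≢0) ⟩
            1# · K i ∎
        ; T-tangent = missed⇒tangent (proj₂ p₀)
        ; U-tangent = λ j≢i eq → *-≢0 (recip-≢0 s≢0) (missed⇒tangent (proj₂ p₁ ∘ suc) j≢i)
            (trans (sym (∙-·ˡ (recip s) U _)) eq)
        } , refl
        where
        open ≡-Reasoning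
        T = line (proj₁ p₀)
        U = line (proj₁ p₁)
        crossed = line⨯line {proj₁ p₀} {proj₁ p₁} (proj₂ p₁ zero)
        c = proj₁ crossed
        T⨯U = proj₂ (proj₂ crossed)
        s = c * ρ
        s≢0 = *-≢0 (proj₁ (proj₂ crossed)) ρ≢0

    opaque
      tangentPair : ∀ i → Σ (TangentPair A i) λ t → TangentPair.ρ t ≡ 1#
      tangentPair i with perp-basis (K≢0 i) | predecessor i
      ... | L , M , ρ , ρ≢0 , L⨯M | n , q≡ = tangentPair′ q≡ ρ≢0 L⨯M

-- The quadrangle in tangent coordinates

module Models (𝔽 : Field) (q : ℕ) (enum : Field.Carrier 𝔽 ↔ Fin q) where
  open FiniteField 𝔽 q enum
  open Geometry 𝔽 q enum
  open Arcs 𝔽 q enum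

  pick : ∀ {a} {X : Set a} → Fin 2 → X → X → X
  pick zero y z = y
  pick (suc zero) y z = z

  module Model (A : Arc) (tangents : ∀ i → TangentPair A i) where
    open Arc A
    open module TP i = TangentPair (tangents i) public

    -- (i , y , z) is the line through K i and the affine points X with T i ∙ X = y, U i ∙ X = z;
    -- (i , k , c) is the plane with equation side i k ∙ X = c.
    Pt Ln : Set
    Pt = Fin q × Carrier × Carrier
    Ln = V ⊎ (Fin q × Fin 2 × Carrier)

    infix 4 _I_
    _I_ : Pt → Ln → Set
    (i , y , z) I inj₁ X = T i ∙ X ≡ y × U i ∙ X ≡ z
    (i , y , z) I inj₂ (j , k , c) = i ≡ j × pick k y z ≡ c

    model : IncStr
    model = record { Pt = Pt ; Ln = Ln ; _≈P_ = _≡_ ; _≈L_ = _≡_ ; _I_ = _I_ }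

    at : Fin q → V → Pt
    at i X = i , T i ∙ X , U i ∙ X

    at-I : ∀ i X → at i X I inj₁ X
    at-I i X = refl , refl

    I⇒at : ∀ {i y z X} → (i , y , z) I inj₁ X → (i , y , z) ≡ at i X
    I⇒at (refl , refl) = refl

    pick-∙ : ∀ i k X → pick k (T i ∙ X) (U i ∙ X) ≡ side i k ∙ X
    pick-∙ i zero X = refl
    pick-∙ i (suc zero) X = refl

    shift : ∀ S X s i → S ∙ (X ⊕ s · K i) ≡ S ∙ X + s * (S ∙ K i)
    shift S X s i = trans (∙-⊕ʳ S X _) (cong (S ∙ X +_) (∙-·ʳ S s (K i)))

    shift-side : ∀ i k X s → side i k ∙ (X ⊕ s · K i) ≡ side i k ∙ X
    shift-side i k X s = trans (shift (side i k) X s i) (trans (cong (λ z → side i k ∙ X + s * z) (side∙K≡0 i k))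
      (solve 2 (λ a s → a :+ s :* :0 := a) refl (side i k ∙ X) s))

    at-shift : ∀ i X s → at i (X ⊕ s · K i) ≡ at i X
    at-shift i X s = cong₂ (λ y z → i , y , z) (shift-side i zero X s) (shift-side i (suc zero) X s)

    at-unique : ∀ {i X Y} → at i X ≡ at i Y → ∃[ s ] (X ≡ Y ⊕ s · K i)
    at-unique eq = ∙-unique _ (cong (proj₁ ∘ proj₂) eq) (cong (proj₂ ∘ proj₂) eq)

    shift-0 : ∀ X i → X ⊕ 0# · K i ≡ X
    shift-0 X i = 0-shift X (K i)

    shift-≡0 : ∀ {S X s i} → S ∙ K i ≢ 0# → S ∙ (X ⊕ s · K i) ≡ S ∙ X → s ≡ 0#
    shift-≡0 {S} {X} {s} {i} SK eq = *-≡0 SK (trans (*-comm _ _)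
      (trans (solve 2 (λ a b → b := (a :+ b) :+ :- a) refl (S ∙ X) (s * (S ∙ K i)))
        (x≡y⇒x-y≡0 (trans (sym (shift S X s i)) eq))))

    -- Agreement at `i` leaves a difference along `K i`, and `T j` does not vanish there, so
    -- agreement at `j` removes it.
    two-affine : ∀ {i j X Y} → i ≢ j → at i X ≡ at i Y → at j X ≡ at j Y → X ≡ Y
    two-affine {i} {j} {X} {Y} i≢j eqᵢ eqⱼ with at-unique eqᵢ
    ... | s , refl with shift-≡0 {X = Y} {s = s} (T-tangent j i≢j) (cong (proj₁ ∘ proj₂) eqⱼ)
    ... | refl = shift-0 Y i

    atMostOne : ∀ P Q L M → P ≢ Q → P I L → Q I L → P I M → Q I M → L ≡ M
    atMostOne (i , y , z) (j , y′ , z′) (inj₁ X) (inj₁ Y) P≢Q PX QX PY QY with i ≟F j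
    ... | yes refl = ⊥-elim (P≢Q (trans (I⇒at PX) (sym (I⇒at QX))))
    ... | no i≢j = cong inj₁ (two-affine i≢j (trans (sym (I⇒at PX)) (I⇒at PY)) (trans (sym (I⇒at QX)) (I⇒at QY)))
    atMostOne P Q (inj₁ X) (inj₂ _) P≢Q PX QX (refl , _) (refl , _) =
      ⊥-elim (P≢Q (trans (I⇒at {X = X} PX) (sym (I⇒at {X = X} QX))))
    atMostOne P Q (inj₂ _) (inj₁ Y) P≢Q (refl , _) (refl , _) PY QY =
      ⊥-elim (P≢Q (trans (I⇒at {X = Y} PY) (sym (I⇒at {X = Y} QY))))
    atMostOne P Q (inj₂ (_ , zero , _)) (inj₂ (_ , zero , _)) P≢Q (refl , refl) _ (refl , refl) _ = refl
    atMostOne P Q (inj₂ (_ , suc zero , _)) (inj₂ (_ , suc zero , _)) P≢Q (refl , refl) _ (refl , refl) _ = refl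
    atMostOne P Q (inj₂ (_ , zero , _)) (inj₂ (_ , suc zero , _)) P≢Q (refl , refl) (refl , refl) (refl , refl) (_ , refl) =
      ⊥-elim (P≢Q refl)
    atMostOne P Q (inj₂ (_ , suc zero , _)) (inj₂ (_ , zero , _)) P≢Q (refl , refl) (refl , refl) (refl , refl) (_ , refl) =
      ⊥-elim (P≢Q refl)

    Projection : Pt → Ln → Set
    Projection P L = Σ Pt λ Q → Q I L × Collinear model P Q × (∀ R → R I L → Collinear model P R → R ≡ Q)

    module ToAffine (i : Fin q) (y z : Carrier) (X : V) where
      P : Pt
      P = i , y , z

      -- `P` and `at l X` have a common affine point exactly when `D` is a multiple of `K l` modulo
      -- `K i`. The position of `D` in the pencil at `K i` therefore decides the projection.
      D : V
      D = X ⊕ (- 1#) · lift i y z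

      T∙D : T i ∙ D ≡ T i ∙ X + - y
      T∙D = trans (∙-⊕ʳ (T i) X _) (cong (T i ∙ X +_)
        (trans (∙-·ʳ (T i) (- 1#) _) (trans (-1* _) (cong -_ (T∙lift i y z)))))

      U∙D : U i ∙ D ≡ U i ∙ X + - z
      U∙D = trans (∙-⊕ʳ (U i) X _) (cong (U i ∙ X +_)
        (trans (∙-·ʳ (U i) (- 1#) _) (trans (-1* _) (cong -_ (U∙lift i y z)))))

      affine-collinear : ∀ {l Y} → P I inj₁ Y → at l X I inj₁ Y →
        ∃[ t ] (T i ∙ X ≡ y + t * (T i ∙ K l) × U i ∙ X ≡ z + t * (U i ∙ K l))
      affine-collinear {l} {Y} (refl , refl) (Tl , Ul) with ∙-unique l {X} {Y} (sym Tl) (sym Ul)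
      ... | t , X≡ = t , trans (cong (T i ∙_) X≡) (shift (T i) Y t l) , trans (cong (U i ∙_) X≡) (shift (U i) Y t l)

      -- Here `D` lies on a tangent at `K i`, so no other point of the arc is in its direction: a
      -- joining affine point would need `t ≡ 0#`, which puts `P` on `X`. The join is a tangent
      -- plane.
      tangent-case : ∀ k → pick k (T i ∙ X) (U i ∙ X) ≡ pick k y z → ¬ (P I inj₁ X) → Projection P (inj₁ X)
      tangent-case k eq ¬PX = at i X , at-I i X , (inj₂ (i , k , pick k y z) , (refl , refl) , (refl , eq)) , unique
        where
        unique : ∀ R → R I inj₁ X → Collinear model P R → R ≡ at i X
        unique (l , _ , _) (refl , refl) (inj₂ _ , (refl , _) , (refl , _)) = refl
        unique (l , _ , _) (refl , refl) (inj₁ Y , PY , RY) with l ≟F i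
        ... | yes refl = refl
        ... | no l≢i with affine-collinear PY RY
        ...   | t , Teq , Ueq with t≡0
          where
          both : pick k (T i ∙ X) (U i ∙ X) ≡ pick k y z + t * (side i k ∙ K l)
          both = help k
            where
            help : ∀ k → pick k (T i ∙ X) (U i ∙ X) ≡ pick k y z + t * (side i k ∙ K l)
            help zero = Teq
            help (suc zero) = Ueq
          t≡0 : t ≡ 0#
          t≡0 = *-≡0 (side-tangent i k l≢i) (trans (*-comm _ _)
            (trans (solve 2 (λ a b → b := (a :+ b) :+ :- a) refl (pick k y z) (t * (side i k ∙ K l)))
            (x≡y⇒x-y≡0 (trans (sym both) eq))))
        ...     | refl = ⊥-elim (¬PX (trans Teq (drop y _) , trans Ueq (drop z _)))
          where
          drop : ∀ y x → y + 0# * x ≡ y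
          drop = solve 2 (λ y x → y :+ :0 :* x := y) refl

      -- Off both tangents the direction of `D` is that of exactly one `K j`, since the ratios are
      -- both onto and injective. Moving `X` along `K j` reaches the line of `P`.
      secant-case : T i ∙ X ≢ y → U i ∙ X ≢ z → Projection P (inj₁ X)
      secant-case Tne Une with secant i {T i ∙ D} {U i ∙ D}
        (λ eq → Tne (x-y≡0⇒x≡y (trans (sym T∙D) eq))) (λ eq → Une (x-y≡0⇒x≡y (trans (sym U∙D) eq)))
      ... | j , j≢i , TD≡ = at j X , at-I j X , (inj₁ Y , (T∙Y , U∙Y) , (QY zero , QY (suc zero))) , unique
        where
        β = (U i ∙ D) * recip (U i ∙ K j)
        Y = X ⊕ (- β) · K j
        βU : β * (U i ∙ K j) ≡ U i ∙ D
        βU = recip-unmul (U-tangent i j≢i)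
        βT : β * (T i ∙ K j) ≡ T i ∙ D
        βT = trans (cong (β *_) (sym (ratio-*U i j≢i)))
          (trans (solve 3 (λ b r u → b :* (r :* u) := r :* (b :* u)) refl β (ratio i j) (U i ∙ K j))
            (trans (cong (ratio i j *_) βU) (sym TD≡)))
        reach : ∀ S y → β * (S ∙ K j) ≡ S ∙ D → S ∙ D ≡ S ∙ X + - y → S ∙ Y ≡ y
        reach S y e₁ e₂ = trans (shift S X (- β) j)
          (trans (solve 3 (λ x b s → x :+ (:- b) :* s := x :+ :- (b :* s)) refl (S ∙ X) β (S ∙ K j))
          (trans (cong (λ w → S ∙ X + - w) (trans e₁ e₂)) (solve 2 (λ x y → x :+ :- (x :+ :- y) := y) refl (S ∙ X) y)))
        T∙Y : T i ∙ Y ≡ y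
        T∙Y = reach (T i) y βT T∙D
        U∙Y : U i ∙ Y ≡ z
        U∙Y = reach (U i) z βU U∙D
        QY : ∀ k → side j k ∙ Y ≡ side j k ∙ X
        QY k = shift-side j k X (- β)
        UD≢0 : U i ∙ D ≢ 0#
        UD≢0 eq = Une (x-y≡0⇒x≡y (trans (sym U∙D) eq))
        unique : ∀ R → R I inj₁ X → Collinear model P R → R ≡ at j X
        unique (l , _ , _) (refl , refl) (inj₂ (_ , zero , _) , (refl , e) , (refl , e′)) = ⊥-elim (Tne (trans e′ (sym e)))
        unique (l , _ , _) (refl , refl) (inj₂ (_ , suc zero , _) , (refl , e) , (refl , e′)) = ⊥-elim (Une (trans e′ (sym e)))
        unique (l , _ , _) (refl , refl) (inj₁ Y′ , PY , RY) with l ≟F i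
        ... | yes refl = ⊥-elim (Tne (trans (sym (proj₁ RY)) (proj₁ PY)))
        ... | no l≢i with affine-collinear PY RY
        ...   | t , Teq , Ueq = cong (λ l → at l X) (ratio-injective i (*-cancelˡ UD≢0
                  (trans (*-comm _ _) (trans (sym TD≡ₗ) (trans TD≡ (*-comm _ _))))))
          where
          diff : ∀ {a y b} → a ≡ y + b → a + - y ≡ b
          diff {y = y} {b} refl = solve 2 (λ y b → (y :+ b) :+ :- y := b) refl y b
          TD≡ₗ : T i ∙ D ≡ ratio i l * (U i ∙ D)
          TD≡ₗ = begin
            T i ∙ D ≡⟨ trans T∙D (diff Teq) ⟩
            t * (T i ∙ K l) ≡⟨ cong (t *_) (sym (ratio-*U i l≢i)) ⟩
            t * (ratio i l * (U i ∙ K l)) ≡⟨ solve 3 (λ b r u → b :* (r :* u) := r :* (b :* u)) refl t (ratio i l) (U i ∙ K l) ⟩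
            ratio i l * (t * (U i ∙ K l)) ≡⟨ cong (ratio i l *_) (sym (trans U∙D (diff Ueq))) ⟩
            ratio i l * (U i ∙ D) ∎
            where open ≡-Reasoning

      project : ¬ (P I inj₁ X) → Projection P (inj₁ X)
      project ¬PX with T i ∙ X ≟ y | U i ∙ X ≟ z
      ... | yes eq | _ = tangent-case zero eq ¬PX
      ... | no _ | yes eq = tangent-case (suc zero) eq ¬PX
      ... | no ne | no ne′ = secant-case ne ne′

    projectPlane : ∀ P j k c → ¬ (P I inj₂ (j , k , c)) → Projection P (inj₂ (j , k , c))
    projectPlane (i , y , z) j k c ¬PL with i ≟F j
    -- Over the same arc point the given plane misses `P`, so the join is the plane through `P` on
    -- the other tangent.
    projectPlane (i , y , z) .i zero c ¬PL | yes refl =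
      (i , c , z) , (refl , refl) , (inj₂ (i , suc zero , z) , (refl , refl) , (refl , refl)) , unique
      where
      unique : ∀ R → R I inj₂ (i , zero , c) → Collinear model (i , y , z) R → R ≡ (i , c , z)
      unique _ (refl , refl) (inj₁ Y , (refl , _) , (refl , _)) = ⊥-elim (¬PL (refl , refl))
      unique _ (refl , refl) (inj₂ (_ , zero , _) , (refl , refl) , (_ , refl)) = ⊥-elim (¬PL (refl , refl))
      unique _ (refl , refl) (inj₂ (_ , suc zero , _) , (refl , refl) , (_ , refl)) = refl
    projectPlane (i , y , z) .i (suc zero) c ¬PL | yes refl =
      (i , y , c) , (refl , refl) , (inj₂ (i , zero , y) , (refl , refl) , (refl , refl)) , unique
      where
      unique : ∀ R → R I inj₂ (i , suc zero , c) → Collinear model (i , y , z) R → R ≡ (i , y , c)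
      unique _ (refl , refl) (inj₁ Y , (_ , refl) , (_ , refl)) = ⊥-elim (¬PL (refl , refl))
      unique _ (refl , refl) (inj₂ (_ , suc zero , _) , (refl , refl) , (_ , refl)) = ⊥-elim (¬PL (refl , refl))
      unique _ (refl , refl) (inj₂ (_ , zero , _) , (refl , refl) , (_ , refl)) = refl
    -- A line through `K i` is not parallel to a tangent plane at `K j`; `s` solves for their unique
    -- affine intersection.
    projectPlane (i , y , z) j k c ¬PL | no i≢j =
      at j Y , (refl , trans (pick-∙ j k Y) S∙Y) , (inj₁ Y , (T∙Y , U∙Y) , at-I j Y) , unique
      where
      S = side j k
      SK≢0 : S ∙ K i ≢ 0#
      SK≢0 = side-tangent j k i≢j
      X = lift i y z
      s = (c + - (S ∙ X)) * recip (S ∙ K i)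
      Y = X ⊕ s · K i
      T∙Y : T i ∙ Y ≡ y
      T∙Y = trans (shift-side i zero X s) (T∙lift i y z)
      U∙Y : U i ∙ Y ≡ z
      U∙Y = trans (shift-side i (suc zero) X s) (U∙lift i y z)
      S∙Y : S ∙ Y ≡ c
      S∙Y = trans (shift S X s i) (trans (cong (S ∙ X +_) (recip-unmul SK≢0))
        (solve 2 (λ x c → x :+ (c :+ :- x) := c) refl (S ∙ X) c))
      unique : ∀ R → R I inj₂ (j , k , c) → Collinear model (i , y , z) R → R ≡ at j Y
      unique _ (refl , _) (inj₂ _ , (refl , _) , (refl , _)) = ⊥-elim (i≢j refl)
      unique (_ , y′ , z′) (refl , pick≡c) (inj₁ Y′ , (TY′ , UY′) , RY′) = trans (I⇒at RY′) (cong (at j) Y′≡Y)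
        where
        shifted : ∃[ t ] (Y′ ≡ Y ⊕ t · K i)
        shifted = ∙-unique i (trans TY′ (sym T∙Y)) (trans UY′ (sym U∙Y))
        S∙Y′ : S ∙ Y′ ≡ c
        S∙Y′ = trans (sym (pick-∙ j k Y′)) (trans (cong₂ (pick k) (proj₁ RY′) (proj₂ RY′)) pick≡c)
        t≡0 : proj₁ shifted ≡ 0#
        t≡0 = shift-≡0 {S} {Y} SK≢0 (trans (cong (S ∙_) (sym (proj₂ shifted))) (trans S∙Y′ (sym S∙Y)))
        Y′≡Y : Y′ ≡ Y
        Y′≡Y = trans (proj₂ shifted) (trans (cong (λ t → Y ⊕ t · K i) t≡0) (shift-0 Y i))

    linePoints : ∀ L → Σ (Fin q → Pt) λ f →
      (∀ i → f i I L) × (∀ i j → f i ≡ f j → i ≡ j) × (∀ P → P I L → ∃[ i ] (P ≡ f i))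
    linePoints (inj₁ X) = (λ i → at i X) , (λ i → at-I i X) , (λ i j → cong proj₁) , λ (i , _) PX → i , I⇒at PX
    linePoints (inj₂ (i , zero , c)) = (λ s → i , c , el s) , (λ _ → refl , refl) ,
      (λ s t eq → el-injective (cong (proj₂ ∘ proj₂) eq)) ,
      λ { (_ , _ , z) (refl , refl) → ix z , cong (λ z → i , c , z) (sym (el-ix z)) }
    linePoints (inj₂ (i , suc zero , c)) = (λ s → i , el s , c) , (λ _ → refl , refl) ,
      (λ s t eq → el-injective (cong (proj₁ ∘ proj₂) eq)) ,
      λ { (_ , y , _) (refl , refl) → ix y , cong (λ y → i , y , c) (sym (el-ix y)) }

    -- Two tangent planes and `q` affine points: one plane at each end of the enumeration gives the
    -- index type `suc (q + 1)` demanded by the order.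
    pointLines : ∀ P → Σ (Fin (suc (q ℕ.+ 1)) → Ln) λ g →
      (∀ i → P I g i) × (∀ i j → g i ≡ g j → i ≡ j) × (∀ L → P I L → ∃[ i ] (L ≡ g i))
    pointLines P@(i , y , z) = g , on , g-injective , g-onto
      where
      X = lift i y z
      g′ : Fin q ⊎ Fin 1 → Ln
      g′ (inj₁ s) = inj₁ (X ⊕ el s · K i)
      g′ (inj₂ zero) = inj₂ (i , suc zero , z)
      g : Fin (suc (q ℕ.+ 1)) → Ln
      g zero = inj₂ (i , zero , y)
      g (suc a) = g′ (splitAt q a)
      on′ : ∀ b → P I g′ b
      on′ (inj₁ s) = trans (shift-side i zero X (el s)) (T∙lift i y z) , trans (shift-side i (suc zero) X (el s)) (U∙lift i y z)
      on′ (inj₂ zero) = refl , refl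
      on : ∀ a → P I g a
      on zero = refl , refl
      on (suc a) = on′ (splitAt q a)
      g′-injective : ∀ b b′ → g′ b ≡ g′ b′ → b ≡ b′
      g′-injective (inj₁ s) (inj₁ t) eq = cong inj₁ (el-injective (shift-injective (K≢0 i) (inj₁-injective eq)))
      g′-injective (inj₁ s) (inj₂ zero) ()
      g′-injective (inj₂ zero) (inj₁ s) ()
      g′-injective (inj₂ zero) (inj₂ zero) eq = refl
      g₀≢ : ∀ b → inj₂ (i , zero , y) ≢ g′ b
      g₀≢ (inj₁ s) ()
      g₀≢ (inj₂ zero) ()
      g-injective : ∀ a b → g a ≡ g b → a ≡ b
      g-injective zero zero eq = refl
      g-injective zero (suc b) eq = ⊥-elim (g₀≢ (splitAt q b) eq)
      g-injective (suc a) zero eq = ⊥-elim (g₀≢ (splitAt q a) (sym eq))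
      g-injective (suc a) (suc b) eq = cong suc (splitAt-injective q (g′-injective _ _ eq))
      g-onto : ∀ L → P I L → ∃[ a ] (L ≡ g a)
      g-onto (inj₁ Y) (TY , UY) with ∙-unique i {Y} {X} (trans TY (sym (T∙lift i y z))) (trans UY (sym (U∙lift i y z)))
      ... | s , Y≡ = suc (ix s ↑ˡ 1) , trans (cong inj₁ (trans Y≡ (cong (λ t → X ⊕ t · K i) (sym (el-ix s)))))
                         (cong g′ (sym (splitAt-↑ˡ q (ix s) 1)))
      g-onto (inj₂ (_ , zero , _)) (refl , refl) = zero , refl
      g-onto (inj₂ (_ , suc zero , _)) (refl , refl) = suc (q ↑ʳ zero) , cong g′ (sym (splitAt-↑ʳ q 1 zero))

    -- The index witnesses that `q` is positive, so that `suc (q ∸ 1)` is `q`.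
    isGQ : Fin q → IsGQ model (q ∸ 1) (q ℕ.+ 1)
    isGQ i₀ = record
      { linePoints = λ L → subst (λ m → Σ (Fin m → Pt) λ f →
          (∀ i → f i I L) × (∀ i j → f i ≡ f j → i ≡ j) × (∀ P → P I L → ∃[ i ] (P ≡ f i)))
          (q≡ (predecessor i₀)) (linePoints L)
      ; pointLines = pointLines
      ; atMostOneLine = atMostOne
      ; uniqueProjection = λ { (i , y , z) (inj₁ X) → ToAffine.project i y z X
                             ; P (inj₂ (j , k , c)) → projectPlane P j k c }
      }
      where
      q≡ : ∃[ n ] (q ≡ suc n) → q ≡ suc (q ∸ 1)
      q≡ (_ , eq) = trans eq (cong (λ m → suc (m ∸ 1)) (sym eq))

-- Transfer from projective coordinates

discrete : (Pt Ln : Set) → (Pt → Ln → Set) → IncStr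
discrete Pt Ln _I_ = record { Pt = Pt ; Ln = Ln ; _≈P_ = _≡_ ; _≈L_ = _≡_ ; _I_ = _I_ }

module _ {A : IncStr} {Pt Ln : Set} {_I_ : Pt → Ln → Set} (iso : Isomorphism A (discrete Pt Ln _I_)) where
  open Isomorphism iso using (fP; fL; fP-resp; fP-inj; fP-surj; fL-resp; fL-inj; fL-surj; inc-pres; inc-refl)
  open IncStr A using (_≈P_; _≈L_) renaming (Pt to Point; Ln to Line; _I_ to _IA_)

  private
    preP : Pt → Point
    preP = proj₁ ∘ fP-surj

    preL : Ln → Line
    preL = proj₁ ∘ fL-surj

    pre-inc : ∀ {p L} → p I fL L → preP p IA L
    pre-inc {p} {L} h = inc-refl _ L (subst (_I fL L) (sym (proj₂ (fP-surj p))) h)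

    inc-pre : ∀ {P m} → fP P I m → P IA preL m
    inc-pre {P} {m} h = inc-refl P _ (subst (fP P I_) (sym (proj₂ (fL-surj m))) h)

    collinear⁺ : ∀ {P Q} → Collinear A P Q → Collinear (discrete Pt Ln _I_) (fP P) (fP Q)
    collinear⁺ (M , PM , QM) = fL M , inc-pres _ M PM , inc-pres _ M QM

  -- Points and lines are pulled back along chosen preimages; the choice is harmless because
  -- `fP-inj` and `fL-inj` reflect equality into the relations of `A`.
  transferGQ : ∀ {s t} → IsGQ (discrete Pt Ln _I_) s t → IsGQ A s t
  transferGQ gq = record
    { linePoints = λ L → let (f , on , inj , onto) = B.linePoints (fL L) in
        preP ∘ f , (λ i → pre-inc (on i)) ,
        (λ i j eq → inj i j (trans (sym (proj₂ (fP-surj (f i)))) (trans (fP-resp _ _ eq) (proj₂ (fP-surj (f j)))))) ,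
        λ P PL → let (i , eq) = onto (fP P) (inc-pres P L PL) in
          i , fP-inj _ _ (trans eq (sym (proj₂ (fP-surj (f i)))))
    ; pointLines = λ P → let (g , on , inj , onto) = B.pointLines (fP P) in
        preL ∘ g , (λ i → inc-pre (on i)) ,
        (λ i j eq → inj i j (trans (sym (proj₂ (fL-surj (g i)))) (trans (fL-resp _ _ eq) (proj₂ (fL-surj (g j)))))) ,
        λ L PL → let (i , eq) = onto (fL L) (inc-pres P L PL) in
          i , fL-inj _ _ (trans eq (sym (proj₂ (fL-surj (g i)))))
    ; atMostOneLine = λ P Q L M P≉Q PL QL PM QM → fL-inj _ _ (B.atMostOneLine (fP P) (fP Q) (fL L) (fL M)
        (P≉Q ∘ fP-inj P Q) (inc-pres _ _ PL) (inc-pres _ _ QL) (inc-pres _ _ PM) (inc-pres _ _ QM))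
    ; uniqueProjection = λ P L ¬PL →
        let (Q , QL , (M , PM , QM) , unique) = B.uniqueProjection (fP P) (fL L) (¬PL ∘ inc-refl P L) in
        preP Q , pre-inc QL ,
        (preL M , inc-pre PM , inc-pre (subst (_I M) (sym (proj₂ (fP-surj Q))) QM)) ,
        λ R RL PR → fP-inj _ _ (trans (unique (fP R) (inc-pres R L RL) (collinear⁺ PR)) (sym (proj₂ (fP-surj Q))))
    }
    where module B = IsGQ gq

  compose : ∀ {Pt′ Ln′ : Set} {_I′_ : Pt′ → Ln′ → Set} →
    Isomorphism (discrete Pt Ln _I_) (discrete Pt′ Ln′ _I′_) → Isomorphism A (discrete Pt′ Ln′ _I′_)
  compose iso′ = record
    { fP = J.fP ∘ fP
    ; fL = J.fL ∘ fL
    ; fP-resp = λ P Q eq → cong J.fP (fP-resp P Q eq)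
    ; fP-inj = λ P Q eq → fP-inj P Q (J.fP-inj _ _ eq)
    ; fP-surj = λ p → let (r , eq) = J.fP-surj p in preP r , trans (cong J.fP (proj₂ (fP-surj r))) eq
    ; fL-resp = λ P Q eq → cong J.fL (fL-resp P Q eq)
    ; fL-inj = λ P Q eq → fL-inj P Q (J.fL-inj _ _ eq)
    ; fL-surj = λ p → let (r , eq) = J.fL-surj p in preL r , trans (cong J.fL (proj₂ (fL-surj r))) eq
    ; inc-pres = λ P L h → J.inc-pres _ _ (inc-pres P L h)
    ; inc-refl = λ P L h → inc-refl P L (J.inc-refl _ _ h)
    }
    where module J = Isomorphism iso′

-- Homogeneous coordinates as vectors and covectors of dimension three

module Structures (𝔽 : Field) (q : ℕ) (enum : Field.Carrier 𝔽 ↔ Fin q)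
    (𝕂 : Fin q → Proj.Vec 𝔽 3) (isArc : Proj.IsArc 𝔽 𝕂) where
  open FiniteField 𝔽 q enum
  open Geometry 𝔽 q enum
  open Arcs 𝔽 q enum
  open Models 𝔽 q enum
  open Proj 𝔽
  open Construction 𝕂
  open IsArc isArc

  pattern i0 = zero
  pattern i1 = suc zero
  pattern i2 = suc (suc zero)
  pattern i3 = suc (suc (suc zero))

  toV : Vec 3 → V
  toV x = vec (x i0) (x i1) (x i2)

  fromV : V → Vec 3
  fromV X i0 = v₀ X
  fromV X i1 = v₁ X
  fromV X i2 = v₂ X

  opaque
    unfolding _∙_ _·_ _⊕_
    dot-∙ : ∀ (a x : Vec 3) → dot a x ≡ toV a ∙ toV x
    dot-∙ a x = solve 6 (λ a b c x y z → a :* x :+ (b :* y :+ (c :* z :+ :0)) := a :* x :+ b :* y :+ c :* z)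
      refl (a i0) (a i1) (a i2) (x i0) (x i1) (x i2)

    dot₄ : ∀ (b p : Vec 4) → dot b p ≡ vec (b i0) (b i1) (b i2) ∙ vec (p i0) (p i1) (p i2) + b i3 * p i3
    dot₄ a x = solve 8 (λ a b c d x y z w → a :* x :+ (b :* y :+ (c :* z :+ (d :* w :+ :0))) :=
      (a :* x :+ b :* y :+ c :* z) :+ d :* w)
      refl (a i0) (a i1) (a i2) (a i3) (x i0) (x i1) (x i2) (x i3)

    vec-· : ∀ s x y z → s · vec x y z ≡ vec (s * x) (s * y) (s * z)
    vec-· s x y z = refl

    v₀-·⊕ : ∀ s X t Y → v₀ (s · X ⊕ t · Y) ≡ s * v₀ X + t * v₀ Y
    v₀-·⊕ s X t Y = refl

    v₁-·⊕ : ∀ s X t Y → v₁ (s · X ⊕ t · Y) ≡ s * v₁ X + t * v₁ Y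
    v₁-·⊕ s X t Y = refl

    v₂-·⊕ : ∀ s X t Y → v₂ (s · X ⊕ t · Y) ≡ s * v₂ X + t * v₂ Y
    v₂-·⊕ s X t Y = refl

  dot-fromV : ∀ X x → dot (fromV X) x ≡ X ∙ toV x
  dot-fromV X x = dot-∙ (fromV X) x

  fromV-≢0 : ∀ {X} → X ≢ 0V → NonZero (fromV X)
  fromV-≢0 X≢0 all0 = X≢0 (vec-cong (all0 i0) (all0 i1) (all0 i2))

  toV-≢0 : ∀ {x} → NonZero x → toV x ≢ 0V
  toV-≢0 {x} ne eq = ne λ { i0 → cong v₀ eq ; i1 → cong v₁ eq ; i2 → cong v₂ eq }

  scaled : ∀ {s} {x y : Vec 3} → toV x ≡ s · toV y → ∀ m → x m ≡ s * y m
  scaled {s} {x} {y} eq = λ { i0 → cong v₀ eq′ ; i1 → cong v₁ eq′ ; i2 → cong v₂ eq′ }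
    where eq′ = trans eq (vec-· s (y i0) (y i1) (y i2))

  -- If the determinant of three points vanished, the covector `k i ⨯ k j` would be a line through
  -- all of them.
  arc : Arc
  arc = record { K = k ; K≢0 = k≢0 ; indep₂ = independent₂ ; indep₃ = independent₃ }
    where
    k : Fin q → V
    k = toV ∘ 𝕂
    k≢0 : ∀ i → k i ≢ 0V
    k≢0 i = toV-≢0 (nonzero i)
    independent₂ : ∀ {i j} → i ≢ j → k i ⨯ k j ≢ 0V
    independent₂ {i} {j} i≢j K⨯K with ⨯≡0⇒parallel (k≢0 j) K⨯K
    ... | s , eq = distinct i j i≢j (s , (λ { refl → k≢0 i (trans eq (0· (k j))) }) , scaled eq)
    independent₃ : ∀ {i j l} → i ≢ j → j ≢ l → i ≢ l → det (k i) (k j) (k l) ≢ 0#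
    independent₃ {i} {j} {l} i≢j j≢l i≢l eq = noThree i j l i≢j j≢l i≢l
      ( fromV (k i ⨯ k j) , fromV-≢0 (independent₂ i≢j)
      , trans (dot-fromV _ (𝕂 i)) (trans (∙-comm _ (k i)) (det-XXY (k i) (k j)))
      , trans (dot-fromV _ (𝕂 j)) (trans (∙-comm _ (k j)) (det-XYX (k j) (k i)))
      , trans (dot-fromV _ (𝕂 l)) (trans (∙-comm _ (k l)) (trans (det-cyclic (k l) (k i) (k j)) eq)) )

  bar : Vec 4 → V
  bar p = vec (p i0) (p i1) (p i2)

  normalised : Vec 4 → V
  normalised p = recip (x₃ p) · bar p

  affine : V → Vec 4
  affine X i0 = v₀ X
  affine X i1 = v₁ X
  affine X i2 = v₂ X
  affine X i3 = 1#

  normalised-affine : ∀ X → normalised (affine X) ≡ X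
  normalised-affine X = trans (cong (_· X) (trans (sym (*-identityˡ _)) (recipʳ 1≢0))) (1· X)

  pointwise : ∀ {a b} {p u w : Vec 4} → bar p ≡ a · bar u ⊕ b · bar w → x₃ p ≡ a * x₃ u + b * x₃ w →
    ∀ m → p m ≡ a * u m + b * w m
  pointwise {a} {b} {p} {u} {w} e e₃ = λ
    { i0 → trans (cong v₀ e) (v₀-·⊕ a (bar u) b (bar w)) ; i1 → trans (cong v₁ e) (v₁-·⊕ a (bar u) b (bar w))
    ; i2 → trans (cong v₂ e) (v₂-·⊕ a (bar u) b (bar w)) ; i3 → e₃ }

  bar-combination : ∀ {a b} {p u w : Vec 4} → (∀ m → p m ≡ a * u m + b * w m) → bar p ≡ a · bar u ⊕ b · bar w
  bar-combination {a} {b} {p} {u} {w} e = vec-cong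
    (trans (e i0) (sym (v₀-·⊕ a (bar u) b (bar w)))) (trans (e i1) (sym (v₁-·⊕ a (bar u) b (bar w))))
    (trans (e i2) (sym (v₂-·⊕ a (bar u) b (bar w))))

  open Arc arc

  -- OnAxis i X is the line joining K i to the affine point X.
  OnAxis : Fin q → V → Vec 4 → Set
  OnAxis i X p = NonZero p × ∃[ a ] (bar p ≡ x₃ p · X ⊕ a · K i)

  private
    nonzero-at : ∀ {n} {p : Vec n} m → p m ≢ 0# → NonZero p
    nonzero-at m ne all0 = ne (all0 m)

    solve-combination : ∀ {κ X p : Vec 4} {i} → bar κ ≡ K i → x₃ κ ≡ 0# → x₃ X ≡ 1# →
      ∀ {a b} → (∀ m → p m ≡ a * κ m + b * X m) → bar p ≡ x₃ p · bar X ⊕ a · K i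
    solve-combination {κ} {X} {p} {i} κ≡ κ₃ X₃ {a} {b} e =
      trans (bar-combination {p = p} {κ} {X} e) (trans (cong₂ (λ Z s → a · Z ⊕ s · bar X) κ≡ (sym p₃)) (⊕-comm _ _))
      where
      p₃ : x₃ p ≡ b
      p₃ = trans (e i3) (trans (cong₂ (λ s t → a * s + b * t) κ₃ X₃) (solve 2 (λ a b → a :* :0 :+ b :* :1 := b) refl a b))

  opaque
    affinePoint : ∀ ℓ → ¬ LineInH ℓ → ∃[ p ] (OnLine p ℓ × x₃ p ≡ 1#)
    affinePoint ℓ@(pline u w _) ∉H with x₃ u ≟ 0# | x₃ w ≟ 0#
    ... | no u₃≢0 | _ = (λ m → recip (x₃ u) * u m) ,
      (nonzero-at i3 (λ eq → 1≢0 (trans (sym (recipˡ u₃≢0)) eq)) , recip (x₃ u) , 0# ,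
        λ m → solve 3 (λ r u w → r :* u := r :* u :+ :0 :* w) refl (recip (x₃ u)) (u m) (w m)) , recipˡ u₃≢0
    ... | yes _ | no w₃≢0 = (λ m → recip (x₃ w) * w m) ,
      (nonzero-at i3 (λ eq → 1≢0 (trans (sym (recipˡ w₃≢0)) eq)) , 0# , recip (x₃ w) ,
        λ m → solve 3 (λ r u w → r :* w := :0 :* u :+ r :* w) refl (recip (x₃ w)) (u m) (w m)) , recipˡ w₃≢0
    ... | yes u₃ | yes w₃ = ⊥-elim (∉H λ { p (_ , a , b , e) → trans (e i3)
      (trans (cong₂ (λ s t → a * s + b * t) u₃ w₃) (solve 2 (λ a b → a :* :0 :+ b :* :0 := :0) refl a b)) })

  -- Cramer's rule for passing from the given basis `u`, `w` of the line to `κ`, `X`. The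
  -- determinant `Δ` is nonzero because `X` is affine and `κ` is a nonzero vector at infinity.
  onLine⇔onAxis : ∀ {ℓ i X} → OnLine (embed (𝕂 i)) ℓ → OnLine X ℓ → x₃ X ≡ 1# →
    ∀ p → (OnLine p ℓ → OnAxis i (bar X) p) × (OnAxis i (bar X) p → OnLine p ℓ)
  onLine⇔onAxis {pline u w ind} {i} {X} (κ≢0 , α , β , κ≡) (X≢0 , γ , δ , X≡) X₃ p = to , from
    where
    κ = embed (𝕂 i)
    Δ = α * δ + - (β * γ)
    Δu : ∀ m → Δ * u m ≡ δ * κ m + - (β * X m)
    Δu m = trans (solve 6 (λ α β γ δ u w → (α :* δ :+ :- (β :* γ)) :* u :=
        δ :* (α :* u :+ β :* w) :+ :- (β :* (γ :* u :+ δ :* w))) refl α β γ δ (u m) (w m))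
      (sym (cong₂ (λ s t → δ * s + - (β * t)) (κ≡ m) (X≡ m)))
    Δw : ∀ m → Δ * w m ≡ - (γ * κ m) + α * X m
    Δw m = trans (solve 6 (λ α β γ δ u w → (α :* δ :+ :- (β :* γ)) :* w :=
        :- (γ :* (α :* u :+ β :* w)) :+ α :* (γ :* u :+ δ :* w)) refl α β γ δ (u m) (w m))
      (sym (cong₂ (λ s t → - (γ * s) + α * t) (κ≡ m) (X≡ m)))
    Δ≢0 : Δ ≢ 0#
    Δ≢0 Δ≡0 = κ≢0 λ m → trans (κ≡ m) (trans (cong₂ (λ a b → a * u m + b * w m) α≡0 β≡0)
        (solve 2 (λ u w → :0 :* u :+ :0 :* w := :0) refl (u m) (w m)))
      where
      α≡0 : α ≡ 0#
      α≡0 = trans (solve 2 (λ g a → a := :- (g :* :0) :+ a :* :1) refl γ α)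
        (trans (cong (λ z → - (γ * 0#) + α * z) (sym X₃)) (trans (sym (Δw i3)) (trans (cong (_* w i3) Δ≡0) (zeroˡ _))))
      β≡0 : β ≡ 0#
      β≡0 = trans (solve 2 (λ d b → b := :- (d :* :0 :+ :- (b :* :1))) refl δ β)
        (trans (cong (λ z → - (δ * 0# + - (β * z))) (sym X₃)) (trans (cong -_ (trans (sym (Δu i3))
          (trans (cong (_* u i3) Δ≡0) (zeroˡ _)))) (solve 0 (:- :0 := :0) refl)))
    to : OnLine p (pline u w ind) → OnAxis i (bar X) p
    to (p≢0 , a , b , p≡) = p≢0 , recip Δ * (a * δ + - (b * γ)) , solve-combination {κ} {X} {p} {i} refl refl X₃
      {recip Δ * (a * δ + - (b * γ))} {recip Δ * (- (a * β) + b * α)}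
      λ m → *-cancelˡ Δ≢0 (begin
        Δ * p m ≡⟨ cong (Δ *_) (p≡ m) ⟩
        Δ * (a * u m + b * w m) ≡⟨ solve 5 (λ d a b u w → d :* (a :* u :+ b :* w) := a :* (d :* u) :+ b :* (d :* w))
                                     refl Δ a b (u m) (w m) ⟩
        a * (Δ * u m) + b * (Δ * w m) ≡⟨ cong₂ (λ s t → a * s + b * t) (Δu m) (Δw m) ⟩
        a * (δ * κ m + - (β * X m)) + b * (- (γ * κ m) + α * X m)
          ≡⟨ solve 8 (λ a b α β γ δ k x → a :* (δ :* k :+ :- (β :* x)) :+ b :* (:- (γ :* k) :+ α :* x) :=
               :1 :* ((a :* δ :+ :- (b :* γ)) :* k :+ (:- (a :* β) :+ b :* α) :* x)) refl a b α β γ δ (κ m) (X m) ⟩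
        1# * (A * κ m + B * X m) ≡⟨ cong (_* (A * κ m + B * X m)) (sym (recipʳ Δ≢0)) ⟩
        (Δ * recip Δ) * (A * κ m + B * X m)
          ≡⟨ solve 6 (λ d r a b k x → (d :* r) :* (a :* k :+ b :* x) := d :* ((r :* a) :* k :+ (r :* b) :* x))
               refl Δ (recip Δ) A B (κ m) (X m) ⟩
        Δ * ((recip Δ * A) * κ m + (recip Δ * B) * X m) ∎)
      where
      open ≡-Reasoning
      A = a * δ + - (b * γ)
      B = - (a * β) + b * α
    from : OnAxis i (bar X) p → OnLine p (pline u w ind)
    from (p≢0 , a , e) = p≢0 , a * α + x₃ p * γ , a * β + x₃ p * δ , λ m → begin
      p m ≡⟨ pointwise {x₃ p} {a} {p} {X} {κ} e p₃ m ⟩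
      x₃ p * X m + a * κ m ≡⟨ cong₂ (λ s t → x₃ p * s + a * t) (X≡ m) (κ≡ m) ⟩
      x₃ p * (γ * u m + δ * w m) + a * (α * u m + β * w m)
        ≡⟨ solve 8 (λ s a α β γ δ u w → s :* (γ :* u :+ δ :* w) :+ a :* (α :* u :+ β :* w) :=
             (a :* α :+ s :* γ) :* u :+ (a :* β :+ s :* δ) :* w) refl (x₃ p) a α β γ δ (u m) (w m) ⟩
      (a * α + x₃ p * γ) * u m + (a * β + x₃ p * δ) * w m ∎
      where
      open ≡-Reasoning
      p₃ : x₃ p ≡ x₃ p * x₃ X + a * 0#
      p₃ = trans (solve 2 (λ p a → p := p :* :1 :+ a :* :0) refl (x₃ p) a) (cong (λ z → x₃ p * z + a * 0#) (sym X₃))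

-- The geometric structure in tangent coordinates

module Isos (𝔽 : Field) (q : ℕ) (enum : Field.Carrier 𝔽 ↔ Fin q)
    (𝕂 : Fin q → Proj.Vec 𝔽 3) (isArc : Proj.IsArc 𝔽 𝕂) where
  open FiniteField 𝔽 q enum
  open Geometry 𝔽 q enum
  open Arcs 𝔽 q enum
  open Models 𝔽 q enum
  open Structures 𝔽 q enum 𝕂 isArc
  open Proj 𝔽
  open Construction 𝕂
  open IsArc isArc

  module Coordinates (tangents : ∀ i → TangentPair arc i) where
    open Arc arc
    open Model arc tangents renaming (_I_ to _Iₘ_; atMostOne to atMostOneₘ; linePoints to linePointsₘ)

    -- Every line has two different points, indexed by `0#` and `1#`, so it is determined by its
    -- points. Equalities of lines thereby reduce to incidences.
    distinct-points : ∀ {L : Ln} {M} → (∀ {P} → P Iₘ L → P Iₘ M) → L ≡ M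
    distinct-points {L} {M} sub with linePointsₘ L
    ... | f , on , inj , _ = atMostOneₘ (f (ix 0#)) (f (ix 1#)) L M
      (λ eq → 0≢1 (ix-injective (inj _ _ eq))) (on _) (on _) (sub (on _)) (sub (on _))

    side-index : ∀ {i j} k → side j k ∙ K i ≡ 0# → i ≡ j
    side-index {i} {j} k eq with i ≟F j
    ... | yes i≡j = i≡j
    ... | no i≢j = ⊥-elim (side-tangent j k i≢j eq)

    affineOf : Point → Vec 4
    affineOf (ℓ , ∉H , _) = proj₁ (affinePoint ℓ ∉H)

    indexOf : Point → Fin q
    indexOf (_ , _ , i , _) = i

    module _ (P : Point) where
      private
        ℓ = proj₁ P
        i = indexOf P
        X = affineOf P

        X∈ℓ : OnLine X ℓ
        X∈ℓ = proj₁ (proj₂ (affinePoint ℓ (proj₁ (proj₂ P))))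

      x₃-affineOf : x₃ X ≡ 1#
      x₃-affineOf = proj₂ (proj₂ (affinePoint ℓ (proj₁ (proj₂ P))))

      affineOf-onLine : OnLine X ℓ
      affineOf-onLine = X∈ℓ

      opaque
        on⇒axis : ∀ {p} → OnLine p ℓ → OnAxis i (bar X) p
        on⇒axis {p} = proj₁ (onLine⇔onAxis {ℓ} {i} {X} (proj₂ (proj₂ (proj₂ P))) X∈ℓ x₃-affineOf p)

        axis⇒on : ∀ {p} → OnAxis i (bar X) p → OnLine p ℓ
        axis⇒on {p} = proj₂ (onLine⇔onAxis {ℓ} {i} {X} (proj₂ (proj₂ (proj₂ P))) X∈ℓ x₃-affineOf p)

      centre-on : OnLine (embed (𝕂 i)) ℓ
      centre-on = proj₂ (proj₂ (proj₂ P))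

    pointMap : Point → Pt
    pointMap P = at (indexOf P) (bar (affineOf P))

    normalised-axis : ∀ {i X p} → x₃ p ≢ 0# → OnAxis i X p → at i (normalised p) ≡ at i X
    normalised-axis {i} {X} {p} p₃≢0 (_ , a , e) = trans (cong (at i) (trans (cong (recip (x₃ p) ·_) e)
      (·-affine (recipˡ p₃≢0)))) (at-shift i X (recip (x₃ p) * a))

    axis-normalised : ∀ {i X p} → x₃ p ≢ 0# → at i (normalised p) ≡ at i X → OnAxis i X p
    axis-normalised {i} {X} {p} p₃≢0 eq with at-unique eq
    ... | s , e = (λ all0 → p₃≢0 (all0 i3)) , x₃ p * s ,
      trans (sym (trans (·-· _ _ _) (trans (cong (_· bar p) (recipʳ p₃≢0)) (1· _))))
        (trans (cong (x₃ p ·_) e) (·-⊕· (x₃ p) X s (K i)))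

    axis-at : ∀ {i X p} → x₃ p ≡ 1# → OnAxis i X p → at i (bar p) ≡ at i X
    axis-at {i} {X} {p} p₃ (_ , a , e) = trans (cong (at i) (trans e
      (cong (_⊕ a · K i) (trans (cong (_· X) p₃) (1· X))))) (at-shift i X a)

    axis-reindex : ∀ {i X Y p} → at i X ≡ at i Y → OnAxis i X p → OnAxis i Y p
    axis-reindex {i} {X} {Y} {p} eq (p≢0 , a , e) with at-unique eq
    ... | s , X≡ = p≢0 , x₃ p * s + a , trans e (trans (cong (λ Z → x₃ p · Z ⊕ a · K i) X≡) (·-⊕·-⊕ (x₃ p) Y s a (K i)))

    -- A line outside the plane at infinity meets that plane once, so equal lines have the same arc
    -- point; then any affine point of the line gives the same coordinates.
    pointMap-respects : ∀ P Q → SameLine (proj₁ P) (proj₁ Q) → pointMap P ≡ pointMap Q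
    pointMap-respects P Q same with indexOf P ≟F indexOf Q
    ... | no i≢j = ⊥-elim (indep₂ (i≢j ∘ sym) (parallel⇒⨯≡0 (trans (proj₂ axis) (drop-0· _ _))))
      where
      axis : ∃[ a ] (K (indexOf Q) ≡ 0# · bar (affineOf P) ⊕ a · K (indexOf P))
      axis = proj₂ (on⇒axis P (proj₂ (same (embed (𝕂 (indexOf Q)))) (centre-on Q)))
    ... | yes i≡j = sym (trans (cong (λ i → at i (bar (affineOf Q))) (sym i≡j))
      (axis-at {X = bar (affineOf P)} {p = affineOf Q} (x₃-affineOf Q)
        (on⇒axis P (proj₂ (same (affineOf Q)) (affineOf-onLine Q)))))

    pointMap-injective : ∀ P Q → pointMap P ≡ pointMap Q → SameLine (proj₁ P) (proj₁ Q)
    pointMap-injective P Q eq p = move P Q eq , move Q P (sym eq)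
      where
      move : ∀ P Q → pointMap P ≡ pointMap Q → OnLine p (proj₁ P) → OnLine p (proj₁ Q)
      move P Q eq on = axis⇒on Q (subst (λ j → OnAxis j (bar (affineOf Q)) p) i≡j
        (axis-reindex {p = p} (trans eq (cong (λ j → at j (bar (affineOf Q))) (sym i≡j))) (on⇒axis P on)))
        where
        i≡j : indexOf P ≡ indexOf Q
        i≡j = cong proj₁ eq

    point : Fin q → V → Point
    point i X = pline κ Xᵃ independent , (λ inH → 1≢0 (inH Xᵃ X-on)) , i ,
      (λ all0 → K≢0 i (vec-cong (all0 i0) (all0 i1) (all0 i2))) , 1# , 0# ,
        λ m → solve 2 (λ k x → k := :1 :* k :+ :0 :* x) refl (κ m) (Xᵃ m)
      where
      κ = embed (𝕂 i)
      Xᵃ = affine X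
      independent : Independent κ Xᵃ
      independent a b e = a≡0 , b≡0
        where
        b≡0 : b ≡ 0#
        b≡0 = trans (solve 2 (λ a b → b := a :* :0 :+ b :* :1) refl a b) (e i3)
        a≡0 : a ≡ 0#
        a≡0 with a ≟ 0#
        ... | yes eq = eq
        ... | no a≢0 = ⊥-elim (K≢0 i (vec-cong (zero-at i0) (zero-at i1) (zero-at i2)))
          where
          zero-at : ∀ m → κ m ≡ 0#
          zero-at m = *-≡0 a≢0 (trans (solve 3 (λ a k x → a :* k := a :* k :+ :0 :* x) refl a (κ m) (Xᵃ m))
            (trans (cong (λ b → a * κ m + b * Xᵃ m) (sym b≡0)) (e m)))
      X-on : OnLine Xᵃ (pline κ Xᵃ independent)
      X-on = (λ all0 → 1≢0 (all0 i3)) , 0# , 1# , λ m → solve 2 (λ k x → x := :0 :* k :+ :1 :* x) refl (κ m) (Xᵃ m)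

    pointMap-point : ∀ i X → pointMap (point i X) ≡ at i X
    pointMap-point i X = sym (axis-at {X = bar (affineOf P)} {p = affine X} refl (on⇒axis P
      ((λ all0 → 1≢0 (all0 i3)) , 0# , 1# , λ m → solve 2 (λ k x → x := :0 :* k :+ :1 :* x) refl (embed (𝕂 i) m) (affine X m))))
      where P = point i X

    pointMap-onto : ∀ P′ → ∃[ P ] (pointMap P ≡ P′)
    pointMap-onto (i , y , z) = point i (lift i y z) , trans (pointMap-point i _)
      (cong₂ (λ y z → i , y , z) (T∙lift i y z) (U∙lift i y z))

    -- A covector vanishing at `K j` is a combination of `T j` and `U j`. With both coefficients
    -- nonzero it would be a secant, by `secant`.
    tangent-side : ∀ {a : Vec 3} → Tangent 𝕂 a → ∃[ j ] ∃[ k ] ∃[ s ] (dot a (𝕂 j) ≡ 0# × toV a ≡ s · side j k)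
    tangent-side {a} (a≢0 , j , aKj , only) = j , proj₁ cases , proj₁ (proj₂ cases) , aKj , proj₂ (proj₂ cases)
      where
      α β : Carrier
      α = toV a ∙ lift j 1# 0#
      β = toV a ∙ lift j 0# 1#
      expand : ∀ X → toV a ∙ X ≡ α * (T j ∙ X) + β * (U j ∙ X)
      expand X = trans (cong (toV a ∙_) (proj₂ same)) (trans (∙-⊕ʳ _ _ _)
          (trans (cong₂ _+_ (lift-linear j (toV a) _ _) (trans (∙-·ʳ (toV a) _ (K j))
            (trans (cong (proj₁ same *_) (trans (sym (dot-∙ a (𝕂 j))) aKj)) (zeroʳ _)))) (+-identityʳ _)))
        where
        same : ∃[ s ] (X ≡ lift j (T j ∙ X) (U j ∙ X) ⊕ s · K j)
        same = ∙-unique j (sym (T∙lift j _ _)) (sym (U∙lift j _ _))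
      cases : ∃[ k ] ∃[ s ] (toV a ≡ s · side j k)
      cases with α ≟ 0# | β ≟ 0#
      ... | yes α≡0 | _ = suc zero , β , ∙-ext λ X → trans (expand X) (trans (cong (λ α → α * (T j ∙ X) + β * (U j ∙ X)) α≡0)
        (trans (solve 3 (λ x b u → :0 :* x :+ b :* u := b :* u) refl (T j ∙ X) β (U j ∙ X)) (sym (∙-·ˡ β (U j) X))))
      ... | no _ | yes β≡0 = zero , α , ∙-ext λ X → trans (expand X) (trans (cong (λ β → α * (T j ∙ X) + β * (U j ∙ X)) β≡0)
        (trans (solve 3 (λ x a u → a :* x :+ :0 :* u := a :* x) refl (T j ∙ X) α (U j ∙ X)) (sym (∙-·ˡ α (T j) X))))
      ... | no α≢0 | no β≢0 with secant j { - β} {α} (-‿≢0 β≢0) α≢0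
      ...   | c , c≢j , eq = ⊥-elim (c≢j (only c (trans (dot-∙ a (𝕂 c)) (trans (expand (K c))
              (trans (cong (λ t → α * t + β * (U j ∙ K c)) (sym (ratio-*U j c≢j)))
              (trans (solve 4 (λ a b r u → a :* (r :* u) :+ b :* u := (r :* a) :* u :+ b :* u) refl α β (ratio j c) (U j ∙ K c))
              (trans (cong (λ z → z * (U j ∙ K c) + β * (U j ∙ K c)) (sym eq))
              (solve 2 (λ b u → (:- b) :* u :+ b :* u := :0) refl β (U j ∙ K c)))))))))

    PlaneForm : Vec 4 → Set
    PlaneForm b = ∃[ j ] ∃[ k ] ∃[ r ] (r ≢ 0# × bar b ≡ r · side j k)

    opaque
      planeForm : (β : TangentPlane) → PlaneForm (proj₁ β)
      planeForm (b , b≢0 , b≢H , a , tangent@(a≢0 , _) , contains) with tangent-side tangent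
      ... | j , k , s , _ , a≡ = j , k , proj₁ b∥a * s , *-≢0 r≢0 s≢0 , trans (proj₂ b∥a) (trans (cong (proj₁ b∥a ·_) a≡) (·-· _ _ _))
        where
        ā : V
        ā = toV a
        b∥a : ∃[ r ] (bar b ≡ r · ā)
        -- `L` and `M` span the kernel of `ā`, on which `bar b` vanishes as well; the Lagrange
        -- identity then makes `bar b` parallel to `ā`.
        b∥a with perp-basis (toV-≢0 a≢0)
        ... | L , M , ρ , ρ≢0 , L⨯M = ⨯≡0⇒parallel (toV-≢0 a≢0) (·-≡0V ρ≢0 (begin
          ρ · (bar b ⨯ ā) ≡⟨ sym (⨯-·ʳ (bar b) ρ ā) ⟩
          bar b ⨯ (ρ · ā) ≡⟨ cong (bar b ⨯_) (sym L⨯M) ⟩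
          bar b ⨯ (L ⨯ M) ≡⟨ lagrange (bar b) L M ⟩
          (bar b ∙ M) · L ⊕ (- (bar b ∙ L)) · M
            ≡⟨ cong₂ (λ x y → x · L ⊕ (- y) · M) (kills M (trans (cong (_∙ M) (sym ā≡)) (scaled0 (det-XYX M L))))
                 (kills L (trans (cong (_∙ L) (sym ā≡)) (scaled0 (det-XXY L M)))) ⟩
          0# · L ⊕ (- 0#) · M ≡⟨ 0·⊕-0· L M ⟩
          0V ∎))
          where
          open ≡-Reasoning
          ā≡ : recip ρ · (L ⨯ M) ≡ ā
          ā≡ = trans (cong (recip ρ ·_) L⨯M) (trans (·-· _ _ _) (trans (cong (_· ā) (recipˡ ρ≢0)) (1· ā)))
          scaled0 : ∀ {s Y} → det Y L M ≡ 0# → (s · (L ⨯ M)) ∙ Y ≡ 0#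
          scaled0 {s} {Y} eq = trans (∙-·ˡ s (L ⨯ M) Y) (trans (cong (s *_) (trans (∙-comm _ Y) eq)) (zeroʳ s))
          kills : ∀ X → ā ∙ X ≡ 0# → bar b ∙ X ≡ 0#
          kills X aX with X ≟V 0V
          ... | yes refl = ∙-0V (bar b)
          ... | no X≢0 = begin
            bar b ∙ X ≡⟨ solve 2 (λ x y → x := x :+ y :* :0) refl (bar b ∙ X) (x₃ b) ⟩
            bar b ∙ X + x₃ b * 0# ≡⟨ sym (dot₄ b (embed (fromV X))) ⟩
            dot b (embed (fromV X)) ≡⟨ contains (fromV X) (fromV-≢0 X≢0) (trans (dot-∙ a (fromV X)) aX) ⟩
            0# ∎
        r≢0 : proj₁ b∥a ≢ 0#
        -- Without its first three coordinates the plane would be the one at infinity.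
        r≢0 r≡0 = b≢H (x₃ b , b₃≢0 , λ
          { i0 → trans (cong v₀ bar≡0) (sym (zeroʳ _)) ; i1 → trans (cong v₁ bar≡0) (sym (zeroʳ _))
          ; i2 → trans (cong v₂ bar≡0) (sym (zeroʳ _)) ; i3 → sym (*-identityʳ _) })
          where
          bar≡0 : bar b ≡ 0V
          bar≡0 = trans (proj₂ b∥a) (trans (cong (_· ā) r≡0) (0· ā))
          b₃≢0 : x₃ b ≢ 0#
          b₃≢0 b₃≡0 = b≢0 λ { i0 → cong v₀ bar≡0 ; i1 → cong v₁ bar≡0 ; i2 → cong v₂ bar≡0 ; i3 → b₃≡0 }
        s≢0 : s ≢ 0#
        s≢0 refl = toV-≢0 a≢0 (trans a≡ (0· _))

    -- With `bar b` equal to `r · side j k`, the affine part of the plane is where `side j k` takes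
    -- the constant value `- x₃ b * recip r`.
    lineMap : Line → Ln
    lineMap (inj₁ (x , _)) = inj₁ (normalised x)
    lineMap (inj₂ β) = let (j , k , r , _) = planeForm β in inj₂ (j , k , - x₃ (proj₁ β) * recip r)

    plane⇒ : ∀ {b j k r} → r ≢ 0# → bar b ≡ r · side j k → ∀ P → PlaneContains b (proj₁ P) →
      pointMap P Iₘ inj₂ (j , k , - x₃ b * recip r)
    plane⇒ {b} {j} {k} {r} r≢0 b≡ P contains = side-index k (*-≡0 r≢0 K∈) ,
      index (side-index k (*-≡0 r≢0 K∈))
      where
      i = indexOf P
      X = affineOf P
      b∙ : ∀ Y → bar b ∙ Y ≡ r * (side j k ∙ Y)
      b∙ Y = trans (cong (_∙ Y) b≡) (∙-·ˡ r _ Y)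
      K∈ : r * (side j k ∙ K i) ≡ 0#
      K∈ = trans (solve 2 (λ x y → x := x :+ y :* :0) refl (r * (side j k ∙ K i)) (x₃ b))
        (trans (cong (_+ x₃ b * 0#) (sym (b∙ (K i)))) (trans (sym (dot₄ b (embed (𝕂 i)))) (contains _ (centre-on P))))
      X∈ : r * (side j k ∙ bar X) + x₃ b * 1# ≡ 0#
      X∈ = trans (cong₂ (λ s t → s + x₃ b * t) (sym (b∙ (bar X))) (sym (x₃-affineOf P)))
        (trans (sym (dot₄ b X)) (contains X (affineOf-onLine P)))
      value : side j k ∙ bar X ≡ - x₃ b * recip r
      value = sym (*-recip-cancel r≢0 (trans (solve 3 (λ r s b → :- b := s :* r :+ :- (r :* s :+ b :* :1)) refl r (side j k ∙ bar X) (x₃ b))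
        (trans (cong (λ z → (side j k ∙ bar X) * r + - z) X∈) (solve 1 (λ x → x :+ :- :0 := x) refl ((side j k ∙ bar X) * r)))))
      index : i ≡ j → pick k (T i ∙ bar X) (U i ∙ bar X) ≡ - x₃ b * recip r
      index refl = trans (pick-∙ i k (bar X)) value

    plane-vanishes : ∀ i k {r s b₃ a X B Y} → r ≢ 0# → B ≡ r · side i k → Y ≡ s · X ⊕ a · K i →
      side i k ∙ X ≡ - b₃ * recip r → B ∙ Y + b₃ * s ≡ 0#
    plane-vanishes i k {r} {s} {b₃} {a} {X} {B} {Y} r≢0 B≡ Y≡ value =
      trans (cong (_+ b₃ * s) B∙Y) (solve 2 (λ p b → p :* (:- b) :+ b :* p := :0) refl s b₃)
      where
      open ≡-Reasoning
      B∙Y : B ∙ Y ≡ s * - b₃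
      B∙Y = begin
        B ∙ Y ≡⟨ cong₂ _∙_ B≡ Y≡ ⟩
        (r · side i k) ∙ (s · X ⊕ a · K i) ≡⟨ ∙-·ˡ r (side i k) (s · X ⊕ a · K i) ⟩
        r * (side i k ∙ (s · X ⊕ a · K i)) ≡⟨ cong (r *_) (shift-side i k (s · X) a) ⟩
        r * (side i k ∙ (s · X)) ≡⟨ cong (r *_) (∙-·ʳ (side i k) s X) ⟩
        r * (s * (side i k ∙ X)) ≡⟨ cong (λ z → r * (s * z)) value ⟩
        r * (s * (- b₃ * recip r))
          ≡⟨ solve 4 (λ r p b i → r :* (p :* ((:- b) :* i)) := p :* (((:- b) :* i) :* r)) refl r s b₃ (recip r) ⟩
        s * ((- b₃ * recip r) * r) ≡⟨ cong (s *_) (recip-unmul r≢0) ⟩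
        s * - b₃ ∎

    plane⇐ : ∀ {b j k r} → r ≢ 0# → bar b ≡ r · side j k → ∀ P →
      pointMap P Iₘ inj₂ (j , k , - x₃ b * recip r) → PlaneContains b (proj₁ P)
    plane⇐ {b} {j} {k} {r} r≢0 b≡ P (i≡j , value) p on = vanish (on⇒axis P on)
      where
      vanish : OnAxis (indexOf P) (bar (affineOf P)) p → dot b p ≡ 0#
      vanish (_ , a , e) = trans (dot₄ b p) (plane-vanishes (indexOf P) k r≢0
        (trans b≡ (cong (λ j → r · side j k) (sym i≡j))) e (trans (sym (pick-∙ (indexOf P) k (bar (affineOf P)))) value))

    incidence⇒ : ∀ P L → P I L → pointMap P Iₘ lineMap L
    incidence⇒ P (inj₁ (x , x₃≢0)) on = let eq = normalised-axis {p = x} x₃≢0 (on⇒axis P on) in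
      cong (proj₁ ∘ proj₂) eq , cong (proj₂ ∘ proj₂) eq
    incidence⇒ P (inj₂ β) contains = let (_ , _ , _ , r≢0 , b≡) = planeForm β in
      plane⇒ {proj₁ β} r≢0 b≡ P contains

    incidence⇐ : ∀ P L → pointMap P Iₘ lineMap L → P I L
    incidence⇐ P (inj₁ (x , x₃≢0)) h = axis⇒on P (axis-normalised {p = x} x₃≢0 (sym (I⇒at h)))
    incidence⇐ P (inj₂ β) h = let (_ , _ , _ , r≢0 , b≡) = planeForm β in
      plane⇐ {proj₁ β} r≢0 b≡ P h

    I-respects-≈L : ∀ P L M → L ≈L M → P I L → P I M
    I-respects-≈L (pline u w _ , _) (inj₁ (x , _)) (inj₁ (y , y₃≢0)) (c , c≢0 , x≡) (_ , a , b , e) =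
      (λ all0 → y₃≢0 (all0 i3)) , recip c * a , recip c * b , λ m → *-cancelˡ c≢0 (begin
        c * y m ≡⟨ sym (x≡ m) ⟩
        x m ≡⟨ e m ⟩
        a * u m + b * w m ≡⟨ sym (*-identityˡ _) ⟩
        1# * (a * u m + b * w m) ≡⟨ cong (_* (a * u m + b * w m)) (sym (recipʳ c≢0)) ⟩
        (c * recip c) * (a * u m + b * w m)
          ≡⟨ solve 6 (λ c r a b u w → (c :* r) :* (a :* u :+ b :* w) := c :* ((r :* a) :* u :+ (r :* b) :* w))
               refl c (recip c) a b (u m) (w m) ⟩
        c * ((recip c * a) * u m + (recip c * b) * w m) ∎)
      where open ≡-Reasoning
    I-respects-≈L P (inj₂ (b , _)) (inj₂ (b′ , _)) (c , c≢0 , b≡) contains p on =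
      *-≡0 c≢0 (trans (sym (trans (dot-cong {w = p} b≡) (dot-scale c {b′} {p}))) (contains p on))
      where
      dot-cong : ∀ {n} {u v w : Vec n} → (∀ m → u m ≡ v m) → dot u w ≡ dot v w
      dot-cong {zero} e = refl
      dot-cong {suc n} {w = w} e = cong₂ _+_ (cong (_* w zero) (e zero)) (dot-cong {w = w ∘ suc} (e ∘ suc))
      dot-scale : ∀ {n} c {v w : Vec n} → dot (λ m → c * v m) w ≡ c * dot v w
      dot-scale {zero} c = sym (zeroʳ c)
      dot-scale {suc n} c {v} {w} = trans (cong₂ _+_ (*-assoc c (v zero) (w zero)) (dot-scale c {v ∘ suc} {w ∘ suc}))
        (sym (distribˡ c _ _))

    -- `planeForm` makes its choices separately for proportional covectors; comparing the points of
    -- the two images avoids comparing these choices.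
    lineMap-respects : ∀ L M → L ≈L M → lineMap L ≡ lineMap M
    lineMap-respects L M L≈M = distinct-points λ {P′} P′L → let (P , P≡) = pointMap-onto P′ in
      subst (_Iₘ lineMap M) P≡ (incidence⇒ P M (I-respects-≈L P L M L≈M
        (incidence⇐ P L (subst (_Iₘ lineMap L) (sym P≡) P′L))))

    lineMap-injective : ∀ L M → lineMap L ≡ lineMap M → L ≈L M
    lineMap-injective (inj₁ (x , x₃≢0)) (inj₁ (y , y₃≢0)) eq = c , *-≢0 x₃≢0 (recip-≢0 y₃≢0) , λ
      { i0 → cong v₀ x̄≡′ ; i1 → cong v₁ x̄≡′ ; i2 → cong v₂ x̄≡′ ; i3 → sym (recip-unmul y₃≢0) }
      where
      c = x₃ x * recip (x₃ y)
      inj₁-inj : ∀ {X Y : V} → _≡_ {A = Ln} (inj₁ X) (inj₁ Y) → X ≡ Y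
      inj₁-inj refl = refl
      x̄≡ : bar x ≡ c · bar y
      x̄≡ = trans (sym (trans (·-· _ _ _) (trans (cong (_· bar x) (recipʳ x₃≢0)) (1· _))))
        (trans (cong (x₃ x ·_) (inj₁-inj eq)) (·-· _ _ _))
      x̄≡′ = trans x̄≡ (vec-· c (y i0) (y i1) (y i2))
    lineMap-injective (inj₂ β) (inj₂ β′) eq = planes (planeForm β) (planeForm β′) eq
      where
      b = proj₁ β
      b′ = proj₁ β′
      planes : (f : PlaneForm b) (f′ : PlaneForm b′) →
        _≡_ {A = Ln} (inj₂ (proj₁ f , proj₁ (proj₂ f) , - x₃ b * recip (proj₁ (proj₂ (proj₂ f)))))
          (inj₂ (proj₁ f′ , proj₁ (proj₂ f′) , - x₃ b′ * recip (proj₁ (proj₂ (proj₂ f′))))) → Prop b b′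
      planes (j , k , r , r≢0 , b≡) (j′ , k′ , r′ , r′≢0 , b′≡) eq = go (cong-j eq) (cong-k eq) (cong-c eq)
        where
        cong-j : ∀ {j j′ k k′ c c′} → _≡_ {A = Ln} (inj₂ (j , k , c)) (inj₂ (j′ , k′ , c′)) → j ≡ j′
        cong-j refl = refl
        cong-k : ∀ {j j′ k k′ c c′} → _≡_ {A = Ln} (inj₂ (j , k , c)) (inj₂ (j′ , k′ , c′)) → k ≡ k′
        cong-k refl = refl
        cong-c : ∀ {j j′ k k′ c c′} → _≡_ {A = Ln} (inj₂ (j , k , c)) (inj₂ (j′ , k′ , c′)) → c ≡ c′
        cong-c refl = refl
        s = r * recip r′
        go : j ≡ j′ → k ≡ k′ → - x₃ b * recip r ≡ - x₃ b′ * recip r′ → Prop b b′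
        go refl refl eq₃ = s , *-≢0 r≢0 (recip-≢0 r′≢0) , λ
          { i0 → cong v₀ b̄≡′ ; i1 → cong v₁ b̄≡′ ; i2 → cong v₂ b̄≡′ ; i3 → b₃≡ }
          where
          b̄≡ : bar b ≡ s · bar b′
          b̄≡ = trans b≡ (trans (cong (_· side j k) (sym (recip-unmul r′≢0)))
            (trans (sym (·-· _ _ _)) (cong (s ·_) (sym b′≡))))
          b̄≡′ = trans b̄≡ (vec-· s (b′ i0) (b′ i1) (b′ i2))
          b₃≡ : x₃ b ≡ s * x₃ b′
          b₃≡ = trans (solve 1 (λ x → x := :- (:- x)) refl (x₃ b)) (trans (cong -_ (trans (sym (recip-unmul r≢0)) (cong (_* r) eq₃)))
            (solve 3 (λ b i r → :- (((:- b) :* i) :* r) := (r :* i) :* b) refl (x₃ b′) (recip r′) r))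

    plane : Fin q → Fin 2 → Carrier → TangentPlane
    plane j k c = b , (λ all0 → side≢0 (vec-cong (all0 i0) (all0 i1) (all0 i2))) ,
        (λ (t , t≢0 , e) → side≢0 (vec-cong (trans (e i0) (zeroʳ t)) (trans (e i1) (zeroʳ t)) (trans (e i2) (zeroʳ t)))) ,
        fromV (side j k) , (fromV-≢0 side≢0 , j , trans (dot-fromV (side j k) (𝕂 j)) (side∙K≡0 j k) ,
          λ i eq → side-index k (trans (sym (dot-fromV (side j k) (𝕂 i))) eq)) ,
        λ x _ a∙x → trans (dot₄ b (embed x)) (trans (cong (_+ (- c) * 0#) (trans (sym (dot-fromV (side j k) x)) a∙x))
          (solve 1 (λ c → :0 :+ (:- c) :* :0 := :0) refl c))
      where
      b : Vec 4
      b i0 = v₀ (side j k)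
      b i1 = v₁ (side j k)
      b i2 = v₂ (side j k)
      b i3 = - c
      side≢0 : side j k ≢ 0V
      side≢0 = side≢0V j k

    lineMap-onto : ∀ L′ → ∃[ L ] (lineMap L ≡ L′)
    lineMap-onto (inj₁ X) = inj₁ (affine X , 1≢0) , cong inj₁ (normalised-affine X)
    lineMap-onto (inj₂ (j , k , c)) = inj₂ β , sym (distinct-points λ {P′} P′L → let (P , P≡) = pointMap-onto P′ in
      subst (_Iₘ lineMap (inj₂ β)) P≡ (incidence⇒ P (inj₂ β) (plane⇐ {proj₁ β} 1≢0 (sym (1· (side j k))) P
        (subst₂ (λ P c → P Iₘ inj₂ (j , k , c)) (sym P≡) c≡ P′L))))
      where
      β = plane j k c
      c≡ : c ≡ - (- c) * recip 1#
      c≡ = trans (solve 2 (λ c r → c := (:- (:- c)) :* :1) refl c c) (cong (- (- c) *_) (trans (sym (recipʳ 1≢0)) (*-identityˡ _)))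

    isomorphism : Isomorphism structure model
    isomorphism = record
      { fP = pointMap ; fL = lineMap
      ; fP-resp = pointMap-respects ; fP-inj = pointMap-injective ; fP-surj = pointMap-onto
      ; fL-resp = lineMap-respects ; fL-inj = lineMap-injective ; fL-surj = lineMap-onto
      ; inc-pres = incidence⇒ ; inc-refl = incidence⇐ }

-- The envelope of the tangents

module Envelopes (𝔽 : Field) (q : ℕ) (enum : Field.Carrier 𝔽 ↔ Fin q) where
  open FiniteField 𝔽 q enum
  open Geometry 𝔽 q enum
  open Arcs 𝔽 q enum
  open MonoidSum *-commutativeMonoid using () renaming (sum-remove to Π-remove)

  ∑-agree₁ : ∀ {n} (f g : Fin n → Carrier) i →
    (∀ c → c ≢ i → f c ≡ g c) → ∃[ r ] (∑ f ≡ f i + r × ∑ g ≡ g i + r)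
  ∑-agree₁ = agree-off-one +-commutativeMonoid

  ∑-0 : ∀ n → ∑ {n} (λ _ → 0#) ≡ 0#
  ∑-0 zero = refl
  ∑-0 (suc n) = trans (+-identityˡ _) (∑-0 n)

  ∑-single : ∀ {n} (f : Fin n → Carrier) i → (∀ c → c ≢ i → f c ≡ 0#) → ∑ f ≡ f i
  ∑-single {n} f i zeros with ∑-agree₁ f (λ _ → 0#) i zeros
  ... | r , e , e′ = trans e (trans (cong (f i +_) r≡0) (+-identityʳ _))
    where
    r≡0 : r ≡ 0#
    r≡0 = trans (sym (+-identityˡ r)) (trans (sym e′) (∑-0 n))

  -- Off-diagonal entries cancel in pairs. Antisymmetry is asked only off the diagonal, because the
  -- diagonal carries the quantities to be extracted.
  ∑-antisymmetric : ∀ {n} (M : Fin n → Fin n → Carrier) → (∀ i j → i ≢ j → M i j ≡ - M j i) →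
    ∑ (λ i → ∑ (λ j → M i j)) ≡ ∑ (λ i → M i i)
  ∑-antisymmetric {zero} M anti = refl
  ∑-antisymmetric {suc n} M anti = begin
    (M zero zero + R) + ∑ (λ i → M (suc i) zero + ∑ (λ j → M (suc i) (suc j)))
      ≡⟨ cong ((M zero zero + R) +_) (∑-distrib-+ (λ i → M (suc i) zero) (λ i → ∑ (λ j → M (suc i) (suc j)))) ⟩
    (M zero zero + R) + (C + Q)
      ≡⟨ solve 4 (λ m r c x → (m :+ r) :+ (c :+ x) := m :+ ((r :+ c) :+ x)) refl (M zero zero) R C Q ⟩
    M zero zero + ((R + C) + Q) ≡⟨ cong₂ (λ a b → M zero zero + (a + b)) R+C≡0
      (∑-antisymmetric (λ i j → M (suc i) (suc j)) (λ i j i≢j → anti (suc i) (suc j) (λ { refl → i≢j refl }))) ⟩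
    M zero zero + (0# + D) ≡⟨ cong (M zero zero +_) (+-identityˡ D) ⟩
    M zero zero + D ∎
    where
    open ≡-Reasoning
    R C Q D : Carrier
    R = ∑ (λ j → M zero (suc j))
    C = ∑ (λ i → M (suc i) zero)
    Q = ∑ (λ i → ∑ (λ j → M (suc i) (suc j)))
    D = ∑ (λ i → M (suc i) (suc i))
    R+C≡0 : R + C ≡ 0#
    R+C≡0 = trans (sym (∑-distrib-+ (λ j → M zero (suc j)) (λ i → M (suc i) zero)))
      (trans (∑-cong λ j → trans (cong (_+ M (suc j) zero) (anti zero (suc j) λ ()))
        (solve 1 (λ x → :- x :+ x := :0) refl (M (suc j) zero))) (∑-0 n))

  -- Divided differences of binary forms

  Pair : Set
  Pair = Carrier × Carrier

  bracket₂ : Pair → Pair → Carrier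
  bracket₂ (a , b) (c , d) = a * d + - (b * c)

  bracket₂-self : ∀ p → bracket₂ p p ≡ 0#
  bracket₂-self (a , b) = solve 2 (λ a b → a :* b :+ :- (b :* a) := :0) refl a b

  bracket₂-anti : ∀ p p′ → bracket₂ p p′ ≡ - bracket₂ p′ p
  bracket₂-anti (a , b) (c , d) = solve 4 (λ a b c d → a :* d :+ :- (b :* c) := :- (c :* b :+ :- (d :* a))) refl a b c d

  coordinate : Bool → Pair → Carrier
  coordinate true = proj₁
  coordinate false = proj₂

  -- Monomials are words in the two coordinates, so that one letter can be traded for one node in
  -- the induction below.
  monomial : ∀ {n} → Tuple Bool n → Pair → Carrier
  monomial [] p = 1#
  monomial (b ∷ M) p = coordinate b p * monomial M p

  recip-* : ∀ {x y} → x ≢ 0# → y ≢ 0# → x * recip (x * y) ≡ recip y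
  recip-* {x} {y} x≢0 y≢0 = *-cancelˡ y≢0 (trans
    (solve 3 (λ x y r → y :* (x :* r) := (x :* y) :* r) refl x y (recip (x * y)))
    (trans (recipʳ (*-≢0 x≢0 y≢0)) (sym (recipʳ y≢0))))

  recip-neg : ∀ {x} → x ≢ 0# → recip (- x) ≡ - recip x
  recip-neg {x} x≢0 = *-cancelˡ (-‿≢0 x≢0) (trans (recipʳ (-‿≢0 x≢0)) (trans (sym (recipʳ x≢0))
    (solve 2 (λ x r → x :* r := (:- x) :* (:- r)) refl x (recip x))))

  -- The denominator of Lagrange interpolation; `nz` discards the vanishing factor at `m = j`.
  node-product : ∀ {n} → (Fin n → Pair) → Fin n → Carrier
  node-product N j = Π (λ m → nz (bracket₂ (N j) (N m)))

  node-product-≢0 : ∀ {n} (N : Fin n → Pair) j → node-product N j ≢ 0#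
  node-product-≢0 N j = Π-≢0 (λ m → nz (bracket₂ (N j) (N m))) (λ m → nz-≢0 (bracket₂ (N j) (N m)))

  -- The homogeneous form of the vanishing of the divided difference of order n + 1 on forms of degree n.
  divided-difference : ∀ {n} (N : Fin (2 ℕ.+ n) → Pair) → (∀ i j → i ≢ j → bracket₂ (N i) (N j) ≢ 0#) →
    (M : Tuple Bool n) → ∑ (λ j → monomial M (N j) * recip (node-product N j)) ≡ 0#
  divided-difference {zero} N indep [] = begin
    1# * recip (nz (bracket₂ p p) * (nz (bracket₂ p r) * 1#)) +
      (1# * recip (nz (bracket₂ r p) * (nz (bracket₂ r r) * 1#)) + 0#)
      ≡⟨ cong₂ (λ x y → 1# * recip x + (1# * recip y + 0#)) e₀ e₁ ⟩
    1# * recip b + (1# * recip (- b) + 0#) ≡⟨ cong (λ x → 1# * recip b + (1# * x + 0#)) (recip-neg b≢0) ⟩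
    1# * recip b + (1# * (- recip b) + 0#) ≡⟨ solve 1 (λ x → :1 :* x :+ (:1 :* (:- x) :+ :0) := :0) refl (recip b) ⟩
    0# ∎
    where
    open ≡-Reasoning
    p r : Pair
    p = N zero
    r = N (suc zero)
    b : Carrier
    b = bracket₂ p r
    b≢0 : b ≢ 0#
    b≢0 = indep zero (suc zero) λ ()
    e₀ : nz (bracket₂ p p) * (nz b * 1#) ≡ b
    e₀ = trans (cong₂ (λ x y → x * (y * 1#)) (nz-0 (bracket₂-self p)) (nz-id b≢0))
      (solve 1 (λ b → :1 :* (b :* :1) := b) refl b)
    e₁ : nz (bracket₂ r p) * (nz (bracket₂ r r) * 1#) ≡ - b
    e₁ = trans (cong₂ (λ x y → x * (y * 1#)) (trans (nz-id (indep (suc zero) zero λ ())) (bracket₂-anti r p))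
      (nz-0 (bracket₂-self r))) (solve 1 (λ b → b :* (:1 :* :1) := b) refl (- b))
  divided-difference {suc n} N indep (b ∷ M) = vanishes b
    where
    open ≡-Reasoning
    w : ∀ j → Carrier
    w j = recip (node-product N j)
    A B : Carrier
    A = ∑ (λ j → (proj₁ (N j) * monomial M (N j)) * w j)
    B = ∑ (λ j → (proj₂ (N j) * monomial M (N j)) * w j)
    -- This combination multiplies each term by its bracket with node `t`: the term of `t` dies and
    -- the others lose that factor of the denominator, leaving the statement for one node fewer.
    remove : ∀ t → proj₂ (N t) * A + - proj₁ (N t) * B ≡ 0#
    remove t = begin
      z * A + - y * B ≡⟨ cong₂ _+_ (*-distribˡ-∑ z (λ j → (proj₁ (N j) * monomial M (N j)) * w j))
                                   (*-distribˡ-∑ (- y) (λ j → (proj₂ (N j) * monomial M (N j)) * w j)) ⟩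
      ∑ (λ j → z * ((proj₁ (N j) * monomial M (N j)) * w j)) + ∑ (λ j → - y * ((proj₂ (N j) * monomial M (N j)) * w j))
        ≡⟨ sym (∑-distrib-+ (λ j → z * ((proj₁ (N j) * monomial M (N j)) * w j)) (λ j → - y * ((proj₂ (N j) * monomial M (N j)) * w j))) ⟩
      ∑ (λ j → z * ((proj₁ (N j) * monomial M (N j)) * w j) + - y * ((proj₂ (N j) * monomial M (N j)) * w j))
        ≡⟨ ∑-cong (λ j → solve 6 (λ y z yⱼ zⱼ m w → z :* ((yⱼ :* m) :* w) :+ (:- y) :* ((zⱼ :* m) :* w) :=
             m :* ((yⱼ :* z :+ :- (zⱼ :* y)) :* w)) refl y z (proj₁ (N j)) (proj₂ (N j)) (monomial M (N j)) (w j)) ⟩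
      ∑ F ≡⟨ ∑-remove {i = t} F ⟩
      F t + ∑ (F ∘ punchIn t) ≡⟨ cong₂ _+_
        (trans (cong (λ x → monomial M (N t) * (x * w t)) (bracket₂-self (N t)))
          (solve 2 (λ m w → m :* (:0 :* w) := :0) refl (monomial M (N t)) (w t)))
        (∑-cong λ j → cong (monomial M (N (punchIn t j)) *_) (weight j)) ⟩
      0# + ∑ (λ j → monomial M (N′ j) * recip (node-product N′ j)) ≡⟨ +-identityˡ _ ⟩
      ∑ (λ j → monomial M (N′ j) * recip (node-product N′ j))
        ≡⟨ divided-difference N′ (λ i j i≢j → indep _ _ (i≢j ∘ punchIn-injective t i j)) M ⟩
      0# ∎
      where
      y z : Carrier
      y = proj₁ (N t)
      z = proj₂ (N t)
      F : Fin (3 ℕ.+ n) → Carrier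
      F j = monomial M (N j) * (bracket₂ (N j) (N t) * w j)
      N′ : Fin (2 ℕ.+ n) → Pair
      N′ = N ∘ punchIn t
      weight : ∀ j → bracket₂ (N′ j) (N t) * w (punchIn t j) ≡ recip (node-product N′ j)
      weight j = trans (cong (λ x → bracket₂ (N′ j) (N t) * recip x)
        (trans (Π-remove {i = t} (λ m → nz (bracket₂ (N′ j) (N m)))) (cong (_* node-product N′ j) (nz-id ne))))
        (recip-* ne (node-product-≢0 N′ j))
        where
        ne : bracket₂ (N′ j) (N t) ≢ 0#
        ne = indep (punchIn t j) t (punchInᵢ≢i t j)
    [01]≢0 : bracket₂ (N zero) (N (suc zero)) ≢ 0#
    [01]≢0 = indep zero (suc zero) λ ()
    -- Two independent nodes give two independent linear equations in `A` and `B`.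
    A≡0 : A ≡ 0#
    A≡0 = *-≡0 [01]≢0 (trans (solve 6 (λ y z y′ z′ a b → (y :* z′ :+ :- (z :* y′)) :* a :=
        y :* (z′ :* a :+ (:- y′) :* b) :+ :- (y′ :* (z :* a :+ (:- y) :* b))) refl
        (proj₁ (N zero)) (proj₂ (N zero)) (proj₁ (N (suc zero))) (proj₂ (N (suc zero))) A B)
      (trans (cong₂ (λ u v → proj₁ (N zero) * u + - (proj₁ (N (suc zero)) * v)) (remove (suc zero)) (remove zero))
        (solve 2 (λ y y′ → y :* :0 :+ :- (y′ :* :0) := :0) refl (proj₁ (N zero)) (proj₁ (N (suc zero))))))
    B≡0 : B ≡ 0#
    B≡0 = *-≡0 [01]≢0 (trans (solve 6 (λ y z y′ z′ a b → (y :* z′ :+ :- (z :* y′)) :* b :=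
        z :* (z′ :* a :+ (:- y′) :* b) :+ :- (z′ :* (z :* a :+ (:- y) :* b))) refl
        (proj₁ (N zero)) (proj₂ (N zero)) (proj₁ (N (suc zero))) (proj₂ (N (suc zero))) A B)
      (trans (cong₂ (λ u v → proj₂ (N zero) * u + - (proj₂ (N (suc zero)) * v)) (remove (suc zero)) (remove zero))
        (solve 2 (λ y y′ → y :* :0 :+ :- (y′ :* :0) := :0) refl (proj₂ (N zero)) (proj₂ (N (suc zero))))))
    vanishes : ∀ b → ∑ (λ j → (coordinate b (N j) * monomial M (N j)) * w j) ≡ 0#
    vanishes true = A≡0
    vanishes false = B≡0

  -- Segre's lemma of tangents and its consequence for six points

  module NormalisedTangents (A : Arc) (tangents : ∀ i → TangentPair A i) (ρ≡1 : ∀ i → TangentPair.ρ (tangents i) ≡ 1#) where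
    open Arc A
    open module TP i = TangentPair (tangents i) using (T; U; T-tangent; U-tangent; ratio; ratio-*U; ratio-injective; ratio-centre; T∙κ≡0; U∙κ≡0; bracket)

    coords : Fin q → V → Pair
    coords i X = T i ∙ X , U i ∙ X

    bracket-det : ∀ i X Y → bracket₂ (coords i X) (coords i Y) ≡ det (K i) X Y
    bracket-det i X Y = trans (bracket i X Y) (trans (cong (_* det (K i) X Y) (ρ≡1 i)) (*-identityˡ _))

    quad : Fin q → V → Carrier
    quad i X = (T i ∙ X) * (U i ∙ X)

    det-product : Fin q → Fin q → Carrier
    det-product i j = Π (λ c → nz (det (K i) (K j) (K c)))

    -- The first product clears the denominators of the ratios, and `W` is the product of the
    -- nonzero differences of ratios. Neither involves `j`.
    tangent-constant : Fin q → Carrier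
    tangent-constant i = Π (λ c → nz (U i ∙ K c)) * W

    tangent-constant-≢0 : ∀ i → tangent-constant i ≢ 0#
    tangent-constant-≢0 i = *-≢0 (Π-≢0 (λ c → nz (U i ∙ K c)) (λ c → nz-≢0 (U i ∙ K c))) (Π-≢0 (nz ∘ el) (nz-≢0 ∘ el))

    -- Segre's lemma of tangents, for two tangents at each point.
    lemma-of-tangents : ∀ {i j} → j ≢ i → quad i (K j) * det-product i j ≡ tangent-constant i
    lemma-of-tangents {i} {j} j≢i = *-cancelˡ z≢0 (begin
      z * ((y * z) * det-product i j)
        ≡⟨ solve 3 (λ y z p → z :* ((y :* z) :* p) := (z :* z) :* (y :* p)) refl y z (det-product i j) ⟩
      (z * z) * (y * det-product i j) ≡⟨ cong ((z * z) *_) (trans (cong (y *_) det-product≡) (sym scaled≡)) ⟩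
      (z * z) * Π (λ c → nz (a c * w c)) ≡⟨ cong (λ x → (z * x) * Π (λ c → nz (a c * w c))) (sym (nz-id z≢0)) ⟩
      a j * Π (λ c → nz (a c * w c)) ≡⟨ Π-nz-scale a w j (λ c → *-≢0 z≢0 (nz-≢0 (U i ∙ K c))) (-‿inverseʳ (ratio i j))
        (λ c c≢j e → c≢j (sym (ratio-injective i (x-y≡0⇒x≡y e)))) ⟩
      Π a * Π (nz ∘ w) ≡⟨ cong₂ _*_ (Π-distrib-* (λ _ → z) (λ c → nz (U i ∙ K c)))
                            (Π-nz-translate (ratio i) (ratio-injective i) (ratio i j)) ⟩
      (Π {q} (λ _ → z) * Π (λ c → nz (U i ∙ K c))) * W
        ≡⟨ cong (λ x → (x * Π (λ c → nz (U i ∙ K c))) * W) (fermat z≢0) ⟩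
      (z * Π (λ c → nz (U i ∙ K c))) * W ≡⟨ *-assoc _ _ _ ⟩
      z * tangent-constant i ∎)
      where
      open ≡-Reasoning
      y z : Carrier
      y = T i ∙ K j
      z = U i ∙ K j
      z≢0 : z ≢ 0#
      z≢0 = U-tangent i j≢i
      -- For `c ≢ i` the determinant factors as `a c * w c`. Since the ratios run over the field,
      -- the `w c` contribute `W`, and the `q` copies of `z` collapse to a single one by `fermat`.
      a w : Fin q → Carrier
      a c = z * nz (U i ∙ K c)
      w c = ratio i j + - ratio i c
      same : ∀ c → c ≢ i → nz (det (K i) (K j) (K c)) ≡ nz (a c * w c)
      same c c≢i = cong nz (begin
        det (K i) (K j) (K c) ≡⟨ sym (bracket-det i (K j) (K c)) ⟩
        y * (U i ∙ K c) + - (z * (T i ∙ K c))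
          ≡⟨ cong₂ (λ s t → s * (U i ∙ K c) + - (z * t)) (sym (ratio-*U i j≢i)) (sym (ratio-*U i c≢i)) ⟩
        (ratio i j * z) * (U i ∙ K c) + - (z * (ratio i c * (U i ∙ K c)))
          ≡⟨ solve 4 (λ r s z u → (r :* z) :* u :+ :- (z :* (s :* u)) := (z :* u) :* (r :+ :- s)) refl
               (ratio i j) (ratio i c) z (U i ∙ K c) ⟩
        (z * (U i ∙ K c)) * w c ≡⟨ cong (λ u → (z * u) * w c) (sym (nz-id (U-tangent i c≢i))) ⟩
        a c * w c ∎)
      -- At `c = i` the determinant counts as `1#`, while `a i * w i` is `y`: this discrepancy
      -- supplies the factor `T i ∙ K j` of `quad`.
      at-centre : a i * w i ≡ y
      at-centre = trans (cong₂ (λ s t → (z * s) * (ratio i j + - t)) (nz-0 (U∙κ≡0 i)) (ratio-centre i))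
        (trans (solve 2 (λ z r → (z :* :1) :* (r :+ :- :0) := r :* z) refl z (ratio i j)) (ratio-*U i j≢i))
      split : ∃[ r ] (det-product i j ≡ nz (det (K i) (K j) (K i)) * r × Π (λ c → nz (a c * w c)) ≡ nz (a i * w i) * r)
      split = Π-agree₁ (λ c → nz (det (K i) (K j) (K c))) (λ c → nz (a c * w c)) i same
      r : Carrier
      r = proj₁ split
      det-product≡ : det-product i j ≡ r
      det-product≡ = trans (proj₁ (proj₂ split)) (trans (cong (_* r) (nz-0 (det-XYX (K i) (K j)))) (*-identityˡ r))
      scaled≡ : Π (λ c → nz (a c * w c)) ≡ y * r
      scaled≡ = trans (proj₂ (proj₂ split)) (cong (_* r) (trans (cong nz at-centre) (nz-id (T-tangent i j≢i))))

    nz-neg-square : ∀ {x} → nz (- x) * nz (- x) ≡ nz x * nz x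
    nz-neg-square {x} with x ≟ 0#
    ... | yes refl = cong (λ y → nz y * nz y) (solve 0 (:- :0 := :0) refl)
    ... | no ne = trans (cong (λ y → y * y) (nz-id (-‿≢0 ne)))
      (trans (solve 1 (λ x → (:- x) :* (:- x) := x :* x) refl x) (cong (λ y → y * y) (sym (nz-id ne))))

    -- Exchanging `i` and `j` changes the sign of each determinant, and squaring makes the number of
    -- changes irrelevant.
    det-product-square : ∀ i j → det-product i j * det-product i j ≡ det-product j i * det-product j i
    det-product-square i j = begin
      Π (d i j) * Π (d i j) ≡⟨ sym (Π-distrib-* (d i j) (d i j)) ⟩
      Π (λ c → d i j c * d i j c) ≡⟨ Π-cong (λ c → trans (cong (λ x → nz x * nz x) (det-swap₁₂ (K i) (K j) (K c))) nz-neg-square) ⟩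
      Π (λ c → d j i c * d j i c) ≡⟨ Π-distrib-* (d j i) (d j i) ⟩
      Π (d j i) * Π (d j i) ∎
      where
      open ≡-Reasoning
      d : Fin q → Fin q → Fin q → Carrier
      d i j c = nz (det (K i) (K j) (K c))

    module SixPoints (φ : Fin 6 → Fin q) (φ-injective : ∀ {a b} → φ a ≡ φ b → a ≡ b) (P : V)
        (generic : ∀ {a b} → a ≢ b → det (K (φ a)) (K (φ b)) P ≢ 0#) where

      private
        -- In its own pencil the point `K (φ a)` has zero coordinates and cannot be a node; its slot
        -- is given to `P`, which thus appears on the diagonal.
        node : Fin 6 → Fin 6 → V
        node a m with m ≟F a
        ... | yes _ = P
        ... | no _ = K (φ m)

        node-centre : ∀ a → node a a ≡ P
        node-centre a with a ≟F a
        ... | yes _ = refl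
        ... | no ne = ⊥-elim (ne refl)

        node-other : ∀ {a m} → m ≢ a → node a m ≡ K (φ m)
        node-other {a} {m} m≢a with m ≟F a
        ... | yes eq = ⊥-elim (m≢a eq)
        ... | no _ = refl

        N : Fin 6 → Fin 6 → Pair
        N a m = coords (φ a) (node a m)

        N-bracket : ∀ a b m → bracket₂ (N a b) (N a m) ≡ det (K (φ a)) (node a b) (node a m)
        N-bracket a b m = bracket-det (φ a) (node a b) (node a m)

        φ-≢ : ∀ {a b} → a ≢ b → φ a ≢ φ b
        φ-≢ a≢b eq = a≢b (φ-injective eq)

        N-independent : ∀ a b c → b ≢ c → bracket₂ (N a b) (N a c) ≢ 0#
        N-independent a b c b≢c eq = nodes-≢0 (trans (sym (N-bracket a b c)) eq)
          where
          nodes-≢0 : det (K (φ a)) (node a b) (node a c) ≢ 0#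
          nodes-≢0 with b ≟F a | c ≟F a
          ... | yes refl | yes refl = ⊥-elim (b≢c refl)
          ... | yes refl | no c≢a = λ e → generic (c≢a ∘ sym) (trans (solve 1 (λ x → x := :- (:- x)) refl (det (K (φ b)) (K (φ c)) P))
            (trans (cong -_ (trans (sym (det-swap₂₃ (K (φ b)) P (K (φ c)))) e)) (solve 0 (:- :0 := :0) refl)))
          ... | no b≢a | yes refl = generic (b≢a ∘ sym)
          ... | no b≢a | no c≢a = indep₃ (φ-≢ (b≢a ∘ sym)) (φ-≢ b≢c) (φ-≢ (c≢a ∘ sym))

        -- y²z², the square of the product of the two tangents in the coordinates of the pencil
        M : Tuple Bool 4
        M = true ∷ true ∷ false ∷ false ∷ []

        monomial-M : ∀ a X → monomial M (coords (φ a) X) ≡ quad (φ a) X * quad (φ a) X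
        monomial-M a X = solve 2 (λ y z → y :* (y :* (z :* (z :* :1))) := (y :* z) :* (y :* z)) refl (T (φ a) ∙ X) (U (φ a) ∙ X)

        κ : Fin 6 → Carrier
        κ a = recip (tangent-constant (φ a)) * recip (tangent-constant (φ a))

        -- Row `a` lists the terms of the divided difference in the pencil at `φ a`. The scale `κ a`
        -- cancels the tangent constant, the only part of an off-diagonal entry that depends on `a`
        -- alone.
        G : Fin 6 → Fin 6 → Carrier
        G a b = κ a * (monomial M (N a b) * recip (node-product (N a) b))

        row-sum : ∀ a → ∑ (G a) ≡ 0#
        row-sum a = trans (sym (*-distribˡ-∑ (κ a) (λ b → monomial M (N a b) * recip (node-product (N a) b))))
          (trans (cong (κ a *_) (divided-difference (N a) (N-independent a) M)) (zeroʳ (κ a)))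

        dets : Fin 6 → Fin 6 → Carrier
        dets a b = Π (λ m → nz (det (K (φ a)) (K (φ b)) (K (φ m))))

        node-product-≡ : ∀ {a b} → a ≢ b → node-product (N a) b ≡ det (K (φ a)) (K (φ b)) P * dets a b
        node-product-≡ {a} {b} a≢b = begin
          node-product (N a) b ≡⟨ Π-cong (λ m → cong nz (trans (N-bracket a b m)
                                    (cong (λ X → det (K (φ a)) X (node a m)) (node-other (a≢b ∘ sym))))) ⟩
          Π F ≡⟨ proj₁ (proj₂ split) ⟩
          F a * r ≡⟨ cong (_* r) (trans (cong (λ X → nz (det (K (φ a)) (K (φ b)) X)) (node-centre a)) (nz-id (generic a≢b))) ⟩
          d * r ≡⟨ cong (d *_) (sym (trans (proj₂ (proj₂ split))
                     (trans (cong (_* r) (nz-0 (det-XYX (K (φ a)) (K (φ b))))) (*-identityˡ r)))) ⟩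
          d * dets a b ∎
          where
          open ≡-Reasoning
          d : Carrier
          d = det (K (φ a)) (K (φ b)) P
          F F′ : Fin 6 → Carrier
          F m = nz (det (K (φ a)) (K (φ b)) (node a m))
          F′ m = nz (det (K (φ a)) (K (φ b)) (K (φ m)))
          split : ∃[ r ] (Π F ≡ F a * r × Π F′ ≡ F′ a * r)
          split = Π-agree₁ F F′ a (λ m m≢a → cong (λ X → nz (det (K (φ a)) (K (φ b)) X)) (node-other m≢a))
          r : Carrier
          r = proj₁ split

        -- Four factors change sign.
        dets-symmetric : ∀ {a b} → a ≢ b → dets b a ≡ dets a b
        dets-symmetric {a} {b} a≢b = begin
          Π F ≡⟨ proj₁ (proj₂ split) ⟩
          (F a * F b) * r ≡⟨ cong₂ (λ x y → (x * y) * r) (nz-0 (det-XYY (K (φ b)) (K (φ a)))) (nz-0 (det-XYX (K (φ b)) (K (φ a)))) ⟩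
          (1# * 1#) * r ≡⟨ solve 1 (λ r → (:1 :* :1) :* r := ((:- :1 :* :1) :* (:- :1 :* :1)) :* r) refl r ⟩
          ((- 1# * 1#) * (- 1# * 1#)) * r ≡⟨ sym (cong₂ (λ x y → ((- 1# * x) * (- 1# * y)) * r)
            (nz-0 (det-XYX (K (φ a)) (K (φ b)))) (nz-0 (det-XYY (K (φ a)) (K (φ b))))) ⟩
          (F′ a * F′ b) * r ≡⟨ sym (proj₂ (proj₂ split)) ⟩
          Π F′ ≡⟨ Π-distrib-* {6} (λ _ → - 1#) (λ m → nz (det (K (φ a)) (K (φ b)) (K (φ m)))) ⟩
          Π {6} (λ _ → - 1#) * dets a b
            ≡⟨ solve 1 (λ x → (:- :1 :* (:- :1 :* (:- :1 :* (:- :1 :* (:- :1 :* (:- :1 :* :1)))))) :* x := x) refl (dets a b) ⟩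
          dets a b ∎
          where
          open ≡-Reasoning
          F F′ : Fin 6 → Carrier
          F m = nz (det (K (φ b)) (K (φ a)) (K (φ m)))
          F′ m = - 1# * nz (det (K (φ a)) (K (φ b)) (K (φ m)))
          split : ∃[ r ] (Π F ≡ (F a * F b) * r × Π F′ ≡ (F′ a * F′ b) * r)
          split = Π-agree₂ F F′ a≢b λ m m≢a m≢b → let ne = indep₃ (φ-≢ a≢b) (φ-≢ (m≢b ∘ sym)) (φ-≢ (m≢a ∘ sym)) in
            trans (cong nz (det-swap₁₂ (K (φ b)) (K (φ a)) (K (φ m)))) (trans (nz-id (-‿≢0 ne))
              (trans (sym (-1* _)) (cong (- 1# *_) (sym (nz-id ne)))))
          r : Carrier
          r = proj₁ split

        -- The lemma of tangents, squared, replaces the values of the tangents by `det-product`,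
        -- whose square does not depend on the order of the two points.
        weight : ∀ {a b} → a ≢ b →
          κ a * monomial M (N a b) ≡ recip (det-product (φ a) (φ b) * det-product (φ a) (φ b))
        weight {a} {b} a≢b = *-cancelˡ D²≢0 (begin
          (D * D) * (κ a * monomial M (N a b)) ≡⟨ cong (λ x → (D * D) * (κ a * x))
            (trans (cong (λ X → monomial M (coords (φ a) X)) (node-other (a≢b ∘ sym))) (monomial-M a (K (φ b)))) ⟩
          (D * D) * ((c * c) * (f * f))
            ≡⟨ solve 3 (λ d c f → (d :* d) :* ((c :* c) :* (f :* f)) := ((f :* d) :* c) :* ((f :* d) :* c)) refl D c f ⟩
          ((f * D) * c) * ((f * D) * c) ≡⟨ cong (λ x → (x * c) * (x * c)) (lemma-of-tangents (φ-≢ (a≢b ∘ sym))) ⟩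
          (C * c) * (C * c) ≡⟨ cong (λ x → x * x) (recipʳ (tangent-constant-≢0 (φ a))) ⟩
          1# * 1# ≡⟨ *-identityˡ 1# ⟩
          1# ≡⟨ sym (recipʳ D²≢0) ⟩
          (D * D) * recip (D * D) ∎)
          where
          open ≡-Reasoning
          D f c C : Carrier
          D = det-product (φ a) (φ b)
          f = quad (φ a) (K (φ b))
          C = tangent-constant (φ a)
          c = recip C
          D≢0 : D ≢ 0#
          D≢0 = Π-≢0 (λ c → nz (det (K (φ a)) (K (φ b)) (K c))) (λ c → nz-≢0 (det (K (φ a)) (K (φ b)) (K c)))
          D²≢0 : D * D ≢ 0#
          D²≢0 = *-≢0 D≢0 D≢0

        G-off-diagonal : ∀ {a b} → a ≢ b → G a b ≡
          recip (det-product (φ a) (φ b) * det-product (φ a) (φ b)) * recip (det (K (φ a)) (K (φ b)) P * dets a b)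
        G-off-diagonal a≢b = trans (sym (*-assoc _ _ _)) (cong₂ (λ x y → x * recip y) (weight a≢b) (node-product-≡ a≢b))

        G-antisymmetric : ∀ a b → a ≢ b → G a b ≡ - G b a
        G-antisymmetric a b a≢b = begin
          G a b ≡⟨ G-off-diagonal a≢b ⟩
          recip (D * D) * recip (d * dets a b) ≡⟨ cong₂ (λ x y → recip x * recip y) (det-product-square (φ a) (φ b)) flip ⟩
          R * recip (- e) ≡⟨ cong (R *_) (recip-neg e≢0) ⟩
          R * - recip e ≡⟨ solve 2 (λ x y → x :* (:- y) := :- (x :* y)) refl R (recip e) ⟩
          - (R * recip e) ≡⟨ cong -_ (sym (G-off-diagonal (a≢b ∘ sym))) ⟩
          - G b a ∎
          where
          open ≡-Reasoning
          D d e R : Carrier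
          D = det-product (φ a) (φ b)
          d = det (K (φ a)) (K (φ b)) P
          e = det (K (φ b)) (K (φ a)) P * dets b a
          R = recip (det-product (φ b) (φ a) * det-product (φ b) (φ a))
          e≢0 : e ≢ 0#
          e≢0 = *-≢0 (generic (a≢b ∘ sym)) (Π-≢0 (λ m → nz (det (K (φ b)) (K (φ a)) (K (φ m)))) (λ m → nz-≢0 (det (K (φ b)) (K (φ a)) (K (φ m)))))
          flip : d * dets a b ≡ - e
          flip = trans (cong₂ _*_ (det-swap₁₂ (K (φ a)) (K (φ b)) P) (sym (dets-symmetric a≢b)))
            (solve 2 (λ x y → (:- x) :* y := :- (x :* y)) refl (det (K (φ b)) (K (φ a)) P) (dets b a))

        -- The total is zero by rows, and by antisymmetry it is the trace.
        diagonal-sum : ∑ (λ a → G a a) ≡ 0#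
        diagonal-sum = trans (sym (∑-antisymmetric G G-antisymmetric)) (trans (∑-cong row-sum) (∑-0 6))

      -- The quartic envelope meets the pencil of P in at most four lines unless it contains the pencil.
      sixth-tangent : ∀ x → (∀ a → a ≢ x → quad (φ a) P ≡ 0#) → quad (φ x) P ≡ 0#
      sixth-tangent x others =
        square-≡0 (trans (sym (M-centre x)) (*-≡0 recip-≢ (trans (*-comm R _) (*-≡0 κ≢0 G≡0))))
        where
        R : Carrier
        R = recip (node-product (N x) x)
        recip-≢ : R ≢ 0#
        recip-≢ = recip-≢0 (node-product-≢0 (N x) x)
        κ≢0 : κ x ≢ 0#
        κ≢0 = *-≢0 (recip-≢0 (tangent-constant-≢0 (φ x))) (recip-≢0 (tangent-constant-≢0 (φ x)))
        M-centre : ∀ a → monomial M (N a a) ≡ quad (φ a) P * quad (φ a) P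
        M-centre a = trans (cong (λ X → monomial M (coords (φ a) X)) (node-centre a)) (monomial-M a P)
        G≡0 : G x x ≡ 0#
        G≡0 = trans (sym (∑-single (λ a → G a a) x λ a a≢x →
          trans (cong (λ s → κ a * (s * recip (node-product (N a) a))) (trans (M-centre a) (trans (cong (λ f → f * f) (others a a≢x)) (zeroˡ 0#))))
            (solve 2 (λ k r → k :* (:0 :* r) := :0) refl (κ a) (recip (node-product (N a) a))))) diagonal-sum
        square-≡0 : ∀ {f} → f * f ≡ 0# → f ≡ 0#
        square-≡0 {f} eq with f ≟ 0#
        ... | yes f≡0 = f≡0
        ... | no f≢0 = ⊥-elim (*-≢0 f≢0 f≢0 eq)

-- Counting tangents through points

open SemiringSum ℕₚ.+-*-semiring using () renaming
  (sum to #∑; sum-cong-≗ to #∑-cong; ∑-distrib-+ to #∑-+; ∑-comm to #∑-comm; *-distribˡ-sum to #∑-*ˡ)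

private
  module NatIdentities where
    open ℕSolver.+-*-Solver

    rearrange₁ : ∀ a b c d → a ℕ.+ b ℕ.+ c ℕ.+ d ≡ (a ℕ.+ d) ℕ.+ (b ℕ.+ c)
    rearrange₁ = solve 4 (λ a b c d → a :+ b :+ c :+ d := (a :+ d) :+ (b :+ c)) refl

    rearrange₂ : ∀ a b c d → (a ℕ.+ b) ℕ.+ (c ℕ.+ d) ≡ (a ℕ.+ c ℕ.+ d) ℕ.+ b
    rearrange₂ = solve 4 (λ a b c d → (a :+ b) :+ (c :+ d) := (a :+ c :+ d) :+ b) refl

    rearrange₃ : ∀ a b c → (4 ℕ.* a ℕ.+ (b ℕ.+ 3)) ℕ.+ c ≡ 3 ℕ.* a ℕ.+ c ℕ.+ b ℕ.+ 3 ℕ.+ a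
    rearrange₃ = solve 3 (λ a b c → (con 4 :* a :+ (b :+ con 3)) :+ c := con 3 :* a :+ c :+ b :+ con 3 :+ a) refl

    rearrange₄ : ∀ m → m ℕ.* m ℕ.+ 3 ℕ.+ (4 ℕ.* m) ℕ.* 1 ≡ 4 ℕ.* m ℕ.+ (m ℕ.* m ℕ.+ 3) ℕ.* 1
    rearrange₄ = solve 1 (λ m → m :* m :+ con 3 :+ (con 4 :* m) :* con 1 := con 4 :* m :+ (m :* m :+ con 3) :* con 1) refl

    rearrange₅ : ∀ q → q ℕ.* (q ℕ.* (q ℕ.* 3)) ≡ 3 ℕ.* (q ℕ.* (q ℕ.* q))
    rearrange₅ = solve 1 (λ q → q :* (q :* (q :* con 3)) := con 3 :* (q :* (q :* q))) refl

    rearrange₆ : ∀ m r d k → (m ℕ.+ r) ℕ.+ (r ℕ.+ (d ℕ.+ 2 ℕ.* k)) ≡ (m ℕ.+ d) ℕ.+ 2 ℕ.* (r ℕ.+ k)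
    rearrange₆ = solve 4 (λ m r d k → (m :+ r) :+ (r :+ (d :+ con 2 :* k)) := (m :+ d) :+ con 2 :* (r :+ k)) refl

open NatIdentities

-- Indicator functions and sums of natural numbers

χ : ∀ {P : Set} → Dec P → ℕ
χ (yes _) = 1
χ (no _) = 0

χ-yes : ∀ {P : Set} (d : Dec P) → P → χ d ≡ 1
χ-yes (yes _) p = refl
χ-yes (no ¬p) p = ⊥-elim (¬p p)

χ-no : ∀ {P : Set} (d : Dec P) → ¬ P → χ d ≡ 0
χ-no (yes p) ¬p = ⊥-elim (¬p p)
χ-no (no _) ¬p = refl

χ-cong : ∀ {P Q : Set} (d : Dec P) (e : Dec Q) → (P → Q) → (Q → P) → χ d ≡ χ e
χ-cong (yes p) e f g = sym (χ-yes e (f p))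
χ-cong (no ¬p) e f g = sym (χ-no e (¬p ∘ g))

#∑-≤ : ∀ {n} {f g : Fin n → ℕ} → (∀ i → f i ℕ.≤ g i) → #∑ f ℕ.≤ #∑ g
#∑-≤ {zero} le = z≤n
#∑-≤ {suc n} le = ℕₚ.+-mono-≤ (le zero) (#∑-≤ (le ∘ suc))

#∑-const : ∀ n c → #∑ {n} (λ _ → c) ≡ n ℕ.* c
#∑-const zero c = refl
#∑-const (suc n) c = cong (c ℕ.+_) (#∑-const n c)

#∑-single : ∀ {n} (f : Fin n → ℕ) i → (∀ c → c ≢ i → f c ≡ 0) → #∑ f ≡ f i
#∑-single {suc n} f zero zeros = trans (cong (f zero ℕ.+_) (trans (#∑-cong (λ c → zeros (suc c) λ ()))
  (trans (#∑-const n 0) (ℕₚ.*-zeroʳ n)))) (ℕₚ.+-identityʳ _)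
#∑-single {suc n} f (suc i) zeros = trans (cong (ℕ._+ #∑ (f ∘ suc)) (zeros zero λ ()))
  (#∑-single (f ∘ suc) i λ c c≢i → zeros (suc c) λ { refl → c≢i refl })

#∑-splitAt : ∀ m {n} (f : Fin m ⊎ Fin n → ℕ) →
  #∑ {m ℕ.+ n} (λ i → f (splitAt m i)) ≡ #∑ (f ∘ inj₁) ℕ.+ #∑ (f ∘ inj₂)
#∑-splitAt zero f = refl
#∑-splitAt (suc m) f = trans (cong (f (inj₁ zero) ℕ.+_) (trans (#∑-cong shift) (#∑-splitAt m f′)))
  (sym (ℕₚ.+-assoc (f (inj₁ zero)) _ _))
  where
  f′ : Fin m ⊎ _ → ℕ
  f′ (inj₁ i) = f (inj₁ (suc i))
  f′ (inj₂ j) = f (inj₂ j)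
  shift : ∀ i → f (splitAt (suc m) (suc i)) ≡ f′ (splitAt m i)
  shift i with splitAt m i
  ... | inj₁ _ = refl
  ... | inj₂ _ = refl

#∑-square : ∀ {n} (f : Fin n → ℕ) → #∑ f ℕ.* #∑ f ≡ #∑ (λ i → #∑ (λ j → f i ℕ.* f j))
#∑-square f = trans (#∑-*ˡ (#∑ f) f) (#∑-cong λ i → trans (ℕₚ.*-comm (#∑ f) (f i)) (#∑-*ˡ (f i) f))

-- Off-diagonal entries occur in equal pairs, so the total and the trace have the same parity. Both
-- parity arguments rest on this: the tangents through a vector and the characteristic of the field.
#∑-symmetric : ∀ {n} (M : Fin n → Fin n → ℕ) → (∀ i j → M i j ≡ M j i) →
  ∃[ k ] (#∑ (λ i → #∑ (M i)) ≡ #∑ (λ i → M i i) ℕ.+ 2 ℕ.* k)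
#∑-symmetric {zero} M sy = 0 , refl
#∑-symmetric {suc n} M sy with #∑-symmetric (λ i j → M (suc i) (suc j)) (λ i j → sy (suc i) (suc j))
... | k , eq = R ℕ.+ k , (begin
  (M zero zero ℕ.+ R) ℕ.+ #∑ (λ i → M (suc i) zero ℕ.+ #∑ (λ j → M (suc i) (suc j)))
    ≡⟨ cong ((M zero zero ℕ.+ R) ℕ.+_) (#∑-+ (λ i → M (suc i) zero) (λ i → #∑ (λ j → M (suc i) (suc j)))) ⟩
  (M zero zero ℕ.+ R) ℕ.+ (#∑ (λ i → M (suc i) zero) ℕ.+ Q)
    ≡⟨ cong₂ (λ x y → (M zero zero ℕ.+ R) ℕ.+ (x ℕ.+ y)) (#∑-cong λ i → sy (suc i) zero) eq ⟩
  (M zero zero ℕ.+ R) ℕ.+ (R ℕ.+ (D ℕ.+ 2 ℕ.* k))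
    ≡⟨ rearrange₆ (M zero zero) R D k ⟩
  (M zero zero ℕ.+ D) ℕ.+ 2 ℕ.* (R ℕ.+ k) ∎)
  where
  open ≡-Reasoning
  R Q D : ℕ
  R = #∑ (λ j → M zero (suc j))
  Q = #∑ (λ i → #∑ (λ j → M (suc i) (suc j)))
  D = #∑ (λ i → M (suc i) (suc i))

select : ∀ {n} k {P : Fin n → Set} (P? : ∀ i → Dec (P i)) → k ℕ.≤ #∑ (λ i → χ (P? i)) →
  Σ (Fin k → Fin n) λ φ → (∀ {a b} → φ a ≡ φ b → a ≡ b) × (∀ a → P (φ a))
select zero P? le = (λ ()) , (λ {a} → ⊥-elim (¬Fin0 a)) , λ ()
select {suc n} (suc k) P? le with P? zero
select {suc n} (suc k) P? (s≤s le) | yes p with select k (P? ∘ suc) le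
... | φ , inj , all = φ′ , inj′ , λ { zero → p ; (suc a) → all a }
  where
  φ′ : Fin (suc k) → Fin (suc n)
  φ′ zero = zero
  φ′ (suc a) = suc (φ a)
  inj′ : ∀ {a b} → φ′ a ≡ φ′ b → a ≡ b
  inj′ {zero} {zero} eq = refl
  inj′ {suc a} {suc b} eq = cong suc (inj (suc-injective eq))
select {suc n} (suc k) P? le | no _ with select (suc k) (P? ∘ suc) le
... | φ , inj , all = suc ∘ φ , (inj ∘ suc-injective) , all

-- Moments of the number of tangents through a vector

module Counts (𝔽 : Field) (q : ℕ) (enum : Field.Carrier 𝔽 ↔ Fin q) where
  open FiniteField 𝔽 q enum
  open Geometry 𝔽 q enum
  open Arcs 𝔽 q enum

  vector : Fin q → Fin q → Fin q → V
  vector x y z = vec (el x) (el y) (el z)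

  -- Summing over vectors dispenses with representatives of projective points and makes every count
  -- a power of `q`.
  #∑V : (V → ℕ) → ℕ
  #∑V f = #∑ λ x → #∑ λ y → #∑ λ z → f (vector x y z)

  #∑V-cong : ∀ {f g} → (∀ v → f v ≡ g v) → #∑V f ≡ #∑V g
  #∑V-cong e = #∑-cong λ x → #∑-cong λ y → #∑-cong λ z → e (vector x y z)

  #∑V-≤ : ∀ {f g} → (∀ v → f v ℕ.≤ g v) → #∑V f ℕ.≤ #∑V g
  #∑V-≤ le = #∑-≤ λ x → #∑-≤ λ y → #∑-≤ λ z → le (vector x y z)

  #∑V-+ : ∀ f g → #∑V (λ v → f v ℕ.+ g v) ≡ #∑V f ℕ.+ #∑V g
  #∑V-+ f g = trans (#∑-cong λ x → trans (#∑-cong λ y → #∑-+ (λ z → f (vector x y z)) (λ z → g (vector x y z)))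
    (#∑-+ (λ y → #∑ λ z → f (vector x y z)) (λ y → #∑ λ z → g (vector x y z))))
    (#∑-+ (λ x → #∑ λ y → #∑ λ z → f (vector x y z)) (λ x → #∑ λ y → #∑ λ z → g (vector x y z)))

  #∑V-* : ∀ c f → #∑V (λ v → c ℕ.* f v) ≡ c ℕ.* #∑V f
  #∑V-* c f = sym (trans (#∑-*ˡ c (λ x → #∑ λ y → #∑ λ z → f (vector x y z)))
    (#∑-cong λ x → trans (#∑-*ˡ c (λ y → #∑ λ z → f (vector x y z)))
      (#∑-cong λ y → #∑-*ˡ c (λ z → f (vector x y z)))))

  #∑V-comm : ∀ {m} (f : V → Fin m → ℕ) → #∑V (λ v → #∑ (f v)) ≡ #∑ (λ i → #∑V (λ v → f v i))
  #∑V-comm f = trans (#∑-cong λ x → trans (#∑-cong λ y → #∑-comm (λ z i → f (vector x y z) i))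
    (#∑-comm (λ y i → #∑ λ z → f (vector x y z) i))) (#∑-comm (λ x i → #∑ λ y → #∑ λ z → f (vector x y z) i))

  #∑V-const : ∀ c → #∑V (λ _ → c) ≡ q ℕ.* (q ℕ.* (q ℕ.* c))
  #∑V-const c = trans (#∑-cong {q} λ _ → trans (#∑-cong {q} λ _ → #∑-const q c) (#∑-const q _)) (#∑-const q _)

  #∑V-single : ∀ f u → (∀ v → v ≢ u → f v ≡ 0) → #∑V f ≡ f u
  #∑V-single f u zeros = begin
    #∑V f ≡⟨ #∑-single (λ x → #∑ λ y → #∑ λ z → f (vector x y z)) x₀
               (λ x x≢ → all-zero (λ y → #∑ λ z → f (vector x y z)) (λ y → all-zero (λ z → f (vector x y z))
                 (λ z → zeros (vector x y z) (x≢ ∘ el-ix≡ ∘ cong v₀)))) ⟩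
    #∑ (λ y → #∑ λ z → f (vector x₀ y z)) ≡⟨ #∑-single (λ y → #∑ λ z → f (vector x₀ y z)) y₀
               (λ y y≢ → all-zero (λ z → f (vector x₀ y z)) (λ z → zeros (vector x₀ y z) (y≢ ∘ el-ix≡ ∘ cong v₁))) ⟩
    #∑ (λ z → f (vector x₀ y₀ z)) ≡⟨ #∑-single (λ z → f (vector x₀ y₀ z)) z₀
               (λ z z≢ → zeros (vector x₀ y₀ z) (z≢ ∘ el-ix≡ ∘ cong v₂)) ⟩
    f (vector x₀ y₀ z₀) ≡⟨ cong f (vec-cong (el-ix _) (el-ix _) (el-ix _)) ⟩
    f u ∎
    where
    open ≡-Reasoning
    x₀ y₀ z₀ : Fin q
    x₀ = ix (v₀ u)
    y₀ = ix (v₁ u)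
    z₀ = ix (v₂ u)
    el-ix≡ : ∀ {i x} → el i ≡ x → i ≡ ix x
    el-ix≡ {i} e = trans (sym (ix-el i)) (cong ix e)
    all-zero : ∀ {n} (g : Fin n → ℕ) → (∀ i → g i ≡ 0) → #∑ g ≡ 0
    all-zero {n} g e = trans (#∑-cong e) (trans (#∑-const n 0) (ℕₚ.*-zeroʳ n))

  #∑V-term : ∀ f u → f u ℕ.≤ #∑V f
  #∑V-term f u = subst (ℕ._≤ #∑V f) (trans (#∑V-single (λ v → χ (v ≟V u) ℕ.* f v) u (λ v v≢u → cong (ℕ._* f v) (χ-no (v ≟V u) v≢u)))
      (trans (cong (ℕ._* f u) (χ-yes (u ≟V u) refl)) (ℕₚ.*-identityˡ (f u))))
    (#∑V-≤ λ v → bound v (v ≟V u))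
    where
    bound : ∀ v (d : Dec (v ≡ u)) → χ d ℕ.* f v ℕ.≤ f v
    bound v (yes _) = ℕₚ.≤-reflexive (ℕₚ.*-identityˡ (f v))
    bound v (no _) = z≤n

  zeros : V → V → ℕ
  zeros S v = χ (S ∙ v ≟ 0#)

  root-count : ∀ {α} (g : Carrier → Carrier) β → α ≢ 0# → (∀ x → g x ≡ α * x + β) → #∑ (λ i → χ (g (el i) ≟ 0#)) ≡ 1
  root-count {α} g β α≢0 g≡ = trans (#∑-single (λ i → χ (g (el i) ≟ 0#)) (ix r) other) (χ-yes (g (el (ix r)) ≟ 0#)
      (trans (cong g (el-ix r)) (trans (g≡ r) (trans (cong (_+ β) (trans (*-comm α r) (recip-unmul α≢0)))
        (solve 1 (λ b → :- b :+ b := :0) refl β)))))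
    where
    r : Carrier
    r = (- β) * recip α
    other : ∀ i → i ≢ ix r → χ (g (el i) ≟ 0#) ≡ 0
    other i i≢ = χ-no (g (el i) ≟ 0#) λ e → i≢ (trans (sym (ix-el i)) (cong ix (sym (*-recip-cancel α≢0
      (trans (solve 2 (λ a b → :- b := a :+ :- (a :+ b)) refl (α * el i) β)
        (trans (cong (λ z → α * el i + - z) (trans (sym (g≡ (el i))) e))
          (solve 2 (λ a x → a :* x :+ :- :0 := x :* a) refl α (el i))))))))

  opaque
    unfolding _∙_
    ∙-vec₂ : ∀ S x y z → S ∙ vec x y z ≡ v₂ S * z + (v₀ S * x + v₁ S * y)
    ∙-vec₂ (vec a b c) x y z = +-comm _ _

    ∙-vec₁ : ∀ S x y z → S ∙ vec x y z ≡ v₁ S * y + (v₀ S * x + v₂ S * z)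
    ∙-vec₁ (vec a b c) x y z = solve 3 (λ p q r → p :+ q :+ r := q :+ (p :+ r)) refl (a * x) (b * y) (c * z)

    ∙-vec₀ : ∀ S x y z → S ∙ vec x y z ≡ v₀ S * x + (v₁ S * y + v₂ S * z)
    ∙-vec₀ (vec a b c) x y z = +-assoc _ _ _

  private
    ones : #∑ {q} (λ _ → #∑ {q} (λ _ → 1)) ≡ q ℕ.* q
    ones = trans (#∑-cong {q} λ _ → trans (#∑-const q 1) (ℕₚ.*-identityʳ q)) (#∑-const q q)

  -- A coordinate with nonzero coefficient is determined by the other two; the sums are exchanged to
  -- bring it innermost.
  plane-count : ∀ {S} → S ≢ 0V → #∑V (zeros S) ≡ q ℕ.* q
  plane-count {S} S≢0 with v₀ S ≟ 0# | v₁ S ≟ 0# | v₂ S ≟ 0#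
  ... | _ | _ | no ne = trans (#∑-cong λ x → #∑-cong λ y → root-count (λ z → S ∙ vec (el x) (el y) z) _ ne (∙-vec₂ S (el x) (el y))) ones
  ... | _ | no ne | _ = trans (#∑-cong λ x → trans (#∑-comm (λ y z → zeros S (vector x y z)))
      (#∑-cong λ z → root-count (λ y → S ∙ vec (el x) y (el z)) _ ne (λ y → ∙-vec₁ S (el x) y (el z)))) ones
  ... | no ne | _ | _ = trans (#∑-comm (λ x y → #∑ λ z → zeros S (vector x y z)))
      (trans (#∑-cong λ y → trans (#∑-comm (λ x z → zeros S (vector x y z)))
        (#∑-cong λ z → root-count (λ x → S ∙ vec x (el y) (el z)) _ ne (λ x → ∙-vec₀ S x (el y) (el z)))) ones)
  ... | yes e₀ | yes e₁ | yes e₂ = ⊥-elim (S≢0 (vec-cong e₀ e₁ e₂))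

  -- Two independent covectors vanish at the q multiples of their cross product.
  line-count : ∀ {S S′} → S ⨯ S′ ≢ 0V → q ℕ.≤ #∑V (λ v → zeros S v ℕ.* zeros S′ v)
  line-count {S} {S′} w≢0 = ℕₚ.≤-trans (ℕₚ.≤-trans (ℕₚ.≤-reflexive (sym (trans (#∑-const q 1) (ℕₚ.*-identityʳ q))))
      (#∑-≤ λ i → ℕₚ.≤-trans (ℕₚ.≤-reflexive (sym (χ-yes (el i · w ≟V el i · w) refl))) (#∑V-term (λ v → χ (v ≟V el i · w)) (el i · w))))
    (ℕₚ.≤-trans (ℕₚ.≤-reflexive (sym (#∑V-comm (λ v i → χ (v ≟V el i · w))))) (#∑V-≤ bound))
    where
    w : V
    w = S ⨯ S′
    e : V
    e = proj₁ (nonzero-coordinate w≢0)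
    ew : e ∙ w ≡ 1#
    ew = proj₂ (nonzero-coordinate w≢0)
    bound : ∀ v → #∑ (λ i → χ (v ≟V el i · w)) ℕ.≤ zeros S v ℕ.* zeros S′ v
    bound v = ℕₚ.≤-trans (ℕₚ.≤-reflexive (#∑-single (λ i → χ (v ≟V el i · w)) i₀ λ i i≢ → χ-no (v ≟V el i · w) λ v≡ → i≢ (trans (sym (ix-el i)) (cong ix
        (trans (trans (sym (*-identityʳ _)) (cong (el i *_) (sym ew))) (trans (sym (∙-·ʳ e (el i) w)) (cong (e ∙_) (sym v≡))))))))
      (at (v ≟V el i₀ · w))
      where
      i₀ : Fin q
      i₀ = ix (e ∙ v)
      at : (d : Dec (v ≡ el i₀ · w)) → χ d ℕ.≤ zeros S v ℕ.* zeros S′ v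
      at (no _) = z≤n
      at (yes v≡) = ℕₚ.≤-reflexive (sym (cong₂ ℕ._*_ (χ-yes (S ∙ v ≟ 0#) (vanish S (det-XXY S S′)))
          (χ-yes (S′ ∙ v ≟ 0#) (vanish S′ (det-XYX S′ S)))))
        where
        vanish : ∀ S → S ∙ w ≡ 0# → S ∙ v ≡ 0#
        vanish S Sw = trans (cong (S ∙_) v≡) (trans (∙-·ʳ S (el i₀) w) (trans (cong (el i₀ *_) Sw) (zeroʳ _)))

  module Family {m : ℕ} (S : Fin m → V) (S≢0 : ∀ a → S a ≢ 0V) (S-indep : ∀ {a b} → a ≢ b → S a ⨯ S b ≢ 0V) where
    τ : V → ℕ
    τ v = #∑ (λ a → zeros (S a) v)

    first-moment : #∑V τ ≡ m ℕ.* (q ℕ.* q)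
    first-moment = trans (#∑V-comm (λ v a → zeros (S a) v)) (trans (#∑-cong λ a → plane-count (S≢0 a)) (#∑-const m _))

    second-moment : m ℕ.* (m ℕ.* q) ℕ.+ m ℕ.* (q ℕ.* q) ℕ.≤ #∑V (λ v → τ v ℕ.* τ v) ℕ.+ m ℕ.* q
    second-moment = begin
      m ℕ.* (m ℕ.* q) ℕ.+ m ℕ.* (q ℕ.* q) ≡⟨ sym (cong₂ ℕ._+_ (#∑-const m _) (#∑-const m _)) ⟩
      #∑ {m} (λ _ → m ℕ.* q) ℕ.+ #∑ {m} (λ _ → q ℕ.* q) ≡⟨ sym (#∑-+ {m} (λ _ → m ℕ.* q) (λ _ → q ℕ.* q)) ⟩
      #∑ {m} (λ _ → m ℕ.* q ℕ.+ q ℕ.* q) ≤⟨ #∑-≤ row ⟩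
      #∑ (λ a → #∑ (λ b → N a b) ℕ.+ q) ≡⟨ #∑-+ (λ a → #∑ (λ b → N a b)) (λ _ → q) ⟩
      #∑ (λ a → #∑ (λ b → N a b)) ℕ.+ #∑ {m} (λ _ → q) ≡⟨ cong₂ ℕ._+_ (sym squares) (#∑-const m q) ⟩
      #∑V (λ v → τ v ℕ.* τ v) ℕ.+ m ℕ.* q ∎
      where
      open ℕₚ.≤-Reasoning
      N : Fin m → Fin m → ℕ
      N a b = #∑V (λ v → zeros (S a) v ℕ.* zeros (S b) v)
      squares : #∑V (λ v → τ v ℕ.* τ v) ≡ #∑ (λ a → #∑ (λ b → N a b))
      squares = trans (#∑V-cong λ v → #∑-square (λ a → zeros (S a) v))
        (trans (#∑V-comm (λ v a → #∑ (λ b → zeros (S a) v ℕ.* zeros (S b) v)))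
          (#∑-cong λ a → #∑V-comm (λ v b → zeros (S a) v ℕ.* zeros (S b) v)))
      -- At least `q` common zeros off the diagonal and exactly `q * q` on it. The uniform lower
      -- bound has a surplus `q` on the diagonal, which is moved to the right to avoid subtraction.
      entry : ∀ a b (d : Dec (b ≡ a)) → q ℕ.+ χ d ℕ.* (q ℕ.* q) ℕ.≤ N a b ℕ.+ χ d ℕ.* q
      entry a b (no b≢a) = ℕₚ.+-monoˡ-≤ 0 (line-count (S-indep (b≢a ∘ sym)))
      entry a .a (yes refl) = ℕₚ.≤-reflexive (trans (ℕₚ.+-comm q _) (cong₂ ℕ._+_
        (trans (ℕₚ.*-identityˡ _) (trans (sym (plane-count (S≢0 a))) (#∑V-cong λ v → idem (S a ∙ v ≟ 0#)))) (sym (ℕₚ.*-identityˡ q))))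
        where
        idem : ∀ {P : Set} (d : Dec P) → χ d ≡ χ d ℕ.* χ d
        idem (yes _) = refl
        idem (no _) = refl
      delta : ∀ a c → #∑ (λ b → χ (b ≟F a) ℕ.* c) ≡ c
      delta a c = trans (#∑-single (λ b → χ (b ≟F a) ℕ.* c) a λ b b≢a → cong (ℕ._* c) (χ-no (b ≟F a) b≢a))
        (trans (cong (ℕ._* c) (χ-yes (a ≟F a) refl)) (ℕₚ.*-identityˡ c))
      row : ∀ a → m ℕ.* q ℕ.+ q ℕ.* q ℕ.≤ #∑ (λ b → N a b) ℕ.+ q
      row a = begin
        m ℕ.* q ℕ.+ q ℕ.* q ≡⟨ sym (cong₂ ℕ._+_ (#∑-const m q) (delta a (q ℕ.* q))) ⟩
        #∑ {m} (λ _ → q) ℕ.+ #∑ (λ b → χ (b ≟F a) ℕ.* (q ℕ.* q)) ≡⟨ sym (#∑-+ (λ _ → q) (λ b → χ (b ≟F a) ℕ.* (q ℕ.* q))) ⟩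
        #∑ (λ b → q ℕ.+ χ (b ≟F a) ℕ.* (q ℕ.* q)) ≤⟨ #∑-≤ (λ b → entry a b (b ≟F a)) ⟩
        #∑ (λ b → N a b ℕ.+ χ (b ≟F a) ℕ.* q) ≡⟨ #∑-+ (N a) (λ b → χ (b ≟F a) ℕ.* q) ⟩
        #∑ (N a) ℕ.+ #∑ (λ b → χ (b ≟F a) ℕ.* q) ≡⟨ cong (#∑ (N a) ℕ.+_) (delta a q) ⟩
        #∑ (N a) ℕ.+ q ∎

    -- The variance argument: (τ − 1)(τ − 3) ≤ 0 for all v ≠ 0 forces q(q − 2)(q − 4) ≤ 3 when m = 2q.
    moment-bound : (∀ v → v ≢ 0V → τ v ℕ.* τ v ℕ.+ 3 ℕ.≤ 4 ℕ.* τ v) →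
      m ℕ.* (m ℕ.* q) ℕ.+ 3 ℕ.* (q ℕ.* (q ℕ.* q)) ℕ.+ 4 ℕ.* m ℕ.≤ 3 ℕ.* (m ℕ.* (q ℕ.* q)) ℕ.+ m ℕ.* q ℕ.+ m ℕ.* m ℕ.+ 3
    moment-bound small = ℕₚ.+-cancelʳ-≤ A₁ _ _ (begin
      m ℕ.* (m ℕ.* q) ℕ.+ 3 ℕ.* (q ℕ.* (q ℕ.* q)) ℕ.+ 4 ℕ.* m ℕ.+ A₁
        ≡⟨ rearrange₁ (m ℕ.* (m ℕ.* q)) (3 ℕ.* (q ℕ.* (q ℕ.* q))) (4 ℕ.* m) A₁ ⟩
      (m ℕ.* (m ℕ.* q) ℕ.+ A₁) ℕ.+ (3 ℕ.* (q ℕ.* (q ℕ.* q)) ℕ.+ 4 ℕ.* m) ≤⟨ ℕₚ.+-monoˡ-≤ _ second-moment ⟩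
      (A₂ ℕ.+ m ℕ.* q) ℕ.+ (3 ℕ.* (q ℕ.* (q ℕ.* q)) ℕ.+ 4 ℕ.* m)
        ≡⟨ rearrange₂ A₂ (m ℕ.* q) (3 ℕ.* (q ℕ.* (q ℕ.* q))) (4 ℕ.* m) ⟩
      (A₂ ℕ.+ 3 ℕ.* (q ℕ.* (q ℕ.* q)) ℕ.+ 4 ℕ.* m) ℕ.+ m ℕ.* q ≤⟨ ℕₚ.+-monoˡ-≤ (m ℕ.* q) summed ⟩
      (4 ℕ.* A₁ ℕ.+ (m ℕ.* m ℕ.+ 3)) ℕ.+ m ℕ.* q
        ≡⟨ rearrange₃ A₁ (m ℕ.* m) (m ℕ.* q) ⟩
      3 ℕ.* A₁ ℕ.+ m ℕ.* q ℕ.+ m ℕ.* m ℕ.+ 3 ℕ.+ A₁ ∎)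
      where
      open ℕₚ.≤-Reasoning
      A₁ A₂ : ℕ
      A₁ = m ℕ.* (q ℕ.* q)
      A₂ = #∑V (λ v → τ v ℕ.* τ v)
      -- All `m` covectors vanish at `0V`, where `small` says nothing. Correction terms on both
      -- sides turn the inequality into an equality there.
      origin : V → ℕ
      origin v = χ (v ≟V 0V)
      origin-sum : ∀ c → #∑V (λ v → c ℕ.* origin v) ≡ c
      origin-sum c = trans (#∑V-single (λ v → c ℕ.* origin v) 0V λ v v≢0 → trans (cong (c ℕ.*_) (χ-no (v ≟V 0V) v≢0)) (ℕₚ.*-zeroʳ c))
        (trans (cong (c ℕ.*_) (χ-yes (0V ≟V 0V) refl)) (ℕₚ.*-identityʳ c))
      τ0 : τ 0V ≡ m
      τ0 = trans (#∑-cong λ a → χ-yes (S a ∙ 0V ≟ 0#) (∙-0V (S a))) (trans (#∑-const m 1) (ℕₚ.*-identityʳ m))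
      pointwise : ∀ v (d : Dec (v ≡ 0V)) →
        τ v ℕ.* τ v ℕ.+ 3 ℕ.+ (4 ℕ.* m) ℕ.* χ d ℕ.≤ 4 ℕ.* τ v ℕ.+ (m ℕ.* m ℕ.+ 3) ℕ.* χ d
      pointwise v (no v≢0) = ℕₚ.+-mono-≤ (small v v≢0)
        (ℕₚ.≤-reflexive (trans (ℕₚ.*-zeroʳ (4 ℕ.* m)) (sym (ℕₚ.*-zeroʳ (m ℕ.* m ℕ.+ 3)))))
      pointwise v (yes refl) = ℕₚ.≤-reflexive (trans (cong (λ t → t ℕ.* t ℕ.+ 3 ℕ.+ (4 ℕ.* m) ℕ.* 1) τ0)
        (trans (rearrange₄ m)
          (cong (λ t → 4 ℕ.* t ℕ.+ (m ℕ.* m ℕ.+ 3) ℕ.* 1) (sym τ0))))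
      summed : A₂ ℕ.+ 3 ℕ.* (q ℕ.* (q ℕ.* q)) ℕ.+ 4 ℕ.* m ℕ.≤ 4 ℕ.* A₁ ℕ.+ (m ℕ.* m ℕ.+ 3)
      summed = begin
        A₂ ℕ.+ 3 ℕ.* (q ℕ.* (q ℕ.* q)) ℕ.+ 4 ℕ.* m ≡⟨ sym (trans (#∑V-+ (λ v → τ v ℕ.* τ v ℕ.+ 3) (λ v → (4 ℕ.* m) ℕ.* origin v))
            (cong₂ ℕ._+_ (trans (#∑V-+ (λ v → τ v ℕ.* τ v) (λ _ → 3)) (cong (A₂ ℕ.+_) (trans (#∑V-const 3)
              (rearrange₅ q)))) (origin-sum (4 ℕ.* m)))) ⟩
        #∑V (λ v → τ v ℕ.* τ v ℕ.+ 3 ℕ.+ (4 ℕ.* m) ℕ.* origin v) ≤⟨ #∑V-≤ (λ v → pointwise v (v ≟V 0V)) ⟩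
        #∑V (λ v → 4 ℕ.* τ v ℕ.+ (m ℕ.* m ℕ.+ 3) ℕ.* origin v)
          ≡⟨ trans (#∑V-+ (λ v → 4 ℕ.* τ v) (λ v → (m ℕ.* m ℕ.+ 3) ℕ.* origin v))
               (cong₂ ℕ._+_ (trans (#∑V-* 4 τ) (cong (4 ℕ.*_) first-moment)) (origin-sum (m ℕ.* m ℕ.+ 3))) ⟩
        4 ℕ.* A₁ ℕ.+ (m ℕ.* m ℕ.+ 3) ∎

-- Every arc of odd size q extends to an oval

-- Below 5, parity refutes 0 and 4; the values 1 and 3 are the roots of `(t - 1)(t - 3)`, and 2 lies
-- between them.
odd-small : ∀ {q} t k → ¬ (2 ∣ q) → t ℕ.+ 2 ℕ.* k ≡ q → ¬ (5 ℕ.≤ t) → t ℕ.* t ℕ.+ 3 ℕ.≤ 4 ℕ.* t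
odd-small 0 k odd eq _ = ⊥-elim (odd (divides k (trans (sym eq) (ℕₚ.*-comm 2 k))))
odd-small 1 k odd eq _ = ℕₚ.≤-refl
odd-small 2 k odd eq _ = ℕₚ.m≤m+n 7 1
odd-small 3 k odd eq _ = ℕₚ.≤-refl
odd-small 4 k odd eq _ = ⊥-elim (odd (divides (2 ℕ.+ k) (trans (sym eq) (cong (4 ℕ.+_) (ℕₚ.*-comm 2 k)))))
odd-small (suc (suc (suc (suc (suc t))))) k odd eq ¬5≤ = ⊥-elim (¬5≤ (ℕₚ.m≤m+n 5 t))

-- For `m = 2q` the two sides of `moment-bound` differ by `q(q - 2)(q - 4) - 3`; expanding at
-- `q = 5 + r` gives positive coefficients only.
cubic-growth : ∀ r → let q = 5 ℕ.+ r; m = q ℕ.+ q in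
  m ℕ.* (m ℕ.* q) ℕ.+ 3 ℕ.* (q ℕ.* (q ℕ.* q)) ℕ.+ 4 ℕ.* m ≡
  (3 ℕ.* (m ℕ.* (q ℕ.* q)) ℕ.+ m ℕ.* q ℕ.+ m ℕ.* m ℕ.+ 3) ℕ.+ suc (r ℕ.* (r ℕ.* r) ℕ.+ 9 ℕ.* (r ℕ.* r) ℕ.+ 23 ℕ.* r ℕ.+ 11)
cubic-growth = solve 1 (λ r → let q = con 5 :+ r; m = q :+ q in
  m :* (m :* q) :+ con 3 :* (q :* (q :* q)) :+ con 4 :* m :=
  (con 3 :* (m :* (q :* q)) :+ m :* q :+ m :* m :+ con 3) :+
    (con 1 :+ (r :* (r :* r) :+ con 9 :* (r :* r) :+ con 23 :* r :+ con 11))) refl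
  where open ℕSolver.+-*-Solver

module Extensions (𝔽 : Field) (q : ℕ) (enum : Field.Carrier 𝔽 ↔ Fin q) where
  open FiniteField 𝔽 q enum
  open Geometry 𝔽 q enum
  open Arcs 𝔽 q enum
  open Envelopes 𝔽 q enum
  open Counts 𝔽 q enum

  Extends : Arc → V → Set
  Extends A P = ∀ {i j} → i ≢ j → det P (Arc.K A i) (Arc.K A j) ≢ 0#

  module _ (A : Arc) where
    open Arc A
    open TangentExistence A

    private
      tangents : ∀ i → TangentPair A i
      tangents i = proj₁ (tangentPair i)

    open module TP i = TangentPair (tangents i)
    open NormalisedTangents A tangents (λ i → proj₂ (tangentPair i)) using (quad; module SixPoints)

    OffArc : V → Set
    OffArc v = ∀ i → v ⨯ K i ≢ 0V

    -- The tangent is the line joining `v` to `K i`; a point `K j` on that line would lie on the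
    -- tangent.
    tangent⇒generic : ∀ {i j v} k → v ⨯ K i ≢ 0V → side i k ∙ v ≡ 0# → j ≢ i → det v (K i) (K j) ≢ 0#
    tangent⇒generic {i} {j} {v} k v⨯K Sv j≢i eq = v⨯K (·-≡0V (side-tangent i k j≢i) (begin
      (side i k ∙ K j) · (v ⨯ K i) ≡⟨ sym (0·-⊕ (K i ⨯ K j) (K j ⨯ v) _) ⟩
      0# · (K i ⨯ K j) ⊕ 0# · (K j ⨯ v) ⊕ (side i k ∙ K j) · (v ⨯ K i)
        ≡⟨ cong₂ (λ x y → x · (K i ⨯ K j) ⊕ y · (K j ⨯ v) ⊕ (side i k ∙ K j) · (v ⨯ K i))
             (sym (trans (∙-comm v _) Sv)) (sym (trans (∙-comm (K i) _) (side∙K≡0 i k))) ⟩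
      (v ∙ side i k) · (K i ⨯ K j) ⊕ (K i ∙ side i k) · (K j ⨯ v) ⊕ (side i k ∙ K j) · (v ⨯ K i)
        ≡⟨ cong (λ x → (v ∙ side i k) · (K i ⨯ K j) ⊕ (K i ∙ side i k) · (K j ⨯ v) ⊕ x · (v ⨯ K i)) (∙-comm _ (K j)) ⟩
      (v ∙ side i k) · (K i ⨯ K j) ⊕ (K i ∙ side i k) · (K j ⨯ v) ⊕ (K j ∙ side i k) · (v ⨯ K i)
        ≡⟨ sym (frame v (K i) (K j) (side i k)) ⟩
      det (K j) v (K i) · side i k ≡⟨ cong (_· side i k) (trans (det-cyclic (K j) v (K i)) eq) ⟩
      0# · side i k ≡⟨ 0· (side i k) ⟩
      0V ∎))
      where open ≡-Reasoning

    quad⇒generic : ∀ {i j v} → v ⨯ K i ≢ 0V → quad i v ≡ 0# → j ≢ i → det v (K i) (K j) ≢ 0#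
    quad⇒generic {i} off eq with *-zero-cases eq
    ... | inj₁ Tv = tangent⇒generic zero off Tv
    ... | inj₂ Uv = tangent⇒generic (suc zero) off Uv

    -- `sixth-tangent` is applied to each remaining point in turn. Its genericity condition is
    -- automatic, because any two of the six indices include one whose line to `v` is already a
    -- tangent.
    five-tangents⇒extends : ∀ {v} → OffArc v → (φ : Fin 5 → Fin q) → (∀ {a b} → φ a ≡ φ b → a ≡ b) →
      (∀ a → quad (φ a) v ≡ 0#) → Extends A v
    five-tangents⇒extends {v} off φ φ-injective tangent {i} i≢j = quad⇒generic (off i) (all-tangent i) (i≢j ∘ sym)
      where
      all-tangent : ∀ x → quad x v ≡ 0#
      all-tangent x with any? (λ a → φ a ≟F x)
      ... | yes (a , refl) = tangent a
      ... | no x∉φ = SixPoints.sixth-tangent φ′ φ′-injective v generic zero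
              (λ { zero ne → ⊥-elim (ne refl) ; (suc a) _ → tangent a })
        where
        φ′ : Fin 6 → Fin q
        φ′ zero = x
        φ′ (suc a) = φ a
        φ′-injective : ∀ {a b} → φ′ a ≡ φ′ b → a ≡ b
        φ′-injective {zero} {zero} eq = refl
        φ′-injective {zero} {suc b} eq = ⊥-elim (x∉φ (b , sym eq))
        φ′-injective {suc a} {zero} eq = ⊥-elim (x∉φ (a , eq))
        φ′-injective {suc a} {suc b} eq = cong suc (φ-injective eq)
        generic : ∀ {a b} → a ≢ b → det (K (φ′ a)) (K (φ′ b)) v ≢ 0#
        generic {zero} {zero} a≢b _ = a≢b refl
        generic {suc a} {b} a≢b eq = quad⇒generic (off (φ a)) (tangent a) (λ e → a≢b (φ′-injective {suc a} {b} (sym e)))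
          (trans (det-cyclic v _ _) eq)
        generic {zero} {suc b} a≢b eq = quad⇒generic (off (φ b)) (tangent b) (λ e → a≢b (φ′-injective {zero} {suc b} e))
          (trans (det-swap₂₃ v _ _) (trans (cong -_ (trans (det-cyclic v _ _) eq)) (solve 0 (:- :0 := :0) refl)))

    private
      member : Fin q ⊎ Fin q → V
      member = [ T , U ]′

      S : Fin (q ℕ.+ q) → V
      S a = member (splitAt q a)

      member≢0 : ∀ s → member s ≢ 0V
      member≢0 (inj₁ i) = T≢0V i
      member≢0 (inj₂ i) = U≢0V i

      T⨯U≢0 : ∀ i → T i ⨯ U i ≢ 0V
      T⨯U≢0 i eq = K≢0 i (·-≡0V (ρ≢0 i) (trans (sym (T⨯U≡ρK i)) eq))

      sides-independent : ∀ {i j} k l → i ≢ j → side i k ⨯ side j l ≢ 0V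
      sides-independent {i} {j} k l i≢j eq = *-≢0 (side-tangent i k (i≢j ∘ sym)) (side-tangent j l i≢j) (begin
        (side i k ∙ K j) * (side j l ∙ K i)
          ≡⟨ solve 2 (λ x y → x := x :+ :- (y :* :0)) refl ((side i k ∙ K j) * (side j l ∙ K i)) (side j l ∙ K j) ⟩
        (side i k ∙ K j) * (side j l ∙ K i) + - ((side j l ∙ K j) * 0#)
          ≡⟨ cong (λ x → (side i k ∙ K j) * (side j l ∙ K i) + - ((side j l ∙ K j) * x)) (sym (side∙K≡0 i k)) ⟩
        (side i k ∙ K j) * (side j l ∙ K i) + - ((side j l ∙ K j) * (side i k ∙ K i)) ≡⟨ sym (binet _ _ (K j) (K i)) ⟩
        (side i k ⨯ side j l) ∙ (K j ⨯ K i) ≡⟨ cong (_∙ (K j ⨯ K i)) eq ⟩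
        0V ∙ (K j ⨯ K i) ≡⟨ 0V-∙ _ ⟩
        0# ∎)
        where open ≡-Reasoning

      ⨯-anti-≡0 : ∀ {X Y} → X ⨯ Y ≡ 0V → Y ⨯ X ≡ 0V
      ⨯-anti-≡0 {X} {Y} eq = trans (⨯-anti Y X) (trans (cong ((- 1#) ·_) eq) (·-0V (- 1#)))

      members-independent : ∀ {s s′} → s ≢ s′ → member s ⨯ member s′ ≢ 0V
      members-independent {inj₁ i} {inj₁ j} ne = sides-independent zero zero (λ { refl → ne refl })
      members-independent {inj₂ i} {inj₂ j} ne = sides-independent (suc zero) (suc zero) (λ { refl → ne refl })
      members-independent {inj₁ i} {inj₂ j} ne with i ≟F j
      ... | yes refl = T⨯U≢0 i
      ... | no i≢j = sides-independent zero (suc zero) i≢j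
      members-independent {inj₂ i} {inj₁ j} ne with i ≟F j
      ... | yes refl = λ eq → T⨯U≢0 i (⨯-anti-≡0 eq)
      ... | no i≢j = sides-independent (suc zero) zero i≢j

      S-independent : ∀ {a b} → a ≢ b → S a ⨯ S b ≢ 0V
      S-independent {a} {b} a≢b = members-independent {splitAt q a} {splitAt q b} λ e →
        a≢b (splitAt-injective q e)

    open Family S (λ a → member≢0 (splitAt q a)) S-independent

    private
      τᵢ : Fin q → V → ℕ
      τᵢ i v = zeros (T i) v ℕ.+ zeros (U i) v

      τ≡∑ : ∀ v → τ v ≡ #∑ (λ i → τᵢ i v)
      τ≡∑ v = trans (#∑-splitAt q (λ s → zeros (member s) v)) (sym (#∑-+ (λ i → zeros (T i) v) (λ i → zeros (U i) v)))

      off⇒¬both : ∀ {i v} → v ⨯ K i ≢ 0V → T i ∙ v ≡ 0# → U i ∙ v ≢ 0#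
      off⇒¬both {i} off Tv Uv = off (parallel⇒⨯≡0 (proj₂ (kernel i Tv Uv)))

      τᵢ-quad : ∀ {i v} → v ⨯ K i ≢ 0V → τᵢ i v ≡ χ (quad i v ≟ 0#)
      τᵢ-quad {i} {v} off with T i ∙ v ≟ 0# | U i ∙ v ≟ 0#
      ... | yes Tv | yes Uv = ⊥-elim (off⇒¬both off Tv Uv)
      ... | yes Tv | no _ = sym (χ-yes (quad i v ≟ 0#) (trans (cong (_* (U i ∙ v)) Tv) (zeroˡ _)))
      ... | no _ | yes Uv = sym (χ-yes (quad i v ≟ 0#) (trans (cong ((T i ∙ v) *_) Uv) (zeroʳ _)))
      ... | no Tv | no Uv = sym (χ-no (quad i v ≟ 0#) (*-≢0 Tv Uv))

      joined : V → Fin q → Fin q → ℕ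
      joined v i j = χ (det v (K i) (K j) ≟ 0#)

      joined-symmetric : ∀ v i j → joined v i j ≡ joined v j i
      joined-symmetric v i j = χ-cong (det v (K i) (K j) ≟ 0#) (det v (K j) (K i) ≟ 0#) (flip i j) (flip j i)
        where
        flip : ∀ i j → det v (K i) (K j) ≡ 0# → det v (K j) (K i) ≡ 0#
        flip i j eq = trans (det-swap₂₃ v (K j) (K i)) (trans (cong -_ eq) (solve 0 (:- :0 := :0) refl))

      joined-self : ∀ v i → joined v i i ≡ 1
      joined-self v i = χ-yes (det v (K i) (K i) ≟ 0#) (det-XYY v (K i))

      tangent-row : ∀ {i v} k → v ⨯ K i ≢ 0V → side i k ∙ v ≡ 0# → #∑ (joined v i) ≡ 1
      tangent-row {i} {v} k off Sv = trans (#∑-single (joined v i) i λ j j≢i →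
        χ-no (det v (K i) (K j) ≟ 0#) (tangent⇒generic k off Sv j≢i)) (joined-self v i)

      -- The line from `v` to `K i` is a secant, and the row counts its two arc points `K i` and
      -- `K j`.
      secant-row : ∀ {i v} → T i ∙ v ≢ 0# → U i ∙ v ≢ 0# → #∑ (joined v i) ≡ 2
      secant-row {i} {v} Tv Uv with secant i Tv Uv
      ... | j , j≢i , TvUv = trans (#∑-cong entry) (trans (#∑-+ (λ l → χ (l ≟F i)) (λ l → χ (l ≟F j))) (cong₂ ℕ._+_ (one i) (one j)))
        where
        one : ∀ i → #∑ (λ l → χ (l ≟F i)) ≡ 1
        one i = trans (#∑-single (λ l → χ (l ≟F i)) i λ l l≢i → χ-no (l ≟F i) l≢i) (χ-yes (i ≟F i) refl)
        bracket-v : ∀ l → (T i ∙ v) * (U i ∙ K l) + - ((U i ∙ v) * (T i ∙ K l)) ≡ - (ρ i * det v (K i) (K l))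
        bracket-v l = trans (bracket i v (K l)) (trans (cong (ρ i *_) (det-swap₁₂ (K i) v (K l)))
          (solve 2 (λ r d → r :* (:- d) := :- (r :* d)) refl (ρ i) (det v (K i) (K l))))
        on-secant : det v (K i) (K j) ≡ 0#
        on-secant = *-≡0 (ρ≢0 i) (trans (solve 1 (λ x → x := :- (:- x)) refl (ρ i * det v (K i) (K j))) (trans (cong -_ (trans (sym (bracket-v j))
          (trans (cong₂ (λ x y → x * (U i ∙ K j) + - ((U i ∙ v) * y)) TvUv (sym (ratio-*U i j≢i)))
            (solve 3 (λ r u w → (r :* u) :* w :+ :- (u :* (r :* w)) := :0) refl (ratio i j) (U i ∙ v) (U i ∙ K j)))))
          (solve 0 (:- :0 := :0) refl)))
        off-secant : ∀ {l} → l ≢ i → det v (K i) (K l) ≡ 0# → l ≡ j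
        off-secant {l} l≢i eq = ratio-injective i (*-cancelˡ Uv (*-cancelˡ (U-tangent i l≢i) (begin
          (U i ∙ K l) * ((U i ∙ v) * ratio i l) ≡⟨ solve 3 (λ w u r → w :* (u :* r) := u :* (r :* w)) refl (U i ∙ K l) (U i ∙ v) (ratio i l) ⟩
          (U i ∙ v) * (ratio i l * (U i ∙ K l)) ≡⟨ cong ((U i ∙ v) *_) (ratio-*U i l≢i) ⟩
          (U i ∙ v) * (T i ∙ K l) ≡⟨ sym (x-y≡0⇒x≡y (trans (bracket-v l) (trans (cong (λ d → - (ρ i * d)) eq)
                                       (solve 1 (λ r → :- (r :* :0) := :0) refl (ρ i))))) ⟩
          (T i ∙ v) * (U i ∙ K l) ≡⟨ cong (_* (U i ∙ K l)) TvUv ⟩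
          (ratio i j * (U i ∙ v)) * (U i ∙ K l) ≡⟨ solve 3 (λ w u r → (r :* u) :* w := w :* (u :* r)) refl (U i ∙ K l) (U i ∙ v) (ratio i j) ⟩
          (U i ∙ K l) * ((U i ∙ v) * ratio i j) ∎)))
          where open ≡-Reasoning
        entry : ∀ l → joined v i l ≡ χ (l ≟F i) ℕ.+ χ (l ≟F j)
        entry l with l ≟F i | l ≟F j
        ... | yes refl | yes refl = ⊥-elim (j≢i refl)
        ... | yes refl | no _ = joined-self v i
        ... | no _ | yes refl = χ-yes (det v (K i) (K j) ≟ 0#) on-secant
        ... | no l≢i | no l≢j = χ-no (det v (K i) (K l) ≟ 0#) (l≢j ∘ off-secant l≢i)

      -- `joined` always counts `K i` itself. The second unit is either the tangent through `v` or
      -- the other arc point of the secant.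
      row : ∀ {i v} → v ⨯ K i ≢ 0V → τᵢ i v ℕ.+ #∑ (joined v i) ≡ 2
      row {i} {v} off with T i ∙ v ≟ 0# | U i ∙ v ≟ 0#
      ... | yes Tv | yes Uv = ⊥-elim (off⇒¬both off Tv Uv)
      ... | yes Tv | no _ = cong suc (tangent-row zero off Tv)
      ... | no _ | yes Uv = cong suc (tangent-row (suc zero) off Uv)
      ... | no Tv | no Uv = secant-row Tv Uv

    -- Summing `row` over the arc gives `q + q`, of which the symmetric matrix `joined`, having unit
    -- diagonal, takes `q` plus an even number.
    τ-parity : ∀ {v} → OffArc v → ∃[ k ] (τ v ℕ.+ 2 ℕ.* k ≡ q)
    τ-parity {v} off with #∑-symmetric (joined v) (joined-symmetric v)
    ... | k , eq = k , ℕₚ.+-cancelʳ-≡ q _ _ (begin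
      τ v ℕ.+ 2 ℕ.* k ℕ.+ q ≡⟨ trans (ℕₚ.+-assoc (τ v) _ q) (cong (τ v ℕ.+_) (ℕₚ.+-comm (2 ℕ.* k) q)) ⟩
      τ v ℕ.+ (q ℕ.+ 2 ℕ.* k) ≡⟨ cong (λ x → τ v ℕ.+ (x ℕ.+ 2 ℕ.* k))
        (sym (trans (#∑-cong (joined-self v)) (trans (#∑-const q 1) (ℕₚ.*-identityʳ q)))) ⟩
      τ v ℕ.+ (#∑ (λ i → joined v i i) ℕ.+ 2 ℕ.* k) ≡⟨ cong₂ ℕ._+_ (τ≡∑ v) (sym eq) ⟩
      #∑ (λ i → τᵢ i v) ℕ.+ #∑ (λ i → #∑ (joined v i)) ≡⟨ sym (#∑-+ (λ i → τᵢ i v) (λ i → #∑ (joined v i))) ⟩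
      #∑ (λ i → τᵢ i v ℕ.+ #∑ (joined v i)) ≡⟨ #∑-cong (λ i → row (off i)) ⟩
      #∑ {q} (λ _ → 2) ≡⟨ trans (#∑-const q 2) (trans (ℕₚ.*-comm q 2) (cong (q ℕ.+_) (ℕₚ.+-identityʳ q))) ⟩
      q ℕ.+ q ∎)
      where open ≡-Reasoning

    τ-on-arc : ∀ {v i} → v ≢ 0V → v ⨯ K i ≡ 0V → τ v ≡ 2
    τ-on-arc {v} {i} v≢0 v⨯K with ⨯≡0⇒parallel (K≢0 i) v⨯K
    ... | s , v≡ = trans (τ≡∑ v) (trans (#∑-single (λ j → τᵢ j v) i others)
        (cong₂ ℕ._+_ (χ-yes (T i ∙ v ≟ 0#) (on zero)) (χ-yes (U i ∙ v ≟ 0#) (on (suc zero)))))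
      where
      s≢0 : s ≢ 0#
      s≢0 refl = v≢0 (trans v≡ (0· (K i)))
      S∙v : ∀ S → S ∙ v ≡ s * (S ∙ K i)
      S∙v S = trans (cong (S ∙_) v≡) (∙-·ʳ S s (K i))
      on : ∀ k → side i k ∙ v ≡ 0#
      on k = trans (S∙v (side i k)) (trans (cong (s *_) (side∙K≡0 i k)) (zeroʳ s))
      others : ∀ j → j ≢ i → τᵢ j v ≡ 0
      others j j≢i = cong₂ ℕ._+_ (χ-no (T j ∙ v ≟ 0#) (off zero)) (χ-no (U j ∙ v ≟ 0#) (off (suc zero)))
        where
        off : ∀ k → side j k ∙ v ≢ 0#
        off k e = *-≢0 s≢0 (side-tangent j k (j≢i ∘ sym)) (trans (sym (S∙v (side j k))) e)

    OffArc? : ∀ v → Dec (OffArc v)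
    OffArc? v = all? (λ i → ¬? (v ⨯ K i ≟V 0V))

    private
      Rich : V → Set
      Rich v = OffArc v × 5 ℕ.≤ τ v

      Rich? : Dec (∃[ x ] ∃[ y ] ∃[ z ] Rich (vector x y z))
      Rich? = any? λ x → any? λ y → any? λ z → OffArc? (vector x y z) ×-dec (5 ℕₚ.≤? τ (vector x y z))

      poor⇒small : ¬ (2 ∣ q) → (∀ v → ¬ Rich v) → ∀ v → v ≢ 0V → τ v ℕ.* τ v ℕ.+ 3 ℕ.≤ 4 ℕ.* τ v
      poor⇒small odd poor v v≢0 with OffArc? v
      ... | yes off = let (k , eq) = τ-parity off in odd-small (τ v) k odd eq (λ 5≤τ → poor v (off , 5≤τ))
      ... | no ¬off with ¬∀⟶∃¬ q (λ i → v ⨯ K i ≢ 0V) (λ i → ¬? (v ⨯ K i ≟V 0V)) ¬off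
      ...   | i , ¬¬on = subst (λ t → t ℕ.* t ℕ.+ 3 ℕ.≤ 4 ℕ.* t)
                (sym (τ-on-arc v≢0 (decidable-stable (v ⨯ K i ≟V 0V) ¬¬on))) (ℕₚ.m≤m+n 7 1)

      rich-vector : ¬ (2 ∣ q) → 5 ℕ.≤ q → ∃[ v ] Rich v
      rich-vector odd 5≤q with Rich?
      ... | yes (x , y , z , rich) = vector x y z , rich
      ... | no none = ⊥-elim (impossible (ℕₚ.m+[n∸m]≡n 5≤q) (moment-bound (poor⇒small odd λ v rich →
              none (ix (v₀ v) , ix (v₁ v) , ix (v₂ v) , subst Rich (sym (vec-cong (el-ix (v₀ v)) (el-ix (v₁ v)) (el-ix (v₂ v)))) rich))))
        where
        impossible : ∀ {q r} → 5 ℕ.+ r ≡ q → let m = q ℕ.+ q in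
          ¬ (m ℕ.* (m ℕ.* q) ℕ.+ 3 ℕ.* (q ℕ.* (q ℕ.* q)) ℕ.+ 4 ℕ.* m ℕ.≤ 3 ℕ.* (m ℕ.* (q ℕ.* q)) ℕ.+ m ℕ.* q ℕ.+ m ℕ.* m ℕ.+ 3)
        impossible {r = r} refl le = ℕₚ.m+1+n≰m _ (ℕₚ.≤-trans (ℕₚ.≤-reflexive (sym (cubic-growth r))) le)

    extension-≥5 : ¬ (2 ∣ q) → 5 ℕ.≤ q → ∃[ P ] (P ≢ 0V × Extends A P)
    extension-≥5 odd 5≤q with rich-vector odd 5≤q
    ... | v , off , 5≤τ with select 5 (λ i → quad i v ≟ 0#)
          (ℕₚ.≤-trans 5≤τ (ℕₚ.≤-reflexive (trans (τ≡∑ v) (#∑-cong λ i → τᵢ-quad (off i)))))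
    ...   | φ , φ-injective , tangent = v , v≢0 , five-tangents⇒extends off φ φ-injective tangent
      where
      v≢0 : v ≢ 0V
      v≢0 refl = off (φ zero) (0V-⨯ (K (φ zero)))

    -- The moment bound is no contradiction for `q = 3`. The three points form a basis, and against
    -- two of them their sum has the determinant of the basis, up to sign.
    extension-3 : ∀ {o p r : Fin q} → o ≢ p → p ≢ r → o ≢ r → (∀ i → i ≡ o ⊎ i ≡ p ⊎ i ≡ r) →
      ∃[ P ] (P ≢ 0V × Extends A P)
    extension-3 {o} {p} {r} o≢p p≢r o≢r cover = P , ∙-≢0⇒≢0V (extends (cover o) (cover p) o≢p) , λ {i} {j} → extends (cover i) (cover j)
      where
      P : V
      P = K o ⊕ K p ⊕ K r
      D : Fin q → Fin q → Fin q → Carrier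
      D x i j = det (K x) (K i) (K j)
      split : ∀ i j → det P (K i) (K j) ≡ D o i j + D p i j + D r i j
      split i j = trans (∙-⊕ˡ _ (K r) _) (cong (_+ D r i j) (∙-⊕ˡ (K o) (K p) _))
      one : ∀ {i j x y z} → det P (K i) (K j) ≡ x + y + z → x ≡ 0# → y ≡ 0# → z ≢ 0# → det P (K i) (K j) ≢ 0#
      one {z = z} e refl refl z≢0 eq = z≢0 (trans (solve 1 (λ z → z := :0 :+ :0 :+ z) refl z) (trans (sym e) eq))
      swap : ∀ a b c → a + b + c ≡ a + c + b
      swap = solve 3 (λ a b c → a :+ b :+ c := a :+ c :+ b) refl
      rotate : ∀ a b c → a + b + c ≡ b + c + a
      rotate = solve 3 (λ a b c → a :+ b :+ c := b :+ c :+ a) refl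
      extends : ∀ {i j} → i ≡ o ⊎ i ≡ p ⊎ i ≡ r → j ≡ o ⊎ j ≡ p ⊎ j ≡ r → i ≢ j → det P (K i) (K j) ≢ 0#
      extends (inj₁ refl) (inj₁ refl) ne = ⊥-elim (ne refl)
      extends (inj₂ (inj₁ refl)) (inj₂ (inj₁ refl)) ne = ⊥-elim (ne refl)
      extends (inj₂ (inj₂ refl)) (inj₂ (inj₂ refl)) ne = ⊥-elim (ne refl)
      extends (inj₁ refl) (inj₂ (inj₁ refl)) ne = one (split o p) (det-XXY _ _) (det-XYX _ _) (indep₃ (o≢r ∘ sym) o≢p (p≢r ∘ sym))
      extends (inj₂ (inj₁ refl)) (inj₁ refl) ne = one (split p o) (det-XYX _ _) (det-XXY _ _) (indep₃ (p≢r ∘ sym) ne (o≢r ∘ sym))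
      extends (inj₁ refl) (inj₂ (inj₂ refl)) ne = one (trans (split o r) (swap _ _ _)) (det-XXY _ _) (det-XYX _ _) (indep₃ (o≢p ∘ sym) o≢r p≢r)
      extends (inj₂ (inj₂ refl)) (inj₁ refl) ne = one (trans (split r o) (swap _ _ _)) (det-XYX _ _) (det-XXY _ _) (indep₃ p≢r ne (o≢p ∘ sym))
      extends (inj₂ (inj₁ refl)) (inj₂ (inj₂ refl)) ne = one (trans (split p r) (rotate _ _ _)) (det-XXY _ _) (det-XYX _ _) (indep₃ o≢p p≢r o≢r)
      extends (inj₂ (inj₂ refl)) (inj₂ (inj₁ refl)) ne = one (trans (split r p) (rotate _ _ _)) (det-XYX _ _) (det-XXY _ _) (indep₃ o≢r ne o≢p)

-- Arcs on conics and AS(q)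

module Conics (𝔽 : Field) (q : ℕ) (enum : Field.Carrier 𝔽 ↔ Fin q)
    (2≢0 : Field._+_ 𝔽 (Field.1# 𝔽) (Field.1# 𝔽) ≢ Field.0# 𝔽) where
  open FiniteField 𝔽 q enum
  open Geometry 𝔽 q enum
  open Arcs 𝔽 q enum
  open Models 𝔽 q enum

  2# : Carrier
  2# = 1# + 1#

  -- The arc lies on the conic b² = 4ac, parametrised by (σ², 2σ, 1).
  record ConicForm (A : Arc) : Set where
    open Arc A
    field
      a b c : V
      σ : Fin q → Carrier
      σ-injective : ∀ {i j} → σ i ≡ σ j → i ≡ j
      c≢0 : ∀ i → c ∙ K i ≢ 0#
      aK : ∀ i → a ∙ K i ≡ (c ∙ K i) * (σ i * σ i)
      bK : ∀ i → b ∙ K i ≡ (c ∙ K i) * (2# * σ i)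

    -- `Tᶜ i` is the tangent to the conic at `K i`. `Uᶜ i`, minus the derivative of `Tᶜ` in the
    -- parameter, joins `K i` to the conic point `b = c = 0`, whose parameter is infinity.
    Tᶜ Uᶜ : Fin q → V
    Tᶜ i = a ⊕ (- σ i) · b ⊕ (σ i * σ i) · c
    Uᶜ i = b ⊕ (- (2# * σ i)) · c

    Tᶜ-∙ : ∀ i X → Tᶜ i ∙ X ≡ a ∙ X + - σ i * (b ∙ X) + (σ i * σ i) * (c ∙ X)
    Tᶜ-∙ i X = trans (∙-⊕ˡ _ _ X) (cong₂ _+_ (trans (∙-⊕ˡ _ _ X) (cong (a ∙ X +_) (∙-·ˡ _ b X))) (∙-·ˡ _ c X))

    Uᶜ-∙ : ∀ i X → Uᶜ i ∙ X ≡ b ∙ X + - (2# * σ i) * (c ∙ X)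
    Uᶜ-∙ i X = trans (∙-⊕ˡ _ _ X) (cong (b ∙ X +_) (∙-·ˡ _ c X))

    TᶜK : ∀ i j → Tᶜ i ∙ K j ≡ (c ∙ K j) * ((σ j + - σ i) * (σ j + - σ i))
    TᶜK i j = trans (Tᶜ-∙ i (K j)) (trans (cong₂ (λ x y → x + - σ i * y + (σ i * σ i) * (c ∙ K j)) (aK j) (bK j))
      (solve 3 (λ s t g → g :* (t :* t) :+ (:- s) :* (g :* ((:1 :+ :1) :* t)) :+ (s :* s) :* g :=
        g :* ((t :+ :- s) :* (t :+ :- s))) refl (σ i) (σ j) (c ∙ K j)))

    UᶜK : ∀ i j → Uᶜ i ∙ K j ≡ (c ∙ K j) * (2# * (σ j + - σ i))
    UᶜK i j = trans (Uᶜ-∙ i (K j)) (trans (cong (_+ - (2# * σ i) * (c ∙ K j)) (bK j))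
      (solve 3 (λ s t g → g :* ((:1 :+ :1) :* t) :+ (:- ((:1 :+ :1) :* s)) :* g :=
        g :* ((:1 :+ :1) :* (t :+ :- s))) refl (σ i) (σ j) (c ∙ K j)))

    σ-≢ : ∀ {i j} → j ≢ i → σ j + - σ i ≢ 0#
    σ-≢ j≢i eq = j≢i (σ-injective (x-y≡0⇒x≡y eq))

    Tᶜ-tangent : ∀ {i j} → j ≢ i → Tᶜ i ∙ K j ≢ 0#
    Tᶜ-tangent {i} {j} j≢i eq = *-≢0 (c≢0 j) (*-≢0 (σ-≢ j≢i) (σ-≢ j≢i)) (trans (sym (TᶜK i j)) eq)

    Uᶜ-tangent : ∀ {i j} → j ≢ i → Uᶜ i ∙ K j ≢ 0#
    Uᶜ-tangent {i} {j} j≢i eq = *-≢0 (c≢0 j) (*-≢0 2≢0 (σ-≢ j≢i)) (trans (sym (UᶜK i j)) eq)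

    Tᶜ⨯Uᶜ≢0 : ∀ i → Tᶜ i ⨯ Uᶜ i ≢ 0V
    -- The parameters `σ i + 1` and `σ i - 1` are attained because `σ` is onto. At these two points
    -- the bracket of the functionals is `- 4gh`, nonzero since 2 is invertible.
    Tᶜ⨯Uᶜ≢0 i eq = -‿≢0 (*-≢0 (*-≢0 (c≢0 j) (c≢0 l)) (*-≢0 (-‿≢0 2≢0) (-‿≢0 2≢0))) (sym (begin
      0# ≡⟨ sym (0V-∙ _) ⟩
      0V ∙ (K j ⨯ K l) ≡⟨ cong (_∙ (K j ⨯ K l)) (sym eq) ⟩
      (Tᶜ i ⨯ Uᶜ i) ∙ (K j ⨯ K l) ≡⟨ binet (Tᶜ i) (Uᶜ i) (K j) (K l) ⟩
      (Tᶜ i ∙ K j) * (Uᶜ i ∙ K l) + - ((Uᶜ i ∙ K j) * (Tᶜ i ∙ K l))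
        ≡⟨ cong₂ (λ x y → x + - y) (cong₂ _*_ (TᶜK i j) (UᶜK i l)) (cong₂ _*_ (UᶜK i j) (TᶜK i l)) ⟩
      (g * ((σ j + - σ i) * (σ j + - σ i))) * (h * (2# * (σ l + - σ i))) +
        - ((g * (2# * (σ j + - σ i))) * (h * ((σ l + - σ i) * (σ l + - σ i))))
        ≡⟨ cong₂ (λ x y → (g * ((x + - σ i) * (x + - σ i))) * (h * (2# * (y + - σ i))) +
             - ((g * (2# * (x + - σ i))) * (h * ((y + - σ i) * (y + - σ i))))) σj σl ⟩
      (g * ((σ i + 1# + - σ i) * (σ i + 1# + - σ i))) * (h * (2# * (σ i + - 1# + - σ i))) +
        - ((g * (2# * (σ i + 1# + - σ i))) * (h * ((σ i + - 1# + - σ i) * (σ i + - 1# + - σ i))))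
        ≡⟨ solve 3 (λ s g h → (g :* ((s :+ :1 :+ :- s) :* (s :+ :1 :+ :- s))) :* (h :* ((:1 :+ :1) :* (s :+ :- :1 :+ :- s))) :+
             :- ((g :* ((:1 :+ :1) :* (s :+ :1 :+ :- s))) :* (h :* ((s :+ :- :1 :+ :- s) :* (s :+ :- :1 :+ :- s)))) :=
             :- ((g :* h) :* ((:- (:1 :+ :1)) :* (:- (:1 :+ :1))))) refl (σ i) g h ⟩
      - ((g * h) * (- 2# * - 2#)) ∎))
      where
      open ≡-Reasoning
      hit : ∀ x → ∃[ j ] (σ j ≡ x)
      hit = injective⇒onto σ σ-injective
      j l : Fin q
      j = proj₁ (hit (σ i + 1#))
      l = proj₁ (hit (σ i + - 1#))
      σj : σ j ≡ σ i + 1#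
      σj = proj₂ (hit (σ i + 1#))
      σl : σ l ≡ σ i + - 1#
      σl = proj₂ (hit (σ i + - 1#))
      g h : Carrier
      g = c ∙ K j
      h = c ∙ K l

    centre-zero : ∀ i x → (c ∙ K i) * (x * (σ i + - σ i)) ≡ 0#
    centre-zero i x = solve 3 (λ g x s → g :* (x :* (s :+ :- s)) := :0) refl (c ∙ K i) x (σ i)

    conic-tangents : ∀ i → TangentPair A i
    conic-tangents i = record
      { T = Tᶜ i ; U = Uᶜ i ; ρ = proj₁ parallel
      ; ρ≢0 = λ ρ≡0 → Tᶜ⨯Uᶜ≢0 i (trans (proj₂ parallel) (trans (cong (_· K i) ρ≡0) (0· (K i))))
      ; T⨯U≡ρK = proj₂ parallel ; T-tangent = Tᶜ-tangent ; U-tangent = Uᶜ-tangent }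
      where
      parallel : ∃[ s ] (Tᶜ i ⨯ Uᶜ i ≡ s · K i)
      -- Both functionals vanish at `K i`, so the Lagrange expansion of `K i ⨯ (Tᶜ i ⨯ Uᶜ i)` is
      -- zero.
      parallel = ⨯≡0⇒parallel (K≢0 i) (anti-zero (trans (lagrange (K i) (Tᶜ i) (Uᶜ i))
        (trans (cong₂ (λ x y → x · Tᶜ i ⊕ (- y) · Uᶜ i) (trans (∙-comm _ _) (trans (UᶜK i i) (centre-zero i 2#)))
          (trans (∙-comm _ _) (trans (TᶜK i i) (centre-zero i _)))) (0·⊕-0· (Tᶜ i) (Uᶜ i)))))
        where
        anti-zero : ∀ {X Y} → X ⨯ Y ≡ 0V → Y ⨯ X ≡ 0V
        anti-zero {X} {Y} eq = trans (⨯-anti Y X) (trans (cong ((- 1#) ·_) eq) (·-0V (- 1#)))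

    module AS = ASq 𝔽

    open Model A conic-tangents renaming (_I_ to _Iₘ_)

    -- The tangents are chosen so that the curves (iii) of AS(q) are exactly the incidence of points with affine points.
    AS-isomorphism : Fin q → Isomorphism model AS.structure
    AS-isomorphism o = record
      { fP = fP ; fL = fL
      ; fP-resp = λ _ _ → cong fP ; fP-inj = fP-inj ; fP-surj = fP-surj
      ; fL-resp = λ _ _ → cong fL ; fL-inj = fL-inj ; fL-surj = fL-surj
      ; inc-pres = pres ; inc-refl = refl′ }
      where
      fP : Pt → AS.Point
      fP (i , y , z) = y , z , σ i
      fP-inj : ∀ P Q → fP P ≡ fP Q → P ≡ Q
      fP-inj (i , y , z) (j , y′ , z′) eq with σ-injective (cong (proj₂ ∘ proj₂) eq)
      ... | refl = cong₂ (λ y z → i , y , z) (cong proj₁ eq) (cong (proj₁ ∘ proj₂) eq)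
      fP-surj : ∀ P → ∃[ Q ] (fP Q ≡ P)
      fP-surj (x , y , z) = (proj₁ hit , x , y) , cong (λ z → x , y , z) (proj₂ hit)
        where hit = injective⇒onto σ σ-injective z
      fL : Ln → AS.Line
      fL (inj₁ X) = inj₂ (inj₂ (a ∙ X , b ∙ X , c ∙ X))
      fL (inj₂ (i , zero , s)) = inj₂ (inj₁ (s , σ i))
      fL (inj₂ (i , suc zero , s)) = inj₁ (s , σ i)
      T-∙ : ∀ i X → Tᶜ i ∙ X ≡ (c ∙ X) * (σ i * σ i) + - ((b ∙ X) * σ i) + a ∙ X
      T-∙ i X = trans (Tᶜ-∙ i X) (solve 4 (λ s a b c → a :+ (:- s) :* b :+ (s :* s) :* c := c :* (s :* s) :+ :- (b :* s) :+ a)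
        refl (σ i) (a ∙ X) (b ∙ X) (c ∙ X))
      U-∙ : ∀ i X → Uᶜ i ∙ X ≡ - (AS.two * (c ∙ X) * σ i) + b ∙ X
      U-∙ i X = trans (Uᶜ-∙ i X) (solve 3 (λ s b c → b :+ (:- ((:1 :+ :1) :* s)) :* c := :- ((:1 :+ :1) :* c :* s) :+ b)
        refl (σ i) (b ∙ X) (c ∙ X))
      pres : ∀ P L → P Iₘ L → AS._I_ (fP P) (fL L)
      pres (i , _ , _) (inj₁ X) (refl , refl) = T-∙ i X , U-∙ i X
      pres (i , _ , _) (inj₂ (_ , zero , _)) (refl , refl) = refl , refl
      pres (i , _ , _) (inj₂ (_ , suc zero , _)) (refl , refl) = refl , refl
      refl′ : ∀ P L → AS._I_ (fP P) (fL L) → P Iₘ L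
      refl′ (i , _ , _) (inj₁ X) (e₁ , e₂) = trans (T-∙ i X) (sym e₁) , trans (U-∙ i X) (sym e₂)
      refl′ (i , _ , _) (inj₂ (_ , zero , _)) (e₁ , e₂) = σ-injective e₂ , e₁
      refl′ (i , _ , _) (inj₂ (_ , suc zero , _)) (e₁ , e₂) = σ-injective e₂ , e₁
      inj₃ : ∀ {s t u s′ t′ u′} → _≡_ {A = AS.Line} (inj₂ (inj₂ (s , t , u))) (inj₂ (inj₂ (s′ , t′ , u′))) →
        s ≡ s′ × t ≡ t′ × u ≡ u′
      inj₃ refl = refl , refl , refl
      inj₂₁ : ∀ {s x t y} → _≡_ {A = AS.Line} (inj₂ (inj₁ (s , x))) (inj₂ (inj₁ (t , y))) → s ≡ t × x ≡ y
      inj₂₁ refl = refl , refl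
      inj₁′ : ∀ {s x t y} → _≡_ {A = AS.Line} (inj₁ (s , x)) (inj₁ (t , y)) → s ≡ t × x ≡ y
      inj₁′ refl = refl , refl
      at-≡ : ∀ i X Y → a ∙ X ≡ a ∙ Y → b ∙ X ≡ b ∙ Y → c ∙ X ≡ c ∙ Y → at i X ≡ at i Y
      at-≡ i X Y ea eb ec = cong₂ (λ y z → i , y , z)
        (trans (Tᶜ-∙ i X) (trans (cong₂ (λ x y → x + - σ i * y + (σ i * σ i) * (c ∙ X)) ea eb)
          (trans (cong (λ z → a ∙ Y + - σ i * (b ∙ Y) + (σ i * σ i) * z) ec) (sym (Tᶜ-∙ i Y)))))
        (trans (Uᶜ-∙ i X) (trans (cong₂ (λ x y → x + - (2# * σ i) * y) eb ec) (sym (Uᶜ-∙ i Y))))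
      fL-inj : ∀ L M → fL L ≡ fL M → L ≡ M
      fL-inj (inj₁ X) (inj₁ Y) eq with inj₃ eq
      -- The values of `a`, `b`, `c` determine the points over the parameters `0#` and `1#`, and
      -- these two determine `X`.
      ... | ea , eb , ec = cong inj₁ (two-affine {proj₁ (hit 0#)} {proj₁ (hit 1#)}
          (λ e → 0≢1 (trans (sym (proj₂ (hit 0#))) (trans (cong σ e) (proj₂ (hit 1#)))))
          (at-≡ _ X Y ea eb ec) (at-≡ _ X Y ea eb ec))
        where hit = injective⇒onto σ σ-injective
      fL-inj (inj₂ (i , zero , s)) (inj₂ (j , zero , t)) eq with inj₂₁ eq
      ... | sₜ , σᵢ = cong₂ (λ i s → inj₂ (i , zero , s)) (σ-injective σᵢ) sₜ
      fL-inj (inj₂ (i , suc zero , s)) (inj₂ (j , suc zero , t)) eq with inj₁′ eq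
      ... | sₜ , σᵢ = cong₂ (λ i s → inj₂ (i , suc zero , s)) (σ-injective σᵢ) sₜ
      fL-inj (inj₁ X) (inj₂ (_ , zero , _)) ()
      fL-inj (inj₁ X) (inj₂ (_ , suc zero , _)) ()
      fL-inj (inj₂ (_ , zero , _)) (inj₁ X) ()
      fL-inj (inj₂ (_ , suc zero , _)) (inj₁ X) ()
      fL-inj (inj₂ (_ , zero , _)) (inj₂ (_ , suc zero , _)) ()
      fL-inj (inj₂ (_ , suc zero , _)) (inj₂ (_ , zero , _)) ()
      fL-surj : ∀ L → ∃[ M ] (fL M ≡ L)
      fL-surj (inj₁ (s , x)) = inj₂ (proj₁ hit , suc zero , s) , cong (λ x → inj₁ (s , x)) (proj₂ hit)
        where hit = injective⇒onto σ σ-injective x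
      fL-surj (inj₂ (inj₁ (s , x))) = inj₂ (proj₁ hit , zero , s) , cong (λ x → inj₂ (inj₁ (s , x))) (proj₂ hit)
        where hit = injective⇒onto σ σ-injective x
      fL-surj (inj₂ (inj₂ (s , t , u))) = inj₁ X , cong₂ (λ x yz → inj₂ (inj₂ (x , yz))) aX (cong₂ _,_ bX cX)
        where
        -- At parameter `0#` the functionals `Tᶜ z` and `Uᶜ z` take the values of `a` and `b`;
        -- shifting along `K z` keeps both and adjusts the value of `c`.
        z : Fin q
        z = proj₁ (injective⇒onto σ σ-injective 0#)
        σz : σ z ≡ 0#
        σz = proj₂ (injective⇒onto σ σ-injective 0#)
        X₀ : V
        X₀ = lift z s t
        r : Carrier
        r = (u + - (c ∙ X₀)) * recip (c ∙ K z)
        X : V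
        X = X₀ ⊕ r · K z
        bX : b ∙ X ≡ t
        bX = trans (solve 2 (λ b c → b := b :+ (:- ((:1 :+ :1) :* :0)) :* c) refl (b ∙ X) (c ∙ X))
          (trans (cong (λ s → b ∙ X + - (2# * s) * (c ∙ X)) (sym σz)) (trans (sym (Uᶜ-∙ z X))
            (trans (shift-side z (suc zero) X₀ r) (U∙lift z s t))))
        aX : a ∙ X ≡ s
        aX = trans (solve 3 (λ a b c → a := a :+ (:- :0) :* b :+ (:0 :* :0) :* c) refl (a ∙ X) (b ∙ X) (c ∙ X))
          (trans (cong (λ s → a ∙ X + - s * (b ∙ X) + (s * s) * (c ∙ X)) (sym σz)) (trans (sym (Tᶜ-∙ z X))
            (trans (shift-side z zero X₀ r) (T∙lift z s t))))
        cX : c ∙ X ≡ u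
        cX = trans (shift c X₀ r z) (trans (cong (c ∙ X₀ +_) (recip-unmul (c≢0 z)))
          (solve 2 (λ x u → x :+ (u :+ :- x) := u) refl (c ∙ X₀) u))

-- Segre's theorem

module SegreTheorem (𝔽 : Field) (q : ℕ) (enum : Field.Carrier 𝔽 ↔ Fin q)
    (2≢0 : Field._+_ 𝔽 (Field.1# 𝔽) (Field.1# 𝔽) ≢ Field.0# 𝔽) where
  open FiniteField 𝔽 q enum
  open Geometry 𝔽 q enum
  open Arcs 𝔽 q enum
  open Conics 𝔽 q enum 2≢0

  -- The graph of φ over s, together with the vertical point at infinity, is a (q+1)-arc.
  module Graph (s φ : Fin q → Carrier) (s-injective : ∀ {i j} → s i ≡ s j → i ≡ j)
      (not-collinear : ∀ {i j l} → i ≢ j → j ≢ l → i ≢ l →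
        (φ l + - φ i) * (s j + - s i) ≢ (φ j + - φ i) * (s l + - s i)) where

    s-≢ : ∀ {i j} → i ≢ j → s i + - s j ≢ 0#
    s-≢ i≢j eq = i≢j (s-injective (x-y≡0⇒x≡y eq))

    slopeᵍ : Fin q → Fin q → Carrier
    slopeᵍ i j = (φ i + - φ j) * recip (s i + - s j)

    slope-* : ∀ {i j} → i ≢ j → slopeᵍ i j * (s i + - s j) ≡ φ i + - φ j
    slope-* i≢j = recip-unmul (s-≢ i≢j)

    slope-symmetric : ∀ {i j} → i ≢ j → slopeᵍ i j ≡ slopeᵍ j i
    slope-symmetric {i} {j} i≢j = *-cancelˡ (s-≢ i≢j) (trans (*-comm _ _) (trans (slope-* i≢j)
      (trans (solve 2 (λ a b → a :+ :- b := :- (b :+ :- a)) refl (φ i) (φ j))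
      (trans (cong -_ (sym (slope-* (i≢j ∘ sym))))
        (solve 3 (λ σ a b → :- (σ :* (b :+ :- a)) := (a :+ :- b) :* σ) refl (slopeᵍ j i) (s i) (s j))))))

    slope-distinct : ∀ {i j l} → i ≢ j → j ≢ l → i ≢ l → slopeᵍ i j ≢ slopeᵍ i l
    slope-distinct {i} {j} {l} i≢j j≢l i≢l eq = not-collinear i≢j j≢l i≢l (begin
      (φ l + - φ i) * (s j + - s i)
        ≡⟨ solve 4 (λ a b c d → (a :+ :- b) :* (c :+ :- d) := (b :+ :- a) :* (d :+ :- c)) refl (φ l) (φ i) (s j) (s i) ⟩
      (φ i + - φ l) * (s i + - s j) ≡⟨ cong (_* (s i + - s j)) (sym (slope-* i≢l)) ⟩
      (slopeᵍ i l * (s i + - s l)) * (s i + - s j) ≡⟨ cong (λ σ → (σ * (s i + - s l)) * (s i + - s j)) (sym eq) ⟩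
      (slopeᵍ i j * (s i + - s l)) * (s i + - s j)
        ≡⟨ solve 4 (λ σ a b c → (σ :* (a :+ :- c)) :* (a :+ :- b) := (σ :* (a :+ :- b)) :* (a :+ :- c)) refl (slopeᵍ i j) (s i) (s j) (s l) ⟩
      (slopeᵍ i j * (s i + - s j)) * (s i + - s l) ≡⟨ cong (_* (s i + - s l)) (slope-* i≢j) ⟩
      (φ i + - φ j) * (s i + - s l)
        ≡⟨ solve 4 (λ a b c d → (a :+ :- b) :* (c :+ :- d) := (b :+ :- a) :* (d :+ :- c)) refl (φ i) (φ j) (s i) (s l) ⟩
      (φ j + - φ i) * (s l + - s i) ∎)
      where open ≡-Reasoning

    -- The `q - 1` chords at a point cannot use up all `q` finite slopes. The vertical line is not
    -- among these: it is the chord to the point at infinity.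
    tangent-slope : ∀ i → ∃[ m ] (∀ {j} → j ≢ i → slopeᵍ i j ≢ m)
    tangent-slope i with predecessor i
    ... | n , q≡ with all-but q≡ i
    ...   | others , others-onto with missing (ix ∘ slopeᵍ i ∘ others) (ℕₚ.≤-reflexive (sym q≡))
    ...     | x , missed = el x , λ j≢i eq → let (y , at) = others-onto j≢i in
                missed y (trans (cong (ix ∘ slopeᵍ i) at) (trans (cong ix eq) (ix-el x)))

    m : Fin q → Carrier
    m i = proj₁ (tangent-slope i)

    private
      -- The tangent slope occupies the idle index `i`, so that each row enumerates the whole field.
      all-slopes : Fin q → Fin q → Carrier
      all-slopes i c with c ≟F i
      ... | yes _ = m i
      ... | no _ = slopeᵍ i c

      all-slopes-centre : ∀ i → all-slopes i i ≡ m i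
      all-slopes-centre i with i ≟F i
      ... | yes _ = refl
      ... | no ne = ⊥-elim (ne refl)

      all-slopes-other : ∀ {i c} → c ≢ i → all-slopes i c ≡ slopeᵍ i c
      all-slopes-other {i} {c} c≢i with c ≟F i
      ... | yes eq = ⊥-elim (c≢i eq)
      ... | no _ = refl

      all-slopes-injective : ∀ i {c d} → all-slopes i c ≡ all-slopes i d → c ≡ d
      all-slopes-injective i {c} {d} eq with c ≟F d
      ... | yes c≡d = c≡d
      ... | no c≢d with c ≟F i | d ≟F i
      ...   | yes refl | yes refl = refl
      ...   | yes refl | no d≢i = ⊥-elim (proj₂ (tangent-slope i) d≢i (sym eq))
      ...   | no c≢i | yes refl = ⊥-elim (proj₂ (tangent-slope i) c≢i eq)
      ...   | no c≢i | no d≢i = ⊥-elim (slope-distinct (c≢i ∘ sym) c≢d (d≢i ∘ sym) eq)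

      module _ {i j : Fin q} (i≢j : i ≢ j) where
        σ : Carrier
        σ = slopeᵍ i j

        -- For generic `c` this measures how far point `c` is from the line of slope `σ` through
        -- point `k`. That line is the same for `k = i` and `k = j`, so almost all factors agree,
        -- while the full product is `W * W` for every `k`.
        F : Fin q → Fin q → Carrier
        F k c = nz (σ + - all-slopes k c) * nz (s k + - s c)

        ΠF : ∀ k → Π (F k) ≡ W * W
        ΠF k = trans (Π-distrib-* (λ c → nz (σ + - all-slopes k c)) (λ c → nz (s k + - s c)))
          (cong₂ _*_ (Π-nz-translate (all-slopes k) (all-slopes-injective k) σ) (Π-nz-translate s s-injective (s k)))

        F-centre : ∀ k → σ ≢ m k → F k k ≡ σ + - m k
        F-centre k ne = trans (cong₂ (λ x y → nz (σ + - x) * y) (all-slopes-centre k) (nz-0 (-‿inverseʳ (s k))))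
          (trans (*-identityʳ _) (nz-id (λ e → ne (x-y≡0⇒x≡y e))))

        F-other : ∀ {k l} → l ≢ k → σ ≡ slopeᵍ k l → F k l ≡ s k + - s l
        F-other {k} {l} l≢k eq = trans (cong₂ _*_ (nz-0 (x≡y⇒x-y≡0 (trans eq (sym (all-slopes-other l≢k)))))
          (nz-id (s-≢ (l≢k ∘ sym)))) (*-identityˡ _)

        F-generic : ∀ {k c} → c ≢ k → σ ≢ slopeᵍ k c → F k c ≡ σ * (s k + - s c) + - (φ k + - φ c)
        F-generic {k} {c} c≢k ne = begin
          F k c ≡⟨ cong₂ _*_ (trans (cong (λ x → nz (σ + - x)) (all-slopes-other c≢k)) (nz-id (λ e → ne (x-y≡0⇒x≡y e))))
                     (nz-id (s-≢ (c≢k ∘ sym))) ⟩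
          (σ + - slopeᵍ k c) * (s k + - s c)
            ≡⟨ solve 3 (λ a b d → (a :+ :- b) :* d := a :* d :+ :- (b :* d)) refl σ (slopeᵍ k c) (s k + - s c) ⟩
          σ * (s k + - s c) + - (slopeᵍ k c * (s k + - s c)) ≡⟨ cong (λ x → σ * (s k + - s c) + - x) (slope-* (c≢k ∘ sym)) ⟩
          σ * (s k + - s c) + - (φ k + - φ c) ∎
          where open ≡-Reasoning

        F-agree : ∀ c → c ≢ i → c ≢ j → F i c ≡ F j c
        F-agree c c≢i c≢j = begin
          F i c ≡⟨ F-generic c≢i (slope-distinct i≢j (c≢j ∘ sym) (c≢i ∘ sym)) ⟩
          σ * (s i + - s c) + - (φ i + - φ c)
            ≡⟨ solve 6 (λ σ a b c x y → σ :* (a :+ :- c) :+ :- x := (σ :* (a :+ :- b) :+ :- (x :+ :- y)) :+ (σ :* (b :+ :- c) :+ :- y))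
                 refl σ (s i) (s j) (s c) (φ i + - φ c) (φ j + - φ c) ⟩
          (σ * (s i + - s j) + - ((φ i + - φ c) + - (φ j + - φ c))) + (σ * (s j + - s c) + - (φ j + - φ c))
            ≡⟨ cong (λ x → (x + - ((φ i + - φ c) + - (φ j + - φ c))) + (σ * (s j + - s c) + - (φ j + - φ c))) (slope-* i≢j) ⟩
          ((φ i + - φ j) + - ((φ i + - φ c) + - (φ j + - φ c))) + (σ * (s j + - s c) + - (φ j + - φ c))
            ≡⟨ solve 4 (λ a b c x → ((a :+ :- b) :+ :- ((a :+ :- c) :+ :- (b :+ :- c))) :+ x := x) refl (φ i) (φ j) (φ c)
                 (σ * (s j + - s c) + - (φ j + - φ c)) ⟩
          σ * (s j + - s c) + - (φ j + - φ c) ≡⟨ sym (F-generic c≢j (λ e → slope-distinct (i≢j ∘ sym) (c≢i ∘ sym) (c≢j ∘ sym)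
                                                    (trans (sym (slope-symmetric i≢j)) e))) ⟩
          F j c ∎
          where open ≡-Reasoning

      split : ∀ {i j} (i≢j : i ≢ j) → ∃[ r ] (Π (F i≢j i) ≡ (F i≢j i i * F i≢j i j) * r × Π (F i≢j j) ≡ (F i≢j j i * F i≢j j j) * r)
      split {i} {j} i≢j = Π-agree₂ (F i≢j i) (F i≢j j) i≢j (F-agree i≢j)

      W≢0 : W ≢ 0#
      W≢0 = Π-≢0 (nz ∘ el) (nz-≢0 ∘ el)

    -- Segre's lemma of tangents at the point at infinity: the slope of a chord is the mean of the two tangent slopes.
    chord-slope : ∀ {i j} → i ≢ j → 2# * slopeᵍ i j ≡ m i + m j
    chord-slope {i} {j} i≢j = begin
      2# * σ′ ≡⟨ solve 3 (λ σ a b → (:1 :+ :1) :* σ := (a :+ b) :+ ((σ :+ :- a) :+ (σ :+ :- b))) refl σ′ (m i) (m j) ⟩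
      (m i + m j) + ((σ′ + - m i) + (σ′ + - m j)) ≡⟨ cong ((m i + m j) +_) opposite ⟩
      (m i + m j) + 0# ≡⟨ +-identityʳ _ ⟩
      m i + m j ∎
      where
      open ≡-Reasoning
      σ′ r : Carrier
      σ′ = slopeᵍ i j
      r = proj₁ (split i≢j)
      Fi = proj₁ (proj₂ (split i≢j))
      Fj = proj₂ (proj₂ (split i≢j))
      r≢0 : r ≢ 0#
      r≢0 = *-≢0ʳ (λ e → *-≢0 W≢0 W≢0 (trans (sym (ΠF i≢j i)) (trans Fi e)))
      crossed : (σ′ + - m i) * (s i + - s j) ≡ (s j + - s i) * (σ′ + - m j)
      crossed = *-cancelˡ r≢0 (trans (*-comm r _) (trans (cong (_* r) (sym (cong₂ _*_
          (F-centre i≢j i (proj₂ (tangent-slope i) (i≢j ∘ sym))) (F-other i≢j (i≢j ∘ sym) refl))))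
        (trans (sym Fi) (trans (ΠF i≢j i) (trans (sym (ΠF i≢j j)) (trans Fj (trans (cong (_* r) (cong₂ _*_
          (F-other i≢j i≢j (slope-symmetric i≢j))
          (F-centre i≢j j (λ e → proj₂ (tangent-slope j) i≢j (trans (sym (slope-symmetric i≢j)) e))))) (*-comm _ r))))))))
      opposite : (σ′ + - m i) + (σ′ + - m j) ≡ 0#
      opposite = *-≡0 (s-≢ i≢j) (trans (solve 4 (λ a b x y → (a :+ :- b) :* (x :+ y) := x :* (a :+ :- b) :+ :- ((b :+ :- a) :* y))
        refl (s i) (s j) (σ′ + - m i) (σ′ + - m j)) (x≡y⇒x-y≡0 crossed))

    -- Cleared of denominators the relation includes `i = j`, so it can be added without
    -- distinguishing cases.
    chord : ∀ i j → 2# * (φ i + - φ j) ≡ (m i + m j) * (s i + - s j)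
    chord i j with i ≟F j
    ... | yes refl = solve 3 (λ a b c → (:1 :+ :1) :* (a :+ :- a) := c :* (b :+ :- b)) refl (φ i) (s i) (m i + m i)
    ... | no i≢j = trans (cong (2# *_) (sym (slope-* i≢j))) (trans (sym (*-assoc _ _ _))
      (cong (_* (s i + - s j)) (chord-slope i≢j)))

    module Quadratic {o p r : Fin q} (o≢p : o ≢ p) (p≢r : p ≢ r) (o≢r : o ≢ r) where
      v : Fin q → Carrier
      v i = s i + - s o

      A : Carrier
      A = (m p + - m o) * recip (v p)

      v-p≢0 : v p ≢ 0#
      v-p≢0 = s-≢ (o≢p ∘ sym)

      -- Adding `chord` around the triangle `i`, `o`, `p` eliminates `φ` and leaves a linear
      -- equation for `m i`.
      m-affine : ∀ i → m i ≡ m o + A * v i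
      m-affine i = *-cancelˡ v-p≢0 (begin
        v p * m i ≡⟨ solve 6 (λ mi mo mp si so sp → (sp :+ :- so) :* mi :=
            ((mi :+ mo) :* (si :+ :- so) :+ (mo :+ mp) :* (so :+ :- sp) :+ (mp :+ mi) :* (sp :+ :- si))
              :+ ((sp :+ :- so) :* mo :+ (mp :+ :- mo) :* (si :+ :- so))) refl (m i) (m o) (m p) (s i) (s o) (s p) ⟩
        ((m i + m o) * (s i + - s o) + (m o + m p) * (s o + - s p) + (m p + m i) * (s p + - s i))
          + (v p * m o + (m p + - m o) * v i)
          ≡⟨ cong (_+ (v p * m o + (m p + - m o) * v i)) (trans
               (sym (cong₂ _+_ (cong₂ _+_ (chord i o) (chord o p)) (chord p i)))
               (solve 4 (λ t a b c → t :* (a :+ :- b) :+ t :* (b :+ :- c) :+ t :* (c :+ :- a) := :0) refl 2# (φ i) (φ o) (φ p))) ⟩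
        0# + (v p * m o + (m p + - m o) * v i) ≡⟨ cong (λ x → 0# + (v p * m o + x * v i)) (sym (recip-unmul v-p≢0)) ⟩
        0# + (v p * m o + (A * v p) * v i) ≡⟨ solve 4 (λ x mo a vi → :0 :+ (x :* mo :+ (a :* x) :* vi) := x :* (mo :+ a :* vi)) refl (v p) (m o) A (v i) ⟩
        v p * (m o + A * v i) ∎)
        where open ≡-Reasoning

      quadratic : ∀ i → 2# * φ i ≡ 2# * φ o + 2# * m o * v i + A * (v i * v i)
      quadratic i = begin
        2# * φ i ≡⟨ solve 3 (λ t a b → t :* a := t :* b :+ t :* (a :+ :- b)) refl 2# (φ i) (φ o) ⟩
        2# * φ o + 2# * (φ i + - φ o) ≡⟨ cong (2# * φ o +_) (chord i o) ⟩
        2# * φ o + (m i + m o) * v i ≡⟨ cong (λ x → 2# * φ o + (x + m o) * v i) (m-affine i) ⟩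
        2# * φ o + ((m o + A * v i) + m o) * v i
          ≡⟨ solve 4 (λ f m a v → (:1 :+ :1) :* f :+ ((m :+ a :* v) :+ m) :* v := (:1 :+ :1) :* f :+ (:1 :+ :1) :* m :* v :+ a :* (v :* v)) refl (φ o) (m o) A (v i) ⟩
        2# * φ o + 2# * m o * v i + A * (v i * v i) ∎
        where open ≡-Reasoning

      -- Otherwise the graph would be a straight line containing three points of the arc.
      A≢0 : A ≢ 0#
      A≢0 A≡0 = not-collinear o≢p p≢r o≢r (*-cancelˡ 2≢0 (trans (line r p) (trans
          (solve 3 (λ t x y → (t :* x) :* y := (t :* y) :* x) refl (2# * m o) (v r) (v p)) (sym (line p r)))))
        where
        line : ∀ i j → 2# * ((φ i + - φ o) * v j) ≡ (2# * m o * v i) * v j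
        line i j = begin
          2# * ((φ i + - φ o) * v j) ≡⟨ solve 4 (λ t a b v → t :* ((a :+ :- b) :* v) := (t :* a :+ :- (t :* b)) :* v) refl 2# (φ i) (φ o) (v j) ⟩
          (2# * φ i + - (2# * φ o)) * v j ≡⟨ cong (λ x → (x + - (2# * φ o)) * v j) (quadratic i) ⟩
          ((2# * φ o + 2# * m o * v i + A * (v i * v i)) + - (2# * φ o)) * v j
            ≡⟨ cong (λ a → ((2# * φ o + 2# * m o * v i + a * (v i * v i)) + - (2# * φ o)) * v j) A≡0 ⟩
          ((2# * φ o + 2# * m o * v i + 0# * (v i * v i)) + - (2# * φ o)) * v j
            ≡⟨ solve 4 (λ f mv v w → ((f :+ mv :+ :0 :* (v :* v)) :+ :- f) :* w := mv :* w) refl (2# * φ o) (2# * m o * v i) (v i) (v j) ⟩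
          (2# * m o * v i) * v j ∎
          where open ≡-Reasoning

  module _ (𝒜 : Arc) where
    open Arc 𝒜

    conicForm : ∀ {P} → P ≢ 0V → (∀ {i j} → i ≢ j → det P (K i) (K j) ≢ 0#) →
      ∀ {o p r : Fin q} → o ≢ p → p ≢ r → o ≢ r → ConicForm 𝒜
    conicForm {P} P≢0 generic {o} {p} {r} o≢p p≢r o≢r with perp-basis P≢0 | nonzero-coordinate P≢0
    ... | L , M , ρ , ρ≢0 , L⨯M | α , αP = record
      { a = a ; b = b ; c = γ ; σ = v ; σ-injective = λ eq → s-injective (v-cancel eq)
      ; c≢0 = γK≢0 ; aK = aK ; bK = bK }
      where
      open ≡-Reasoning
      open PencilLines ρ≢0 L⨯M
      other : ∀ i → ∃[ j ] (i ≢ j)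
      other i with i ≟F o
      ... | yes refl = p , o≢p
      ... | no i≢o = o , i≢o
      K⨯P : ∀ i → K i ⨯ P ≢ 0V
      K⨯P i eq = generic (proj₂ (other i)) (begin
        det P (K i) (K j) ≡⟨ det-cyclic P (K i) (K j) ⟩
        det (K i) (K j) P ≡⟨ det-cyclic (K i) (K j) P ⟩
        det (K j) P (K i) ≡⟨ det-swap₂₃ (K j) P (K i) ⟩
        - (K j ∙ (K i ⨯ P)) ≡⟨ cong (λ X → - (K j ∙ X)) eq ⟩
        - (K j ∙ 0V) ≡⟨ cong -_ (∙-0V (K j)) ⟩
        - 0# ≡⟨ solve 0 (:- :0 := :0) refl ⟩
        0# ∎)
        where
        j : Fin q
        j = proj₁ (other i)
      -- There are `q + 1` lines through `P` and only `q` arc points, so some line `γ` through `P`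
      -- misses the arc and can serve as the line at infinity. The line `β` from `P` to `K o` meets
      -- the arc, hence differs from `γ`.
      missed : ∃[ x ] (∀ i → slope (K i) ≢ x)
      missed = missing (slope ∘ K) ℕₚ.≤-refl
      β γ : V
      γ = line (proj₁ missed)
      β = line (slope (K o))
      γK≢0 : ∀ i → γ ∙ K i ≢ 0#
      γK≢0 i = missed⇒off (K⨯P i) (proj₂ missed i)
      β⨯γ : ∃[ c ] (c ≢ 0# × β ⨯ γ ≡ c · (L ⨯ M))
      β⨯γ = line⨯line (proj₂ missed o)
      c : Carrier
      c = proj₁ β⨯γ * ρ
      c≢0 : c ≢ 0#
      c≢0 = *-≢0 (proj₁ (proj₂ β⨯γ)) ρ≢0
      β⨯γ≡cP : β ⨯ γ ≡ c · P
      β⨯γ≡cP = trans (proj₂ (proj₂ β⨯γ)) (trans (cong (proj₁ β⨯γ ·_) L⨯M) (·-· _ _ _))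
      γP≡0 : γ ∙ P ≡ 0#
      γP≡0 = *-≡0 c≢0 (trans (sym (∙-·ʳ γ c P)) (trans (cong (γ ∙_) (sym β⨯γ≡cP)) (det-XYX γ β)))
      βP≡0 : β ∙ P ≡ 0#
      βP≡0 = *-≡0 c≢0 (trans (sym (∙-·ʳ β c P)) (trans (cong (β ∙_) (sym β⨯γ≡cP)) (det-XXY β γ)))
      s φ : Fin q → Carrier
      s i = (β ∙ K i) * recip (γ ∙ K i)
      φ i = (α ∙ K i) * recip (γ ∙ K i)
      β≡ : ∀ i → β ∙ K i ≡ s i * (γ ∙ K i)
      β≡ i = sym (recip-unmul (γK≢0 i))
      α≡ : ∀ i → α ∙ K i ≡ φ i * (γ ∙ K i)
      α≡ i = sym (recip-unmul (γK≢0 i))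
      s-injective : ∀ {i j} → s i ≡ s j → i ≡ j
      s-injective {i} {j} eq with i ≟F j
      ... | yes i≡j = i≡j
      ... | no i≢j = ⊥-elim (*-≢0 c≢0 (generic i≢j) (begin
        c * det P (K i) (K j) ≡⟨ sym (∙-·ˡ c P _) ⟩
        (c · P) ∙ (K i ⨯ K j) ≡⟨ cong (_∙ (K i ⨯ K j)) (sym β⨯γ≡cP) ⟩
        (β ⨯ γ) ∙ (K i ⨯ K j) ≡⟨ binet β γ (K i) (K j) ⟩
        (β ∙ K i) * (γ ∙ K j) + - ((γ ∙ K i) * (β ∙ K j))
          ≡⟨ cong₂ (λ x y → x * (γ ∙ K j) + - ((γ ∙ K i) * y)) (β≡ i) (β≡ j) ⟩
        (s i * (γ ∙ K i)) * (γ ∙ K j) + - ((γ ∙ K i) * (s j * (γ ∙ K j)))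
          ≡⟨ cong (λ x → (x * (γ ∙ K i)) * (γ ∙ K j) + - ((γ ∙ K i) * (s j * (γ ∙ K j)))) eq ⟩
        (s j * (γ ∙ K i)) * (γ ∙ K j) + - ((γ ∙ K i) * (s j * (γ ∙ K j)))
          ≡⟨ solve 3 (λ s x y → (s :* x) :* y :+ :- (x :* (s :* y)) := :0) refl (s j) (γ ∙ K i) (γ ∙ K j) ⟩
        0# ∎))
      not-collinear : ∀ {i j l} → i ≢ j → j ≢ l → i ≢ l →
        (φ l + - φ i) * (s j + - s i) ≢ (φ j + - φ i) * (s l + - s i)
      -- The covector `ω` below would vanish at three independent vectors and so be zero, yet its
      -- value at `P` is `d`, because `α ∙ P` is `1#` while `β` and `γ` vanish at `P`.
      not-collinear {i} {j} {l} i≢j j≢l i≢l eq = i≢j (s-injective (sym (x-y≡0⇒x≡y (begin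
        d ≡⟨ solve 2 (λ d f → d := d :* (:1 :+ (:- f) :* :0) :+ (:- :0) :* :0) refl d (φ i) ⟩
        d * (1# + - φ i * 0#) + - 0# * 0# ≡⟨ solve 4 (λ d f e s → d :* (:1 :+ (:- f) :* :0) :+ (:- :0) :* :0 :=
            d :* (:1 :+ (:- f) :* :0) :+ (:- e) :* (:0 :+ (:- s) :* :0)) refl d (φ i) e (s i) ⟩
        d * (1# + - φ i * 0#) + - e * (0# + - s i * 0#)
          ≡⟨ cong₂ (λ x y → d * (x + - φ i * y) + - e * (0# + - s i * y)) (sym αP) (sym γP≡0) ⟩
        d * (α ∙ P + - φ i * (γ ∙ P)) + - e * (0# + - s i * (γ ∙ P))
          ≡⟨ cong (λ x → d * (α ∙ P + - φ i * (γ ∙ P)) + - e * (x + - s i * (γ ∙ P))) (sym βP≡0) ⟩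
        d * (α ∙ P + - φ i * (γ ∙ P)) + - e * (β ∙ P + - s i * (γ ∙ P)) ≡⟨ sym (ω-∙ P) ⟩
        ω ∙ P ≡⟨ cong (_∙ P) ω≡0 ⟩
        0V ∙ P ≡⟨ 0V-∙ P ⟩
        0# ∎))))
        where
        d e : Carrier
        d = s j + - s i
        e = φ j + - φ i
        -- the line joining the points of the graph over s i and s j
        ω : V
        ω = d · (α ⊕ (- φ i) · γ) ⊕ (- e) · (β ⊕ (- s i) · γ)
        ω-∙ : ∀ X → ω ∙ X ≡ d * (α ∙ X + - φ i * (γ ∙ X)) + - e * (β ∙ X + - s i * (γ ∙ X))
        ω-∙ X = trans (∙-⊕ˡ _ _ X) (cong₂ _+_
          (trans (∙-·ˡ d _ X) (cong (d *_) (trans (∙-⊕ˡ α _ X) (cong (α ∙ X +_) (∙-·ˡ _ γ X)))))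
          (trans (∙-·ˡ (- e) _ X) (cong (- e *_) (trans (∙-⊕ˡ β _ X) (cong (β ∙ X +_) (∙-·ˡ _ γ X))))))
        ωK : ∀ k → ω ∙ K k ≡ (γ ∙ K k) * ((φ k + - φ i) * d + - (e * (s k + - s i)))
        ωK k = trans (ω-∙ (K k)) (trans (cong₂ (λ x y → d * (x + - φ i * (γ ∙ K k)) + - e * (y + - s i * (γ ∙ K k))) (α≡ k) (β≡ k))
          (solve 7 (λ d e f f′ s s′ g → d :* (f :* g :+ (:- f′) :* g) :+ (:- e) :* (s :* g :+ (:- s′) :* g) :=
            g :* ((f :+ :- f′) :* d :+ :- (e :* (s :+ :- s′)))) refl d e (φ k) (φ i) (s k) (s i) (γ ∙ K k)))
        ωKi : ω ∙ K i ≡ 0#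
        ωKi = trans (ωK i) (solve 5 (λ g f d e s → g :* ((f :+ :- f) :* d :+ :- (e :* (s :+ :- s))) := :0) refl (γ ∙ K i) (φ i) d e (s i))
        ωKj : ω ∙ K j ≡ 0#
        ωKj = trans (ωK j) (solve 3 (λ g d e → g :* (e :* d :+ :- (e :* d)) := :0) refl (γ ∙ K j) d e)
        ωKl : ω ∙ K l ≡ 0#
        ωKl = trans (ωK l) (trans (cong (λ x → (γ ∙ K l) * (x + - (e * (s l + - s i)))) eq)
          (solve 2 (λ g x → g :* (x :+ :- x) := :0) refl (γ ∙ K l) (e * (s l + - s i))))
        ω≡0 : ω ≡ 0V
        ω≡0 = ·-≡0V (indep₃ (i≢l ∘ sym) i≢j (j≢l ∘ sym)) (trans (frame (K i) (K j) (K l) ω)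
          (trans (cong₂ (λ x y → x · (K j ⨯ K l) ⊕ y · (K l ⨯ K i) ⊕ (K l ∙ ω) · (K i ⨯ K j)) (trans (∙-comm _ ω) ωKi) (trans (∙-comm _ ω) ωKj))
          (trans (0·-⊕ _ _ _) (trans (cong (_· (K i ⨯ K j)) (trans (∙-comm _ ω) ωKl)) (0· _)))))
      open Graph s φ s-injective not-collinear
      open Quadratic o≢p p≢r o≢r
      v-cancel : ∀ {i j} → v i ≡ v j → s i ≡ s j
      v-cancel {i} {j} eq = x-y≡0⇒x≡y (trans (solve 3 (λ a b o → a :+ :- b := (a :+ :- o) :+ :- (b :+ :- o)) refl (s i) (s j) (s o)) (x≡y⇒x-y≡0 eq))
      b′ a b : V
      b′ = β ⊕ (- s o) · γ
      b = 2# · b′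
      -- This is `quadratic` solved for `v i * v i`, with `1`, `v` and `φ` made homogeneous as `γ`,
      -- `b′` and `α`.
      a = recip A · (2# · α ⊕ (- (2# * φ o)) · γ ⊕ (- (2# * m o)) · b′)
      b′K : ∀ i → b′ ∙ K i ≡ (γ ∙ K i) * v i
      b′K i = trans (∙-⊕ˡ β _ (K i)) (trans (cong₂ _+_ (β≡ i) (∙-·ˡ _ γ (K i)))
        (solve 3 (λ s o g → s :* g :+ (:- o) :* g := g :* (s :+ :- o)) refl (s i) (s o) (γ ∙ K i)))
      bK : ∀ i → b ∙ K i ≡ (γ ∙ K i) * (2# * v i)
      bK i = trans (∙-·ˡ 2# b′ (K i)) (trans (cong (2# *_) (b′K i))
        (solve 3 (λ t g v → t :* (g :* v) := g :* (t :* v)) refl 2# (γ ∙ K i) (v i)))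
      aK : ∀ i → a ∙ K i ≡ (γ ∙ K i) * (v i * v i)
      aK i = trans (∙-·ˡ (recip A) _ (K i)) (trans (*-comm _ _) (*-recip-cancel A≢0 (begin
        (2# · α ⊕ (- (2# * φ o)) · γ ⊕ (- (2# * m o)) · b′) ∙ K i
          ≡⟨ trans (∙-⊕ˡ _ _ (K i)) (cong₂ _+_ (trans (∙-⊕ˡ _ _ (K i)) (cong₂ _+_ (∙-·ˡ 2# α (K i)) (∙-·ˡ _ γ (K i)))) (∙-·ˡ _ b′ (K i))) ⟩
        2# * (α ∙ K i) + - (2# * φ o) * (γ ∙ K i) + - (2# * m o) * (b′ ∙ K i)
          ≡⟨ cong₂ (λ x y → 2# * x + - (2# * φ o) * (γ ∙ K i) + - (2# * m o) * y) (α≡ i) (b′K i) ⟩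
        2# * (φ i * (γ ∙ K i)) + - (2# * φ o) * (γ ∙ K i) + - (2# * m o) * ((γ ∙ K i) * v i)
          ≡⟨ solve 6 (λ t f g fo mo v → t :* (f :* g) :+ (:- (t :* fo)) :* g :+ (:- (t :* mo)) :* (g :* v) :=
               g :* (t :* f :+ :- (t :* fo :+ t :* mo :* v))) refl 2# (φ i) (γ ∙ K i) (φ o) (m o) (v i) ⟩
        (γ ∙ K i) * (2# * φ i + - (2# * φ o + 2# * m o * v i))
          ≡⟨ cong (λ x → (γ ∙ K i) * (x + - (2# * φ o + 2# * m o * v i))) (quadratic i) ⟩
        (γ ∙ K i) * (2# * φ o + 2# * m o * v i + A * (v i * v i) + - (2# * φ o + 2# * m o * v i))
          ≡⟨ solve 4 (λ g x y a → g :* (x :+ a :* (y :* y) :+ :- x) := (g :* (y :* y)) :* a) refl (γ ∙ K i) (2# * φ o + 2# * m o * v i) (v i) A ⟩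
        ((γ ∙ K i) * (v i * v i)) * A ∎)))

-- Odd orders, the characteristic, and the theorem

Distinct : ∀ {q} → Fin q → Fin q → Fin q → Set
Distinct o p r = o ≢ p × p ≢ r × o ≢ r

-- Three distinct indices anchor the quadratic fit. The alternative selects the counting argument,
-- or the explicit extension when these three are the whole arc.
odd-cases : ∀ q → ¬ (2 ∣ q) → q ≢ 1 → Σ (Fin q) λ o → Σ (Fin q) λ p → Σ (Fin q) λ r →
  Distinct o p r × (5 ℕ.≤ q ⊎ (∀ i → i ≡ o ⊎ i ≡ p ⊎ i ≡ r))
odd-cases 0 odd _ = ⊥-elim (odd (divides 0 refl))
odd-cases 1 _ q≢1 = ⊥-elim (q≢1 refl)
odd-cases 2 odd _ = ⊥-elim (odd (divides 1 refl))
odd-cases 3 _ _ = zero , suc zero , suc (suc zero) , ((λ ()) , (λ ()) , (λ ())) ,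
  inj₂ λ { zero → inj₁ refl ; (suc zero) → inj₂ (inj₁ refl) ; (suc (suc zero)) → inj₂ (inj₂ refl) }
odd-cases 4 odd _ = ⊥-elim (odd (divides 2 refl))
odd-cases (suc (suc (suc (suc (suc n))))) _ _ = zero , suc zero , suc (suc zero) , ((λ ()) , (λ ()) , (λ ())) ,
  inj₁ (ℕₚ.m≤m+n 5 n)

module Cardinality (𝔽 : Field) (q : ℕ) (enum : Field.Carrier 𝔽 ↔ Fin q) where
  open FiniteField 𝔽 q enum renaming (_+_ to _+ᶠ_)

  q≢1 : q ≢ 1
  q≢1 eq = 0≢1 (ix-injective (unique eq (ix 0#) (ix 1#)))
    where
    unique : ∀ {n} → n ≡ 1 → (i j : Fin n) → i ≡ j
    unique refl zero zero = refl

  -- In characteristic 2 the translation x ↦ x + 1 is an involution without fixed points.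
  odd⇒2≢0 : ¬ (2 ∣ q) → 1# +ᶠ 1# ≢ 0#
  odd⇒2≢0 odd 1+1≡0 = odd (divides k (trans q≡2k (ℕₚ.*-comm 2 k)))
    where
    M : Fin q → Fin q → ℕ
    M i j = χ (el j ≟ el i +ᶠ 1#)
    flip : ∀ {x y} → x ≡ y +ᶠ 1# → y ≡ x +ᶠ 1#
    flip {y = y} refl = trans (solve 1 (λ y → y := y :+ :0) refl y)
      (trans (cong (y +ᶠ_) (sym 1+1≡0)) (sym (+-assoc y 1# 1#)))
    M-symmetric : ∀ i j → M i j ≡ M j i
    M-symmetric i j = χ-cong (el j ≟ el i +ᶠ 1#) (el i ≟ el j +ᶠ 1#) flip flip
    k : ℕ
    k = proj₁ (#∑-symmetric M M-symmetric)
    row : ∀ i → #∑ (M i) ≡ 1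
    row i = trans (#∑-single (M i) (ix (el i +ᶠ 1#)) λ j j≢ → χ-no (el j ≟ el i +ᶠ 1#) λ e → j≢ (trans (sym (ix-el j)) (cong ix e)))
      (χ-yes (el (ix (el i +ᶠ 1#)) ≟ el i +ᶠ 1#) (el-ix _))
    diagonal : ∀ i → M i i ≡ 0
    diagonal i = χ-no (el i ≟ el i +ᶠ 1#) λ e → 1≢0 (trans (solve 2 (λ x o → o := (x :+ o) :+ :- x) refl (el i) 1#)
      (x≡y⇒x-y≡0 (sym e)))
    q≡2k : q ≡ 2 ℕ.* k
    q≡2k = begin
      q ≡⟨ sym (trans (#∑-const q 1) (ℕₚ.*-identityʳ q)) ⟩
      #∑ {q} (λ _ → 1) ≡⟨ sym (#∑-cong row) ⟩
      #∑ (λ i → #∑ (M i)) ≡⟨ proj₂ (#∑-symmetric M M-symmetric) ⟩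
      #∑ (λ i → M i i) ℕ.+ 2 ℕ.* k ≡⟨ cong (ℕ._+ 2 ℕ.* k) (trans (#∑-cong diagonal) (trans (#∑-const q 0) (ℕₚ.*-zeroʳ q))) ⟩
      2 ℕ.* k ∎
      where open ≡-Reasoning

open import Data.Nat using (_+_)

theorem3p1 : (q : ℕ) (𝔽 : Field) → Field.Carrier 𝔽 ↔ Fin q →
    (K : Fin q → Proj.Vec 𝔽 3) → Proj.IsArc 𝔽 K →
    IsGQ (Proj.Construction.structure 𝔽 K) (q ∸ 1) (q + 1) ×
    (¬ (2 ∣ q) → Isomorphic (Proj.Construction.structure 𝔽 K) (ASq.structure 𝔽))
theorem3p1 q 𝔽 enum 𝕂 isArc = quadrangle , conical
  where
  open FiniteField 𝔽 q enum using (ix; 0#)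
  open Arcs 𝔽 q enum
  open Models 𝔽 q enum
  open Structures 𝔽 q enum 𝕂 isArc using (arc)
  open Isos 𝔽 q enum 𝕂 isArc
  open Extensions 𝔽 q enum

  quadrangle : IsGQ (Proj.Construction.structure 𝔽 𝕂) (q ∸ 1) (q + 1)
  quadrangle = transferGQ (Coordinates.isomorphism tangents) (Model.isGQ arc tangents (ix 0#))
    where
    tangents : ∀ i → TangentPair arc i
    tangents i = proj₁ (TangentExistence.tangentPair arc i)

  conical : ¬ (2 ∣ q) → Isomorphic (Proj.Construction.structure 𝔽 𝕂) (ASq.structure 𝔽)
  conical odd with odd-cases q odd (Cardinality.q≢1 𝔽 q enum)
  -- Any choice of tangent pairs coordinatises the structure; the conic ones are taken here because
  -- their coordinates are those of AS(q).
  ... | o , p , r , (o≢p , p≢r , o≢r) , size = compose (Coordinates.isomorphism conic-tangents) (AS-isomorphism o)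
    where
    2≢0 = Cardinality.odd⇒2≢0 𝔽 q enum odd
    open SegreTheorem 𝔽 q enum 2≢0 using (conicForm)
    extension : (5 ℕ.≤ q ⊎ (∀ i → i ≡ o ⊎ i ≡ p ⊎ i ≡ r)) → ∃[ P ] (P ≢ _ × Extends arc P)
    extension (inj₁ 5≤q) = extension-≥5 arc odd 5≤q
    extension (inj₂ cover) = extension-3 arc o≢p p≢r o≢r cover
    form : Conics.ConicForm 𝔽 q enum 2≢0 arc
    form = let (P , P≢0 , extends) = extension size in conicForm arc P≢0 extends o≢p p≢r o≢r
    open Conics.ConicForm form
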